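{- Let $P$ be a $d$-dimensional prism-like polyhedron. Then for any choice of $b(P)$ (i.e., for any $d$-dimensional prism $P'=\Delta_1\times\cdots\times\Delta_m$ and any order-preserving injective map $f$ from the face lattice of $P$ to the face lattice of $P'$), the set $b(P)$ is an ample subset of $U=U_1\times\cdots\times U_m$, where $U_i$ is the vertex set of $\Delta_i$, and $b(P)$ admits a corner peeling.
   Context: A polyhedron is an intersection of finitely many closed halfspaces in $\mathbb R^d$. A prism is a Cartesian product $P'=\Delta_1\times\cdots\times\Delta_m$ of simplices; if $U_i$ is the vertex set of $\Delta_i$, then $U=U_1\times\cdots\times U_m$ is the vertex set of $P'$. A $d$-dimensional polyhedron $P$ is prism-like if there is an order-preserving injective map $f$ from the face lattice of $P$ (including the empty face and $P$) to the face lattice of a $d$-dimensional prism $P'$. Such $f$ maps vertices to vertices; $b(P)\subseteq U$ denotes the set of vertices $v'$ of $P'$ with $v'=f(v)$ for some vertex $v$ of $P$ (it depends on the choice of $P'$ and $f$). For a Cartesian product $U=U_1\times\cdots\times U_m$ of nonempty finite sets, a box is a set $B_1\times\cdots\times B_m$ with $\varnothing\ne B_i\subseteq U_i$. A generalized partition is a tuple $\Lambda=(\alpha_1,\dots,\alpha_m)$ with $\alpha_i$ a partition of $U_i$ into nonempty blocks; it defines a partition of $U$ into the boxes $P^1\times\cdots\times P^m$, $P^i\in\alpha_i$, and the minor-subproduct $M(\Lambda)=M_1\times\cdots\times M_m$, where $M_i$ is the set of blocks of $\alpha_i$. $M(\Lambda)$ is shattered by $S\subseteq U$ if $S$ meets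 every box of the box-partition. A copy of $M(\Lambda)$ is a set $W_1\times\cdots\times W_m$ where $W_i$ consists of exactly one element from each block of $\alpha_i$. $M(\Lambda)$ is strongly shattered by $S$ if $S$ contains a copy of it. $S$ is ample if every minor-subproduct of $U$ shattered by $S$ is strongly shattered by $S$. A corner of a set $S\subseteq U$ is an element $s\in S$ belonging to a unique inclusion-maximal box contained in $S$. A corner peeling of $S$ is a total ordering $s_1,\dots,s_n$ of $S$ such that for each $i=n,\dots,1$, $s_i$ is a corner of $\{s_1,\dots,s_i\}$. -}

module Defs where

open import Algebra.Bundles using (CommutativeRing)
open import Data.Fin as Fin using (Fin)
open import Data.Fin.Subset using (Subset; Nonempty) renaming (_∈_ to _∈ₛ_)
open import Data.List using (List)
open import Data.List.Relation.Unary.All using (All)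
open import Data.Nat using (ℕ; suc)
open import Data.Product using (Σ; ∃; ∃!; _×_; _,_; proj₁; proj₂)
open import Function.Bundles using (_⇔_)
open import Function.Definitions using (Injective)
open import Level using (0ℓ) renaming (suc to lsuc)
open import Relation.Binary.Bundles using (Poset)
open import Relation.Binary.Morphism.Bundles using (PosetHomomorphism)
open import Relation.Binary.PropositionalEquality using (_≡_)
open import Relation.Binary.Structures using (IsTotalOrder)
open import Relation.Nullary using (¬_)
open import Relation.Unary using (Pred; _∈_; _⊆_; _≐_; Satisfiable)

import Algebra.Properties.Semiring.Sum as Sum

-- The real numbers, given axiomatically: classically, a complete ordered
-- field is unique up to a unique isomorphism.

record CompleteOrderedField : Set₁ where
  infix 4 _≤_
  field
    commutativeRing : CommutativeRing 0ℓ 0ℓ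
  open CommutativeRing commutativeRing public
  field
    _≤_          : Carrier → Carrier → Set
    isTotalOrder : IsTotalOrder _≈_ _≤_
    0≉1          : ¬ (0# ≈ 1#)
    inverse      : ∀ x → ¬ (x ≈ 0#) → ∃ λ y → x * y ≈ 1#
    +-monoˡ-≤    : ∀ z {x y} → x ≤ y → x + z ≤ y + z
    *-nonNeg     : ∀ {x y} → 0# ≤ x → 0# ≤ y → 0# ≤ x * y

  UpperBound : Pred Carrier 0ℓ → Pred Carrier 0ℓ
  UpperBound S b = ∀ x → x ∈ S → x ≤ b

  field
    supremum : (S : Pred Carrier 0ℓ) → Satisfiable S → Satisfiable (UpperBound S) →
               ∃ λ s → s ∈ UpperBound S × (∀ b → b ∈ UpperBound S → s ≤ b)

------------------------------------------------------------------------
-- Cartesian products of finite sets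

module Combinatorics {m : ℕ} (size : Fin m → ℕ) where

  infix 4 _≗_ _∈ᵇ_

  U : Set
  U = (i : Fin m) → Fin (size i)

  _≗_ : U → U → Set
  u ≗ v = ∀ i → u i ≡ v i

  -- A product of subsets B₁ × ⋯ × Bₘ is given by its list of factors.
  Factors : Set
  Factors = (i : Fin m) → Subset (size i)

  _∈ᵇ_ : U → Factors → Set
  u ∈ᵇ B = ∀ i → u i ∈ₛ B i

  ∏ : Factors → Pred U 0ℓ
  ∏ B u = u ∈ᵇ B

  IsBox : Factors → Set
  IsBox B = ∀ i → Nonempty (B i)

  record Partition (n : ℕ) : Set where
    field
      #blocks  : ℕ
      block    : Fin #blocks → Subset n
      nonempty : ∀ j → Nonempty (block j)
      covers   : ∀ x → ∃ λ j → x ∈ₛ block j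
      disjoint : ∀ {x j k} → x ∈ₛ block j → x ∈ₛ block k → j ≡ k

  open Partition

  GeneralizedPartition : Set
  GeneralizedPartition = (i : Fin m) → Partition (size i)

  -- The points of the minor-subproduct M(Λ), i.e. the boxes of the
  -- partition of U defined by Λ.
  M : GeneralizedPartition → Set
  M Λ = (i : Fin m) → Fin (#blocks (Λ i))

  boxOf : (Λ : GeneralizedPartition) → M Λ → Factors
  boxOf Λ p i = block (Λ i) (p i)

  IsCopy : GeneralizedPartition → Factors → Set
  IsCopy Λ W = ∀ i j → ∃! _≡_ λ x → x ∈ₛ W i × x ∈ₛ block (Λ i) j

  Shatters : Pred U 0ℓ → GeneralizedPartition → Set
  Shatters S Λ = (p : M Λ) → ∃ λ u → u ∈ S × u ∈ᵇ boxOf Λ p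

  StronglyShatters : Pred U 0ℓ → GeneralizedPartition → Set
  StronglyShatters S Λ = ∃ λ W → IsCopy Λ W × ∏ W ⊆ S

  Ample : Pred U 0ℓ → Set
  Ample S = ∀ Λ → Shatters S Λ → StronglyShatters S Λ

  IsMaximalBox : Pred U 0ℓ → Factors → Set
  IsMaximalBox S B =
    IsBox B × ∏ B ⊆ S × (∀ B′ → IsBox B′ → ∏ B′ ⊆ S → ∏ B ⊆ ∏ B′ → ∏ B′ ⊆ ∏ B)

  IsCorner : Pred U 0ℓ → U → Set
  IsCorner S s =
    s ∈ S × ∃! (λ B B′ → ∏ B ≐ ∏ B′) (λ B → IsMaximalBox S B × s ∈ᵇ B)

  record CornerPeeling (S : Pred U 0ℓ) : Set where
    field
      n         : ℕ
      s         : Fin n → U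
      injective : Injective _≡_ _≗_ s
      exhausts  : ∀ u → u ∈ S ⇔ (∃ λ i → s i ≗ u)

    prefix : Fin n → Pred U 0ℓ
    prefix i u = ∃ λ j → j Fin.≤ i × s j ≗ u

    field
      corner    : ∀ i → IsCorner (prefix i) (s i)

------------------------------------------------------------------------
-- Polyhedra and prisms

module Geometry (ℝ : CompleteOrderedField) where

  open CompleteOrderedField ℝ
  open Sum semiring using (sum-syntax)

  -- Points of ℝᴵ.  Both I = Fin n and, for products, I = Σ (Fin m) (Fin ∘ n)
  -- are used.
  Point : Set → Set
  Point I = I → Carrier

  infix 4 _≋_

  _≋_ : {I : Set} → Point I → Point I → Set
  x ≋ y = ∀ i → x i ≈ y i

  _·_ : {n : ℕ} → Point (Fin n) → Point (Fin n) → Carrier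
  _·_ {n} c x = ∑[ i < n ] (c i * x i)

  AffinelyIndependent : {I : Set} {k : ℕ} → (Fin k → Point I) → Set
  AffinelyIndependent {I} {k} p =
    (w : Fin k → Carrier) →
    ∑[ j < k ] w j ≈ 0# →
    (∀ i → ∑[ j < k ] (w j * p j i) ≈ 0#) →
    ∀ j → w j ≈ 0#

  HasDimension : {I : Set} → Pred (Point I) 0ℓ → ℕ → Set
  HasDimension {I} C d =
    (∃ λ (p : Fin (suc d) → Point I) → (∀ j → p j ∈ C) × AffinelyIndependent p) ×
    ((p : Fin (suc (suc d)) → Point I) → (∀ j → p j ∈ C) → ¬ AffinelyIndependent p)

  -- A face is the intersection of C with a hyperplane {x | c ∙ x ≈ δ} such
  -- that c ∙ x ≤ δ is valid on C.  The normal c may be zero, which yields C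
  -- itself (δ = 0) and the empty face (δ = 1).  Different (c, δ) may describe
  -- the same face; faces are compared as sets of points.
  module Faces {I : Set} (_∙_ : Point I → Point I → Carrier) (C : Pred (Point I) 0ℓ) where

    record Face : Set where
      field
        normal : Point I
        offset : Carrier
        valid  : ∀ x → x ∈ C → normal ∙ x ≤ offset

      points : Pred (Point I) 0ℓ
      points x = x ∈ C × normal ∙ x ≈ offset

    open Face public

    faceLattice : Poset 0ℓ 0ℓ 0ℓ
    faceLattice = record
      { Carrier        = Face
      ; _≈_            = λ F G → points F ≐ points G
      ; _≤_            = λ F G → points F ⊆ points G
      ; isPartialOrder = record
        { isPreorder = record
          { isEquivalence = record
            { refl  = (λ x → x) , (λ x → x)
            ; sym   = λ e → proj₂ e , proj₁ e
            ; trans = λ e e′ → (λ x → proj₁ e′ (proj₁ e x)) , (λ x → proj₂ e (proj₂ e′ x))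
            }
          ; reflexive = proj₁
          ; trans     = λ F⊆G G⊆H x → G⊆H (F⊆G x)
          }
        ; antisym = λ F⊆G G⊆F → F⊆G , G⊆F
        }
      }

    IsVertexAt : Face → Point I → Set
    IsVertexAt F x = points F ≐ (x ≋_)

  record Halfspace (n : ℕ) : Set where
    field
      normal   : Point (Fin n)
      offset   : Carrier
      normal≉0 : ¬ (∀ i → normal i ≈ 0#)

    points : Pred (Point (Fin n)) 0ℓ
    points x = normal · x ≤ offset

  Polyhedron : ℕ → Set
  Polyhedron n = List (Halfspace n)

  ⟦_⟧ : {n : ℕ} → Polyhedron n → Pred (Point (Fin n)) 0ℓ
  ⟦ P ⟧ x = All (λ H → x ∈ Halfspace.points H) P

  -- The vertex set of the simplex is indexed by Fin (suc dim).
  record Simplex : Set where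
    field
      ambient     : ℕ
      dim         : ℕ
      vertex      : Fin (suc dim) → Point (Fin ambient)
      independent : AffinelyIndependent vertex

    points : Pred (Point (Fin ambient)) 0ℓ
    points x = ∃ λ (w : Fin (suc dim) → Carrier) →
      (∀ j → 0# ≤ w j) ×
      ∑[ j < suc dim ] w j ≈ 1# ×
      (∀ i → x i ≈ ∑[ j < suc dim ] (w j * vertex j i))

  record Prism : Set where
    field
      m : ℕ
      Δ : Fin m → Simplex

    open module Δ i = Simplex (Δ i) using (ambient; dim; vertex)

    Index : Set
    Index = Σ (Fin m) λ i → Fin (ambient i)

    points : Pred (Point Index) 0ℓ
    points x = ∀ i → (λ j → x (i , j)) ∈ Simplex.points (Δ i)

    dot : Point Index → Point Index → Carrier
    dot c x = ∑[ i < m ] ((λ j → c (i , j)) · (λ j → x (i , j)))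

    open Combinatorics (λ i → suc (dim i)) public

    vertexPoint : U → Point Index
    vertexPoint u (i , j) = vertex i (u i) j

  module PolyhedronFaces {n : ℕ} (P : Polyhedron n) = Faces _·_ ⟦ P ⟧
  module PrismFaces (P′ : Prism) = Faces (Prism.dot P′) (Prism.points P′)

  -- An order-preserving injective map of face lattices.  It is not required
  -- to reflect the order.
  record FaceMap {n : ℕ} (P : Polyhedron n) (P′ : Prism) : Set where
    private
      module L  = Poset (PolyhedronFaces.faceLattice P)
      module L′ = Poset (PrismFaces.faceLattice P′)
    field
      homomorphism : PosetHomomorphism (PolyhedronFaces.faceLattice P) (PrismFaces.faceLattice P′)

    open PosetHomomorphism homomorphism public renaming (⟦_⟧ to map)

    field
      injective : Injective L._≈_ L′._≈_ map

  record IsPrismLike (d : ℕ) {n : ℕ} (P : Polyhedron n) : Set where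
    field
      dimension      : HasDimension ⟦ P ⟧ d
      prism          : Prism
      prismDimension : HasDimension (Prism.points prism) d
      faceMap        : FaceMap P prism

  -- b(P) for the choice of P′ and f.
  b : {n : ℕ} {P : Polyhedron n} (P′ : Prism) → FaceMap P P′ → Pred (Prism.U P′) 0ℓ
  b {P = P} P′ f u =
    ∃ λ (F : PolyhedronFaces.Face P) →
      (∃ λ v → PolyhedronFaces.IsVertexAt P F v) ×
      PrismFaces.IsVertexAt P′ (FaceMap.map f F) (Prism.vertexPoint P′ u)

{-# OPTIONS --safe #-}

-- Let v be a vertex of P with f(v) = v′.  The faces of P′ at v′ form a Boolean
-- lattice of rank d, and the image under f of a flag of P at v is a strictly
-- increasing chain in it.  Hence f maps the edges of P at v bijectively to
-- those of P′ at v′, the tangent cone of P at v is generated by d linearly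
-- independent edge directions, and the face of P spanned by a set of edges at
-- v is mapped to the face of P′ spanned by the corresponding edges at v′.
--
-- Order b(P) by a linear functional on P that increases along all unbounded
-- edges, breaking ties lexicographically.  The descending edges at v span a
-- face of P without unbounded edges, so all vertices of its image belong to
-- b(P), and they lie below v: this makes v a corner of the set of vertices up
-- to v.  Moreover, v is the minimum of b(P) in a box as soon as no edge inside
-- the box descends from v, as in the simplex algorithm; ampleness follows from
-- these two properties of the order alone.

module Submission where

import Algebra.Properties.Ring
import Algebra.Properties.Semiring.Mult.TCOptimised
import Algebra.Properties.Semiring.Sum
import Algebra.Solver.Ring
import Data.Fin.Properties as Fin
import Data.Fin.Subset.Properties as Subset
import Data.Integer.Properties as ℤ
import Data.List.Membership.Propositional as List
import Data.List.Relation.Unary.Any.Properties as Any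
import Data.Nat.Properties as ℕ
import Data.Vec as Vec
import Data.Vec.Functional.Properties as Vector
import Data.Vec.Properties as Vec
import Relation.Binary.Reasoning.Setoid
open import Algebra.Bundles using (CommutativeRing; RawRing)
open import Algebra.Solver.Ring.AlmostCommutativeRing using (_-Raw-AlmostCommutative⟶_; fromCommutativeRing)
open import Axiom.ExcludedMiddle using (ExcludedMiddle)
open import Data.Empty using (⊥; ⊥-elim)
open import Data.Fin as Fin using (Fin; zero; suc; toℕ; punchIn; punchOut)
open import Data.Fin.Subset using (Subset; _⊂_; ∣_∣; ⁅_⁆) renaming (_∈_ to _∈ₛ_)
open import Data.Integer as ℤ using (ℤ; +_; -[1+_])
open import Data.List using (List; []; _∷_; length; lookup; cartesianProductWith; allFin)
open import Data.List.Membership.Propositional.Properties using (∈-allFin; ∈-lookup)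
open import Data.List.Relation.Unary.All as All using (All; []; _∷_)
open import Data.List.Relation.Unary.AllPairs using (AllPairs; []; _∷_)
open import Data.List.Relation.Unary.Any as Any using (Any; here; there)
open import Data.Maybe using (Maybe; just; nothing)
open import Data.Nat as ℕ using (ℕ; zero; suc; s≤s)
open import Data.Product using (Σ; ∃; _×_; _,_; proj₁; proj₂)
open import Data.Sum using (_⊎_; inj₁; inj₂; [_,_]′)
open import Data.Unit using () renaming (⊤ to Unit; tt to unit)
open import Data.Vec.Functional using (Vector; insertAt; removeAt) renaming (_∷_ to _∷ᵥ_)
open import Defs
open import Function using (_∘_; mk⇔)
open import Level using (0ℓ)
open import Relation.Binary.Definitions using (tri<; tri≈; tri>)
open import Relation.Binary.PropositionalEquality as ≡ using (_≡_; _≢_)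
open import Relation.Binary.Structures using (IsTotalOrder)
open import Relation.Nullary using (¬_; Dec; yes; no; does; contradiction)
open import Relation.Nullary.Decidable using (dec-true)
open import Relation.Unary using (Pred; _∈_; _⊆_; _≐_; Satisfiable)


-- The obstacle is how little is known about f: it is monotone and injective, but it is not assumed
-- to reflect the order or to respect rank, and a vertex of f(G) need not come from a vertex of G.
-- Everything is drawn from one fact, `edges-injective`: a face of P whose image passes through u is
-- determined by the edges of this image at u. The prism has D edges at u, and D ≤ d because u and
-- its neighbours are affinely independent. A flag at v is as long as the dimension d permits, so
-- its image fills the whole range of edge sets and leaves no slack: each extreme ray at v gets
-- exactly one edge of P′, distinct rays get distinct ones, and a family of D ≤ d vectors that spans
-- dimension d is independent. The same fact is used again to show that a bounded edge of P ends in
-- a vertex sent to the neighbour of u (`EdgeEnd`), that the image of the face spanned by J has no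
-- edges at u besides J, and that a vertex of P lies in a spanned face as soon as its image lies in
-- the image of that face (`vertex∈face`), which replaces the missing reflection of the order.

module Classical (em : ExcludedMiddle 0ℓ) where

  by-contradiction : {A : Set} → ¬ ¬ A → A
  by-contradiction {A} ¬¬a with em {A}
  ... | yes a = a
  ... | no ¬a = ⊥-elim (¬¬a ¬a)

  ¬∀⇒∃¬ : {A : Set} {B : A → Set} → ¬ (∀ x → B x) → ∃ λ x → ¬ B x
  ¬∀⇒∃¬ ¬∀ = by-contradiction λ ¬∃ → ¬∀ λ x → by-contradiction λ ¬b → ¬∃ (x , ¬b)

  opaque

    -- Choice made total by a default, so that every edge of P′ can be given a direction before it
    -- is known to carry a ray. The last component makes the default recognizable.
    pick : {A : Set} (Q : Pred A 0ℓ) (default : A) → ∃ λ x → (∀ {y} → Q y → Q x) × (¬ ∃ Q → x ≡ default)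
    pick Q default with em {∃ Q}
    ... | yes (x , q) = x , (λ _ → q) , λ ¬∃ → contradiction (x , q) ¬∃
    ... | no ¬∃       = default , (λ q → contradiction (_ , q) ¬∃) , λ _ → ≡.refl

    -- Predicates are turned into bit vectors because the counting arguments need cardinalities and
    -- strict inclusions.
    ⟪_⟫ : {n : ℕ} → Pred (Fin n) 0ℓ → Subset n
    ⟪ Q ⟫ = Vec.tabulate λ x → does (em {Q x})

  opaque
    unfolding ⟪_⟫

    ∈⟪⟫⁺ : {n : ℕ} {Q : Pred (Fin n) 0ℓ} {x : Fin n} → Q x → x ∈ₛ ⟪ Q ⟫
    ∈⟪⟫⁺ {Q = Q} {x} q =
      Vec.lookup⇒[]= x _ (≡.trans (Vec.lookup∘tabulate _ x) (dec-true (em {Q x}) q))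

    ∈⟪⟫⁻ : {n : ℕ} {Q : Pred (Fin n) 0ℓ} {x : Fin n} → x ∈ₛ ⟪ Q ⟫ → Q x
    ∈⟪⟫⁻ {Q = Q} {x} x∈ with em {Q x} | ≡.trans (≡.sym (Vec.lookup∘tabulate (λ y → does (em {Q y})) x)) (Vec.[]=⇒lookup x∈)
    ... | yes q | _  = q
    ... | no _  | ()

-- Points of a product: changing one coordinate, and orders that sweep a subset

module _ {m : ℕ} {A : Fin m → Set} where

  _[_≔_] : ((i : Fin m) → A i) → (i : Fin m) → A i → (i : Fin m) → A i
  (u [ i ≔ x ]) k with k Fin.≟ i
  ... | yes ≡.refl = x
  ... | no _       = u k

  ≔-same : ∀ u i (x : A i) → (u [ i ≔ x ]) i ≡ x
  ≔-same u i x with i Fin.≟ i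
  ... | yes ≡.refl = ≡.refl
  ... | no i≢i     = contradiction ≡.refl i≢i

  ≔-other : ∀ u i (x : A i) {k} → k ≢ i → (u [ i ≔ x ]) k ≡ u k
  ≔-other u i x {k} k≢i with k Fin.≟ i
  ... | yes k≡i = contradiction k≡i k≢i
  ... | no _    = ≡.refl

  ≔-all : (B : ∀ i → A i → Set) → ∀ u i (x : A i) → (∀ k → k ≢ i → B k (u k)) → B i x →
          ∀ k → B k ((u [ i ≔ x ]) k)
  ≔-all B u i x b bx k with k Fin.≟ i
  ... | yes ≡.refl = bx
  ... | no k≢i     = b k k≢i

-- A linear functional in general position on the vertices of a polyhedron P
-- induces on b(P) an order of the following kind.

module _ {m : ℕ} {size : Fin m → ℕ} where
  open Combinatorics size

  record IsSweep (S : Pred U 0ℓ) (_≺_ : U → U → Set) : Set where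
    field
      S-resp          : ∀ {u w} → u ≗ w → u ∈ S → w ∈ S
      ≺-respˡ         : ∀ {u u′ w} → u ≗ u′ → u ≺ w → u′ ≺ w
      ≺-respʳ         : ∀ {u w w′} → w ≗ w′ → u ≺ w → u ≺ w′
      ≺-irrefl        : ∀ {u} → ¬ (u ≺ u)
      ≺-trans         : ∀ {u w t} → u ≺ w → w ≺ t → u ≺ t
      ≺-total         : ∀ u w → u ∈ S → w ∈ S → u ≺ w ⊎ u ≗ w ⊎ w ≺ u
      descending-box  : ∀ u B → u ∈ S → u ∈ᵇ B →
                        (∀ i x → x ∈ₛ B i → x ≢ u i → (u [ i ≔ x ]) ∈ S × (u [ i ≔ x ]) ≺ u) →
                        ∀ w → w ∈ᵇ B → w ∈ S × ¬ (u ≺ w)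
      local-minimum   : ∀ u B → u ∈ S → u ∈ᵇ B →
                        (∀ i x → x ∈ₛ B i → (u [ i ≔ x ]) ∈ S → ¬ ((u [ i ≔ x ]) ≺ u)) →
                        ∀ w → w ∈ᵇ B → w ∈ S → ¬ (w ≺ u)

  -- Coordinates are changed one at a time on the way from `u` to `w`, so closure under a single
  -- replacement inside the box is enough.
  ∈-box : ∀ {S : Pred U 0ℓ} → (∀ {u w} → u ≗ w → u ∈ S → w ∈ S) →
          ∀ B u → u ∈ S → u ∈ᵇ B → (∀ w i x → w ∈ S → w ∈ᵇ B → x ∈ₛ B i → (w [ i ≔ x ]) ∈ S) →
          ∀ w → w ∈ᵇ B → w ∈ S
  ∈-box {S} S-resp B u u∈S u∈B closed w w∈B =
    let w′ , w′∈S , _ , agrees = path (allFin m) in S-resp (λ i → agrees (∈-allFin i)) w′∈S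
    where
    path : (is : List (Fin m)) → ∃ λ w′ → w′ ∈ S × w′ ∈ᵇ B × (∀ {i} → i List.∈ is → w′ i ≡ w i)
    path []       = u , u∈S , u∈B , λ ()
    path (i ∷ is) =
      let w′ , w′∈S , w′∈B , agrees = path is
      in w′ [ i ≔ w i ] , closed w′ i (w i) w′∈S w′∈B (w∈B i) ,
         ≔-all (λ k x → x ∈ₛ B k) w′ i (w i) (λ k _ → w′∈B k) (w∈B i) ,
         λ {k} k∈ → ≔-all (λ k x → k List.∈ (i ∷ is) → x ≡ w k) w′ i (w i)
           (λ { k k≢i (here k≡i) → contradiction k≡i k≢i ; k _ (there k∈) → agrees k∈ }) (λ _ → ≡.refl) k k∈

-- Listing S in increasing order; corner peeling and ampleness from the order

enumerate : (m : ℕ) (size : Fin m → ℕ) → List (Combinatorics.U size)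
enumerate zero    size = (λ ()) ∷ []
enumerate (suc m) size =
  cartesianProductWith (λ { x u zero → x ; x u (suc i) → u i }) (allFin (size zero)) (enumerate m (size ∘ suc))

∈-enumerate : (m : ℕ) (size : Fin m → ℕ) (u : Combinatorics.U size) →
              Any (Combinatorics._≗_ size u) (enumerate m size)
∈-enumerate zero    size u = here λ ()
∈-enumerate (suc m) size u =
  Any.cartesianProductWith⁺ _ (λ { ≡.refl e zero → ≡.refl ; ≡.refl e (suc i) → e i })
    (∈-allFin (u zero)) (∈-enumerate m (size ∘ suc) (u ∘ suc))

AllPairs-lookup : {A : Set} {R : A → A → Set} {xs : List A} → AllPairs R xs →
                  ∀ {i j} → i Fin.< j → R (lookup xs i) (lookup xs j)
AllPairs-lookup (r ∷ _)  {zero}  {suc j} _       = All.lookup r (∈-lookup j)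
AllPairs-lookup (_ ∷ rs) {suc i} {suc j} (ℕ.s≤s i<j) = AllPairs-lookup rs i<j

module Sweep (em : ExcludedMiddle 0ℓ) {m : ℕ} (size : Fin m → ℕ) {S : Pred (Combinatorics.U size) 0ℓ}
             {_≺_ : Combinatorics.U size → Combinatorics.U size → Set} (sweep : IsSweep S _≺_) where
  open Combinatorics size
  open Classical em
  open IsSweep sweep
  open Partition

  ≗-sym : {u w : U} → u ≗ w → w ≗ u
  ≗-sym e i = ≡.sym (e i)

  ≗-trans : {u w t : U} → u ≗ w → w ≗ t → u ≗ t
  ≗-trans e e′ i = ≡.trans (e i) (e′ i)

  Sorted : List U → Set
  Sorted us = AllPairs _≺_ us × All S us

  -- An element already listed up to `_≗_` is dropped, which keeps the order of the list strict. The
  -- clause for arbitrary `Q` carries the bound by the head of the list through the recursive call.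
  insert : ∀ u → u ∈ S → ∀ us → Sorted us →
           ∃ λ us′ → Sorted us′ ×
                     (∀ {Q : Pred U 0ℓ} → All Q us → Q u → All Q us′) ×
                     (∀ w → (w ≗ u) ⊎ Any (w ≗_) us → Any (w ≗_) us′)
  insert u u∈S [] sorted =
    u ∷ [] , (([] ∷ []) , u∈S ∷ []) , (λ _ q → q ∷ []) , λ { w (inj₁ e) → here e }
  insert u u∈S (x ∷ us) (x≺us ∷ ordered , x∈S ∷ us⊆S) with ≺-total u x u∈S x∈S
  ... | inj₁ u≺x =
    u ∷ x ∷ us ,
    ((u≺x ∷ All.map (≺-trans u≺x) x≺us) ∷ x≺us ∷ ordered , u∈S ∷ x∈S ∷ us⊆S) ,
    (λ qs q → q ∷ qs) , λ { w (inj₁ e) → here e ; w (inj₂ w∈) → there w∈ }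
  ... | inj₂ (inj₁ u≗x) =
    x ∷ us , (x≺us ∷ ordered , x∈S ∷ us⊆S) , (λ qs _ → qs) ,
    λ { w (inj₁ e) → here (≗-trans e u≗x) ; w (inj₂ w∈) → w∈ }
  ... | inj₂ (inj₂ x≺u) with insert u u∈S us (ordered , us⊆S)
  ...   | us′ , (ordered′ , us′⊆S) , all′ , any′ =
    x ∷ us′ , (all′ x≺us x≺u ∷ ordered′ , x∈S ∷ us′⊆S) ,
    (λ { (q′ ∷ qs) q → q′ ∷ all′ qs q }) ,
    λ { w (inj₁ e) → there (any′ w (inj₁ e))
      ; w (inj₂ (here e)) → here e
      ; w (inj₂ (there w∈)) → there (any′ w (inj₂ w∈)) }

  sort : ∀ us → ∃ λ us′ → Sorted us′ × (∀ w → w ∈ S → Any (w ≗_) us → Any (w ≗_) us′)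
  sort [] = [] , ([] , []) , λ _ _ ()
  sort (u ∷ us) with sort us | em {u ∈ S}
  ... | us′ , sorted , any | no u∉S =
    us′ , sorted ,
    λ { w w∈S (here e) → contradiction (S-resp e w∈S) u∉S ; w w∈S (there w∈) → any w w∈S w∈ }
  ... | us′ , sorted , any | yes u∈S with insert u u∈S us′ sorted
  ...   | us″ , sorted″ , _ , any″ =
    us″ , sorted″ ,
    λ { w w∈S (here e) → any″ w (inj₁ e) ; w w∈S (there w∈) → any″ w (inj₂ (any w w∈S w∈)) }

  private
    listing  = sort (enumerate m size)
    elements = proj₁ listing

  n : ℕ
  n = length elements

  s : Fin n → U
  s = lookup elements

  s∈S : ∀ i → s i ∈ S
  s∈S i = All.lookup (proj₂ (proj₁ (proj₂ listing))) (∈-lookup i)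

  s-mono : ∀ {i j} → i Fin.< j → s i ≺ s j
  s-mono = AllPairs-lookup (proj₁ (proj₁ (proj₂ listing)))

  s-surjective : ∀ u → u ∈ S → ∃ λ i → s i ≗ u
  s-surjective u u∈S with proj₂ (proj₂ listing) u u∈S (∈-enumerate m size u)
  ... | u∈ = Any.index u∈ , ≗-sym (Any.lookup-index u∈)

  s-reflects-< : ∀ {i j} → s i ≺ s j → i Fin.< j
  s-reflects-< {i} {j} si≺sj with i Fin.<? j
  ... | yes i<j = i<j
  ... | no i≮j with ℕ.m≤n⇒m<n∨m≡n (ℕ.≮⇒≥ i≮j)
  ...   | inj₁ j<i = contradiction (≺-trans si≺sj (s-mono j<i)) ≺-irrefl
  ...   | inj₂ j≡i with Fin.toℕ-injective j≡i
  ...     | ≡.refl = contradiction si≺sj ≺-irrefl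

  s-injective : ∀ {i j} → s i ≗ s j → i ≡ j
  s-injective {i} {j} e with ℕ.<-cmp (toℕ i) (toℕ j)
  ... | tri< i<j _ _ = contradiction (≺-respˡ e (s-mono i<j)) ≺-irrefl
  ... | tri≈ _ i≡j _ = Fin.toℕ-injective i≡j
  ... | tri> _ _ j<i = contradiction (≺-respˡ (≗-sym e) (s-mono j<i)) ≺-irrefl

  -- The candidate for the unique maximal box at `u`: a box through `u` contains the lines through
  -- `u` in its directions, and these already force it into this one.
  descending : U → Factors
  descending u i = ⟪ (λ x → x ≡ u i ⊎ ((u [ i ≔ x ]) ∈ S × (u [ i ≔ x ]) ≺ u)) ⟫

  ∈-descending : ∀ u → u ∈ᵇ descending u
  ∈-descending u i = ∈⟪⟫⁺ (inj₁ ≡.refl)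

  descending-below : ∀ u → u ∈ S → ∀ w → w ∈ᵇ descending u → w ∈ S × ¬ (u ≺ w)
  descending-below u u∈S = descending-box u (descending u) u∈S (∈-descending u) λ i x x∈ x≢ →
    [ (λ x≡ → contradiction x≡ x≢) , (λ p → p) ]′ (∈⟪⟫⁻ x∈)

  -- A prefix consists of the elements of S that are not above its last element. By
  -- `descending-below` the descending box of that element lies in the prefix, and every box of the
  -- prefix through the element lies in the descending box; a largest such box is the only maximal
  -- one.
  corner-peeling : CornerPeeling S
  corner-peeling = record
    { n         = n
    ; s         = s
    ; injective = s-injective
    ; exhausts  = λ u → mk⇔ (s-surjective u) λ { (i , e) → S-resp e (s∈S i) }
    ; corner    = corner
    }
    where
    Prefix : Fin n → Pred U 0ℓ
    Prefix i u = ∃ λ j → j Fin.≤ i × s j ≗ u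

    prefix⁺ : ∀ i u → u ∈ S → ¬ (s i ≺ u) → u ∈ Prefix i
    prefix⁺ i u u∈S si⊀u with s-surjective u u∈S
    ... | j , e = j , ℕ.≮⇒≥ (λ i<j → si⊀u (≺-respʳ e (s-mono i<j))) , e

    prefix⁻ : ∀ i u → u ∈ Prefix i → u ∈ S × ¬ (s i ≺ u)
    prefix⁻ i u (j , j≤i , e) =
      S-resp e (s∈S j) , λ si≺u → ℕ.<⇒≱ (s-reflects-< (≺-respʳ (≗-sym e) si≺u)) j≤i

    corner : ∀ i → IsCorner (Prefix i) (s i)
    corner i =
      (i , ℕ.≤-refl , λ _ → ≡.refl) , B ,
      ((nonempty-B , B⊆ , λ B′ _ B′⊆ B⊆B′ → largest B′ B′⊆ (B⊆B′ s∈B)) , s∈B) , unique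
      where
      B : Factors
      B = descending (s i)
      s∈B : s i ∈ᵇ B
      s∈B = ∈-descending (s i)
      nonempty-B : IsBox B
      nonempty-B k = s i k , s∈B k
      B⊆ : ∀ {u} → u ∈ᵇ B → u ∈ Prefix i
      B⊆ {u} u∈B with descending-below (s i) (s∈S i) u u∈B
      ... | u∈S , si⊀u = prefix⁺ i u u∈S si⊀u
      largest : ∀ B′ → (∀ {u} → u ∈ᵇ B′ → u ∈ Prefix i) → s i ∈ᵇ B′ → ∀ {u} → u ∈ᵇ B′ → u ∈ᵇ B
      largest B′ B′⊆ s∈B′ {u} u∈B′ k with u k Fin.≟ s i k
      ... | yes uk≡ = ∈⟪⟫⁺ (inj₁ uk≡)
      ... | no uk≢ with prefix⁻ i w (B′⊆ (≔-all (λ k x → x ∈ₛ B′ k) (s i) k (u k) (λ l _ → s∈B′ l) (u∈B′ k)))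
        where w = s i [ k ≔ u k ]
      ...   | w∈S , si⊀w with ≺-total _ (s i) w∈S (s∈S i)
      ...     | inj₁ w≺s        = ∈⟪⟫⁺ (inj₂ (w∈S , w≺s))
      ...     | inj₂ (inj₁ w≗s) = contradiction (≡.trans (≡.sym (≔-same (s i) k (u k))) (w≗s k)) uk≢
      ...     | inj₂ (inj₂ s≺w) = contradiction s≺w si⊀w
      unique : ∀ {B′} → IsMaximalBox (Prefix i) B′ × s i ∈ᵇ B′ → (∀ {u} → u ∈ᵇ B → u ∈ᵇ B′) × (∀ {u} → u ∈ᵇ B′ → u ∈ᵇ B)
      unique {B′} ((_ , B′⊆ , maximal) , s∈B′) =
        maximal B nonempty-B B⊆ (largest B′ B′⊆ s∈B′) , largest B′ B′⊆ s∈B′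

  -- Let k be least such that the first k + 1 elements of S still shatter Λ,
  -- and let s be the last of them.  Some box p₀ of Λ is met only by s, so a
  -- block c of coordinate i is met by the descending box of s: apply
  -- local-minimum to p₀ together with the box obtained from p₀ by passing to c.
  ample : U → Ample S
  -- All representatives lie in the descending box of `t`, which is contained in S; hence so is the
  -- copy formed from them.
  ample u₀ Λ shattered = W , W-copy , λ {w} w∈W → proj₁ (descending-below t t∈S w λ i →
    let c , w≡ = ∈⟪⟫⁻ (w∈W i) in ≡.subst (_∈ₛ descending t i) (≡.sym w≡) (proj₁ (proj₂ (representative i c))))
    where
    Meets : ℕ → M Λ → Set
    Meets k p = ∃ λ j → toℕ j ℕ.< k × s j ∈ᵇ boxOf Λ p

    all-meet : ∀ p → Meets n p
    all-meet p with shattered p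
    ... | u , u∈S , u∈p with s-surjective u u∈S
    ...   | j , e = j , Fin.toℕ<n j , λ i → ≡.subst (_∈ₛ boxOf Λ p i) (≡.sym (e i)) (u∈p i)

    threshold : ∀ k → (∀ p → Meets k p) → ∃ λ k → (∀ p → Meets (suc k) p) × ∃ λ p → ¬ Meets k p
    -- `u₀` lies in some box of the partition, and no element at all is available to meet it.
    threshold zero meets with meets (λ i → proj₁ (covers (Λ i) (u₀ i)))
    ... | _ , () , _
    threshold (suc k) meets with em {∀ p → Meets k p}
    ... | yes meets′ = threshold k meets′
    ... | no ¬meets  = k , meets , ¬∀⇒∃¬ ¬meets

    k : ℕ
    k = proj₁ (threshold n all-meet)
    meets : ∀ p → Meets (suc k) p
    meets = proj₁ (proj₂ (threshold n all-meet))
    p₀ : M Λ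
    p₀ = proj₁ (proj₂ (proj₂ (threshold n all-meet)))
    misses : ¬ Meets k p₀
    misses = proj₂ (proj₂ (proj₂ (threshold n all-meet)))

    top : Fin n
    top = proj₁ (meets p₀)
    t : U
    t = s top
    t∈S : t ∈ S
    t∈S = s∈S top
    t∈p₀ : t ∈ᵇ boxOf Λ p₀
    t∈p₀ = proj₂ (proj₂ (meets p₀))
    top≡k : toℕ top ≡ k
    top≡k = ℕ.≤-antisym (ℕ.≤-pred (proj₁ (proj₂ (meets p₀)))) (ℕ.≮⇒≥ λ top<k → misses (top , top<k , t∈p₀))

    lower-misses : ∀ w → w ∈ S → w ≺ t → ¬ (w ∈ᵇ boxOf Λ p₀)
    lower-misses w w∈S w≺t w∈p₀ with s-surjective w w∈S
    ... | j , e = misses (j , ≡.subst (toℕ j ℕ.<_) top≡k (s-reflects-< (≺-respˡ (≗-sym e) w≺t)) ,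
                          λ i → ≡.subst (_∈ₛ boxOf Λ p₀ i) (≡.sym (e i)) (w∈p₀ i))

    representative : ∀ i c → ∃ λ x → x ∈ₛ descending t i × x ∈ₛ block (Λ i) c
    representative i c with c Fin.≟ p₀ i
    ... | yes ≡.refl = t i , ∈-descending t i , t∈p₀ i
    ... | no c≢ = x , result
      where
      q : M Λ
      q = p₀ [ i ≔ c ]
      R : Factors
      R k = ⟪ (λ x → x ∈ₛ block (Λ k) (p₀ k) ⊎ x ∈ₛ block (Λ k) (q k)) ⟫
      lower : ∃ λ w → w ∈ S × w ≺ t × w ∈ᵇ boxOf Λ q
      lower with meets q
      ... | j , j<sk , j∈q with ℕ.m≤n⇒m<n∨m≡n (ℕ.≤-pred j<sk)
      ...   | inj₁ j<k = s j , s∈S j , s-mono (≡.subst (toℕ j ℕ.<_) (≡.sym top≡k) j<k) , j∈q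
      ...   | inj₂ j≡k with Fin.toℕ-injective (≡.trans j≡k (≡.sym top≡k))
      -- If the element were `t` itself, its coordinate `i` would lie in two different blocks.
      ...     | ≡.refl = contradiction
                  (disjoint (Λ i) (≡.subst (λ c → t i ∈ₛ block (Λ i) c) (≔-same p₀ i c) (j∈q i)) (t∈p₀ i)) c≢
      w = proj₁ lower
      neighbour : ∃ λ k → ∃ λ x → x ∈ₛ R k × (t [ k ≔ x ]) ∈ S × (t [ k ≔ x ]) ≺ t
      neighbour = by-contradiction λ ¬∃ →
        local-minimum t R t∈S (λ k → ∈⟪⟫⁺ (inj₁ (t∈p₀ k)))
          (λ k x x∈R ∈S ≺t → ¬∃ (k , x , x∈R , ∈S , ≺t))
          w (λ k → ∈⟪⟫⁺ (inj₂ (proj₂ (proj₂ (proj₂ lower)) k))) (proj₁ (proj₂ lower)) (proj₁ (proj₂ (proj₂ lower)))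
      step : ∀ k x → x ∈ₛ R k → (t [ k ≔ x ]) ∈ S → (t [ k ≔ x ]) ≺ t →
             ∃ λ x → x ∈ₛ descending t i × x ∈ₛ block (Λ i) c
      step k x x∈R ∈S ≺t with ∈⟪⟫⁻ x∈R
      ... | inj₁ x∈p₀ = contradiction (≔-all (λ k x → x ∈ₛ boxOf Λ p₀ k) t k x (λ l _ → t∈p₀ l) x∈p₀)
                          (lower-misses _ ∈S ≺t)
      ... | inj₂ x∈q with k Fin.≟ i
      ...   | yes ≡.refl = x , ∈⟪⟫⁺ (inj₂ (∈S , ≺t)) , x∈q
      ...   | no k≢i = contradiction
                (≔-all (λ k x → x ∈ₛ boxOf Λ p₀ k) t k x (λ l _ → t∈p₀ l)x∈q)
                (lower-misses _ ∈S ≺t)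
      found = step (proj₁ neighbour) (proj₁ (proj₂ neighbour)) (proj₁ (proj₂ (proj₂ neighbour)))
                   (proj₁ (proj₂ (proj₂ (proj₂ neighbour)))) (proj₂ (proj₂ (proj₂ (proj₂ neighbour))))
      x = proj₁ found
      result = proj₂ found

    W : Factors
    W i = ⟪ (λ x → ∃ λ c → x ≡ proj₁ (representative i c)) ⟫

    W-copy : IsCopy Λ W
    W-copy i c = proj₁ (representative i c) ,
      (∈⟪⟫⁺ (c , ≡.refl) , proj₂ (proj₂ (representative i c))) ,
      λ { (y∈W , y∈c) → unique (∈⟪⟫⁻ y∈W) y∈c }
      where
      unique : ∀ {y} → (∃ λ c′ → y ≡ proj₁ (representative i c′)) → y ∈ₛ block (Λ i) c →
               proj₁ (representative i c) ≡ y
      unique (c′ , ≡.refl) y∈c with disjoint (Λ i) y∈c (proj₂ (proj₂ (representative i c′)))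
      ... | ≡.refl = ≡.refl

-- A ring solver with integer coefficients

module RingSolver (R : CommutativeRing 0ℓ 0ℓ) where
  open CommutativeRing R
  open Algebra.Properties.Ring ring
  open Algebra.Properties.Semiring.Mult.TCOptimised semiring using () renaming (_×_ to infixr 8 _×ᴿ_)
  open Algebra.Properties.Semiring.Mult.TCOptimised semiring using (×-homo-+; ×1-homo-*; 1+×)
  open Relation.Binary.Reasoning.Setoid setoid

  fromℤ : ℤ → Carrier
  fromℤ (+ n)    = n ×ᴿ 1#
  fromℤ -[1+ n ] = - (suc n ×ᴿ 1#)

  fromℤ-⊖ : ∀ m n → fromℤ (m ℤ.⊖ n) ≈ m ×ᴿ 1# - n ×ᴿ 1#
  fromℤ-⊖ zero    zero    = sym (-‿inverseʳ 0#)
  fromℤ-⊖ (suc m) zero    = sym (trans (+-congˡ -0#≈0#) (+-identityʳ _))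
  fromℤ-⊖ zero    (suc n) = sym (+-identityˡ _)
  fromℤ-⊖ (suc m) (suc n) = begin
    fromℤ (suc m ℤ.⊖ suc n)              ≡⟨ ≡.cong fromℤ (ℤ.[1+m]⊖[1+n]≡m⊖n m n) ⟩
    fromℤ (m ℤ.⊖ n)                      ≈⟨ fromℤ-⊖ m n ⟩
    m ×ᴿ 1# - n ×ᴿ 1#                      ≈⟨ +-congʳ (+-identityˡ _) ⟨
    (0# + m ×ᴿ 1#) - n ×ᴿ 1#               ≈⟨ +-congʳ (+-congʳ (-‿inverseʳ 1#)) ⟨
    ((1# - 1#) + m ×ᴿ 1#) - n ×ᴿ 1#        ≈⟨ +-congʳ (+-assoc _ _ _) ⟩
    (1# + (- 1# + m ×ᴿ 1#)) - n ×ᴿ 1#      ≈⟨ +-congʳ (+-congˡ (+-comm _ _)) ⟩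
    (1# + (m ×ᴿ 1# - 1#)) - n ×ᴿ 1#        ≈⟨ +-congʳ (+-assoc _ _ _) ⟨
    ((1# + m ×ᴿ 1#) - 1#) - n ×ᴿ 1#        ≈⟨ +-assoc _ _ _ ⟩
    (1# + m ×ᴿ 1#) + (- 1# - n ×ᴿ 1#)      ≈⟨ +-congˡ (-‿+-comm 1# (n ×ᴿ 1#)) ⟩
    (1# + m ×ᴿ 1#) - (1# + n ×ᴿ 1#)        ≈⟨ +-cong (1+× m 1#) (-‿cong (1+× n 1#)) ⟨
    suc m ×ᴿ 1# - suc n ×ᴿ 1#              ∎

  fromℤ-+ : ∀ i j → fromℤ (i ℤ.+ j) ≈ fromℤ i + fromℤ j
  fromℤ-+ (+ m)    (+ n)    = ×-homo-+ 1# m n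
  fromℤ-+ (+ m)    -[1+ n ] = fromℤ-⊖ m (suc n)
  fromℤ-+ -[1+ m ] (+ n)    = trans (fromℤ-⊖ n (suc m)) (+-comm _ _)
  fromℤ-+ -[1+ m ] -[1+ n ] = begin
    - (suc (suc (m ℕ.+ n)) ×ᴿ 1#)          ≡⟨ ≡.cong (λ k → - (k ×ᴿ 1#)) (≡.cong suc (ℕ.+-suc m n)) ⟨
    - ((suc m ℕ.+ suc n) ×ᴿ 1#)            ≈⟨ -‿cong (×-homo-+ 1# (suc m) (suc n)) ⟩
    - (suc m ×ᴿ 1# + suc n ×ᴿ 1#)           ≈⟨ -‿+-comm _ _ ⟨
    - (suc m ×ᴿ 1#) - suc n ×ᴿ 1#           ∎
    where import Data.Nat.Properties as ℕ

  fromℤ-neg : ∀ i → fromℤ (ℤ.- i) ≈ - fromℤ i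
  fromℤ-neg (+ zero)  = sym -0#≈0#
  fromℤ-neg (+ suc n) = refl
  fromℤ-neg -[1+ n ]  = sym (-‿involutive _)

  fromℤ-*⁺ : ∀ m j → fromℤ (+ m ℤ.* j) ≈ m ×ᴿ 1# * fromℤ j
  fromℤ-*⁺ m (+ n) = trans (reflexive (≡.cong fromℤ (≡.sym (ℤ.pos-* m n)))) (×1-homo-* m n)
  fromℤ-*⁺ m -[1+ n ] = begin
    fromℤ (+ m ℤ.* -[1+ n ])         ≡⟨ ≡.cong fromℤ (ℤ.neg-distribʳ-* (+ m) (+ suc n)) ⟨
    fromℤ (ℤ.- (+ m ℤ.* + suc n))    ≈⟨ fromℤ-neg (+ m ℤ.* + suc n) ⟩
    - fromℤ (+ m ℤ.* + suc n)        ≈⟨ -‿cong (fromℤ-*⁺ m (+ suc n)) ⟩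
    - (m ×ᴿ 1# * (suc n ×ᴿ 1#))        ≈⟨ -‿distribʳ-* _ _ ⟩
    m ×ᴿ 1# * - (suc n ×ᴿ 1#)          ∎

  fromℤ-* : ∀ i j → fromℤ (i ℤ.* j) ≈ fromℤ i * fromℤ j
  fromℤ-* (+ m)    j = fromℤ-*⁺ m j
  fromℤ-* -[1+ m ] j = begin
    fromℤ (-[1+ m ] ℤ.* j)           ≡⟨ ≡.cong fromℤ (ℤ.neg-distribˡ-* (+ suc m) j) ⟨
    fromℤ (ℤ.- (+ suc m ℤ.* j))      ≈⟨ fromℤ-neg (+ suc m ℤ.* j) ⟩
    - fromℤ (+ suc m ℤ.* j)          ≈⟨ -‿cong (fromℤ-*⁺ (suc m) j) ⟩
    - (suc m ×ᴿ 1# * fromℤ j)         ≈⟨ -‿distribˡ-* _ _ ⟩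
    - (suc m ×ᴿ 1#) * fromℤ j         ∎

  ℤ-rawRing : RawRing 0ℓ 0ℓ
  ℤ-rawRing = record { _≈_ = _≡_ ; _+_ = ℤ._+_ ; _*_ = ℤ._*_ ; -_ = ℤ.-_ ; 0# = + 0 ; 1# = + 1 }

  fromℤ-homomorphism : ℤ-rawRing -Raw-AlmostCommutative⟶ fromCommutativeRing R
  fromℤ-homomorphism = record
    { ⟦_⟧ = fromℤ ; +-homo = fromℤ-+ ; *-homo = fromℤ-* ; -‿homo = fromℤ-neg ; 0-homo = refl ; 1-homo = refl }

  -- Coefficients are integers so that the solver can compare them; a negative answer claims nothing
  -- about their images in the ring.
  fromℤ-≟ : ∀ i j → Maybe (fromℤ i ≈ fromℤ j)
  fromℤ-≟ i j with i ℤ.≟ j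
  ... | yes ≡.refl = just refl
  ... | no _       = nothing

  open Algebra.Solver.Ring ℤ-rawRing (fromCommutativeRing R) fromℤ-homomorphism fromℤ-≟ public
    using (solve; _:=_; _:+_; _:*_; _:-_; :-_; con; Polynomial)

  0′ 1′ : ∀ {n} → Polynomial n
  0′ = con (+ 0)
  1′ = con (+ 1)

-- Ordered fields: signs, finite sums, the ratio test and homogeneous linear equations

module OrderedField (em : ExcludedMiddle 0ℓ) (ℝ : CompleteOrderedField) where
  open Classical em
  open CompleteOrderedField ℝ hiding (zero)
  open RingSolver commutativeRing
  open Algebra.Properties.Ring ring using (-‿involutive; -1*x≈-x)
  open Algebra.Properties.Semiring.Sum semiring
  open Relation.Binary.Reasoning.Setoid setoid
  module ≤ = IsTotalOrder isTotalOrder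

  infix 4 _<_

  -- As `_≤_` is total, the negated converse is the usual strict order, and strictness can be
  -- refuted or assumed directly in proofs by contradiction.
  _<_ : Carrier → Carrier → Set
  x < y = ¬ (y ≤ x)

  <⇒≤ : ∀ {x y} → x < y → x ≤ y
  <⇒≤ {x} {y} x<y = [ (λ x≤y → x≤y) , (λ y≤x → contradiction y≤x x<y) ]′ (≤.total x y)

  <⇒≉ : ∀ {x y} → x < y → ¬ (x ≈ y)
  <⇒≉ x<y x≈y = x<y (≤.reflexive (sym x≈y))

  ≤∧≉⇒< : ∀ {x y} → x ≤ y → ¬ (x ≈ y) → x < y
  ≤∧≉⇒< x≤y x≉y y≤x = x≉y (≤.antisym x≤y y≤x)

  <-≤-trans : ∀ {x y z} → x < y → y ≤ z → x < z
  <-≤-trans x<y y≤z z≤x = x<y (≤.trans y≤z z≤x)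

  ≤-<-trans : ∀ {x y z} → x ≤ y → y < z → x < z
  ≤-<-trans x≤y y<z z≤x = y<z (≤.trans z≤x x≤y)

  <-resp : ∀ {x x′ y y′} → x ≈ x′ → y ≈ y′ → x < y → x′ < y′
  <-resp x≈ y≈ x<y y≤x = x<y (≤.trans (≤.reflexive y≈) (≤.trans y≤x (≤.reflexive (sym x≈))))

  ≤-resp : ∀ {x x′ y y′} → x ≈ x′ → y ≈ y′ → x ≤ y → x′ ≤ y′
  ≤-resp x≈ y≈ x≤y = ≤.trans (≤.reflexive (sym x≈)) (≤.trans x≤y (≤.reflexive y≈))

  ≤⇒0≤- : ∀ {x y} → x ≤ y → 0# ≤ y - x
  ≤⇒0≤- {x} x≤y = ≤-resp (-‿inverseʳ x) refl (+-monoˡ-≤ (- x) x≤y)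

  0≤-⇒≤ : ∀ {x y} → 0# ≤ y - x → x ≤ y
  0≤-⇒≤ {x} {y} 0≤ = ≤-resp (+-identityˡ x) (solve 2 (λ x y → y :- x :+ x := y) refl x y) (+-monoˡ-≤ x 0≤)

  +-mono-≤ : ∀ {x x′ y y′} → x ≤ x′ → y ≤ y′ → x + y ≤ x′ + y′
  +-mono-≤ {x} {x′} {y} {y′} x≤ y≤ =
    ≤.trans (+-monoˡ-≤ y x≤) (≤-resp (+-comm y x′) (+-comm y′ x′) (+-monoˡ-≤ x′ y≤))

  0≤+ : ∀ {x y} → 0# ≤ x → 0# ≤ y → 0# ≤ x + y
  0≤+ 0≤x 0≤y = ≤-resp (+-identityʳ 0#) refl (+-mono-≤ 0≤x 0≤y)

  +≤0 : ∀ {x y} → x ≤ 0# → y ≤ 0# → x + y ≤ 0#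
  +≤0 x≤0 y≤0 = ≤-resp refl (+-identityʳ 0#) (+-mono-≤ x≤0 y≤0)

  0≤- : ∀ {x} → x ≤ 0# → 0# ≤ - x
  0≤- {x} x≤0 = ≤-resp refl (+-identityˡ (- x)) (≤⇒0≤- x≤0)

  -≤0 : ∀ {x} → 0# ≤ x → - x ≤ 0#
  -≤0 {x} 0≤x = 0≤-⇒≤ (≤-resp refl (solve 1 (λ x → x := 0′ :- (:- x)) refl x) 0≤x)

  ≤0-by-neg : ∀ {x} → 0# ≤ - x → x ≤ 0#
  ≤0-by-neg 0≤-x = ≤-resp (-‿involutive _) refl (-≤0 0≤-x)

  *≤0 : ∀ {x y} → 0# ≤ x → y ≤ 0# → x * y ≤ 0#
  *≤0 {x} {y} 0≤x y≤0 =
    ≤0-by-neg (≤-resp refl (solve 2 (λ x y → x :* (:- y) := :- (x :* y)) refl x y) (*-nonNeg 0≤x (0≤- y≤0)))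

  -- The inverse of 0 is 0.
  infix 9 _⁻¹
  _⁻¹ : Carrier → Carrier
  x ⁻¹ with em {x ≈ 0#}
  ... | yes _  = 0#
  ... | no x≉0 = proj₁ (inverse x x≉0)

  ⁻¹-inverse : ∀ {x} → ¬ (x ≈ 0#) → x * x ⁻¹ ≈ 1#
  ⁻¹-inverse {x} x≉0 with em {x ≈ 0#}
  ... | yes x≈0 = contradiction x≈0 x≉0
  ... | no x≉0  = proj₂ (inverse x x≉0)

  *-cancel-0 : ∀ {x y} → ¬ (x ≈ 0#) → x * y ≈ 0# → y ≈ 0#
  *-cancel-0 {x} {y} x≉0 xy≈0 = begin
    y                  ≈⟨ *-identityˡ y ⟨
    1# * y             ≈⟨ *-congʳ (⁻¹-inverse x≉0) ⟨
    x * x ⁻¹ * y       ≈⟨ solve 3 (λ x y z → x :* y :* z := y :* (x :* z)) refl x (x ⁻¹) y ⟩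
    x ⁻¹ * (x * y)     ≈⟨ *-congˡ xy≈0 ⟩
    x ⁻¹ * 0#          ≈⟨ zeroʳ _ ⟩
    0#                 ∎

  *-≉0 : ∀ {x y} → ¬ (x ≈ 0#) → ¬ (y ≈ 0#) → ¬ (x * y ≈ 0#)
  *-≉0 x≉0 y≉0 xy≈0 = y≉0 (*-cancel-0 x≉0 xy≈0)

  0<* : ∀ {x y} → 0# < x → 0# < y → 0# < x * y
  0<* 0<x 0<y = ≤∧≉⇒< (*-nonNeg (<⇒≤ 0<x) (<⇒≤ 0<y)) (*-≉0 (<⇒≉ 0<x ∘ sym) (<⇒≉ 0<y ∘ sym) ∘ sym)

  0<1 : 0# < 1#
  0<1 1≤0 = 0≉1 (≤.antisym
    (≤-resp refl (solve 0 ((:- 1′) :* (:- 1′) := 1′) refl) (*-nonNeg (0≤- 1≤0) (0≤- 1≤0))) 1≤0)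

  0≤1 : 0# ≤ 1#
  0≤1 = <⇒≤ 0<1

  0<⁻¹ : ∀ {x} → 0# < x → 0# < x ⁻¹
  0<⁻¹ {x} 0<x x⁻¹≤0 = 0<1 (≤-resp (⁻¹-inverse (<⇒≉ 0<x ∘ sym)) refl (*≤0 (<⇒≤ 0<x) x⁻¹≤0))

  0≤*⇒0≤ : ∀ {x y} → 0# < x → 0# ≤ x * y → 0# ≤ y
  0≤*⇒0≤ {x} {y} 0<x 0≤xy = by-contradiction λ ¬0≤y →
    ¬0≤y (≤.reflexive (sym (*-cancel-0 (<⇒≉ 0<x ∘ sym) (≤.antisym (*≤0 (<⇒≤ 0<x) (<⇒≤ ¬0≤y)) 0≤xy))))

  0<+ : ∀ {x y} → 0# < x → 0# ≤ y → 0# < x + y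
  0<+ {x} {y} 0<x 0≤y = <-≤-trans 0<x (≤-resp (+-identityʳ x) refl (+-mono-≤ ≤.refl 0≤y))

  0<- : ∀ {x} → x < 0# → 0# < - x
  0<- {x} x<0 -x≤0 = x<0 (≤-resp refl (-‿involutive x) (0≤- -x≤0))

  +<0 : ∀ {x y} → x < 0# → y ≤ 0# → x + y < 0#
  +<0 {x} {y} x<0 y≤0 = ≤-<-trans (≤-resp refl (+-identityʳ x) (+-mono-≤ ≤.refl y≤0)) x<0

  +-split-0 : ∀ {x y} → 0# ≤ x → 0# ≤ y → x + y ≈ 0# → x ≈ 0#
  +-split-0 {x} {y} 0≤x 0≤y e =
    ≤.antisym (≤-resp (+-identityʳ x) e (+-mono-≤ ≤.refl 0≤y)) 0≤x

  sum-cong : ∀ {n} {f g : Vector Carrier n} → (∀ i → f i ≈ g i) → sum f ≈ sum g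
  sum-cong = sum-cong-≋

  sum-zero : ∀ {n} {f : Vector Carrier n} → (∀ i → f i ≈ 0#) → sum f ≈ 0#
  sum-zero {n} e = trans (sum-cong e) (sum-replicate-zero n)

  sum-nonneg : ∀ {n} {f : Vector Carrier n} → (∀ i → 0# ≤ f i) → 0# ≤ sum f
  sum-nonneg {zero}  _  = ≤.refl
  sum-nonneg {suc n} 0≤ = 0≤+ (0≤ zero) (sum-nonneg (0≤ ∘ suc))

  sum-nonneg-zero : ∀ {n} {f : Vector Carrier n} → (∀ i → 0# ≤ f i) → sum f ≈ 0# → ∀ i → f i ≈ 0#
  sum-nonneg-zero {suc n} 0≤ e zero    = +-split-0 (0≤ zero) (sum-nonneg (0≤ ∘ suc)) e
  sum-nonneg-zero {suc n} 0≤ e (suc i) =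
    sum-nonneg-zero (0≤ ∘ suc) (+-split-0 (sum-nonneg (0≤ ∘ suc)) (0≤ zero) (trans (+-comm _ _) e)) i

  sum-single : ∀ {n} (f : Vector Carrier n) i → (∀ k → k ≢ i → f k ≈ 0#) → sum f ≈ f i
  sum-single {suc n} f i e = begin
    sum f                        ≈⟨ sum-remove {i = i} f ⟩
    f i + sum (removeAt f i)     ≈⟨ +-congˡ (sum-zero λ k → e (punchIn i k) (Fin.punchInᵢ≢i i k)) ⟩
    f i + 0#                     ≈⟨ +-identityʳ _ ⟩
    f i                          ∎

  sum-neg : ∀ {n} (f : Vector Carrier n) → sum (λ i → - f i) ≈ - sum f
  sum-neg f = begin
    sum (λ i → - f i)            ≈⟨ sum-cong (λ i → sym (-1*x≈-x (f i))) ⟩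
    sum (λ i → - 1# * f i)       ≈⟨ *-distribˡ-sum (- 1#) f ⟨
    - 1# * sum f                 ≈⟨ -1*x≈-x _ ⟩
    - sum f                      ∎

  sum-sub : ∀ {n} (f g : Vector Carrier n) → sum (λ i → f i - g i) ≈ sum f - sum g
  sum-sub f g = trans (∑-distrib-+ f (λ i → - g i)) (+-congˡ (sum-neg g))

  *-sum : ∀ {n} c (f : Vector Carrier n) → c * sum f ≈ sum (λ i → c * f i)
  *-sum = *-distribˡ-sum

  sum-* : ∀ {n} c (f : Vector Carrier n) → sum f * c ≈ sum (λ i → f i * c)
  sum-* = *-distribʳ-sum

  [_≟_] : ∀ {n} → Fin n → Fin n → Carrier
  [ i ≟ j ] with i Fin.≟ j
  ... | yes _ = 1#
  ... | no _  = 0#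

  ≟-same : ∀ {n} {i j : Fin n} → i ≡ j → [ i ≟ j ] ≈ 1#
  ≟-same {i = i} {j} i≡j with i Fin.≟ j
  ... | yes _  = refl
  ... | no i≢j = contradiction i≡j i≢j

  ≟-distinct : ∀ {n} {i j : Fin n} → i ≢ j → [ i ≟ j ] ≈ 0#
  ≟-distinct {i = i} {j} i≢j with i Fin.≟ j
  ... | yes i≡j = contradiction i≡j i≢j
  ... | no _    = refl

  0≤≟ : ∀ {n} (i j : Fin n) → 0# ≤ [ i ≟ j ]
  0≤≟ i j with i Fin.≟ j
  ... | yes _ = 0≤1
  ... | no _  = ≤.refl

  sum-≟ : ∀ {n} (i : Fin n) (f : Vector Carrier n) → sum (λ k → [ k ≟ i ] * f k) ≈ f i
  sum-≟ i f = begin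
    sum (λ k → [ k ≟ i ] * f k) ≈⟨ sum-single _ i (λ k k≢i → trans (*-congʳ (≟-distinct k≢i)) (zeroˡ _)) ⟩
    [ i ≟ i ] * f i             ≈⟨ *-congʳ (≟-same {i = i} ≡.refl) ⟩
    1# * f i                    ≈⟨ *-identityˡ _ ⟩
    f i                         ∎

  sum-≟1 : ∀ {n} (i : Fin n) → sum (λ k → [ k ≟ i ]) ≈ 1#
  sum-≟1 {n} i = trans (sum-cong {n} λ k → sym (*-identityʳ _)) (sum-≟ i (λ _ → 1#))

  argmin : ∀ {n} (Q : Pred (Fin n) 0ℓ) (r : Fin n → Carrier) → Satisfiable Q →
           ∃ λ i → Q i × (∀ k → Q k → r i ≤ r k)
  argmin {zero}  Q r (() , _)
  argmin {suc n} Q r (i , qi) with em {Satisfiable (Q ∘ suc)} | em {Q zero}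
  ... | no ¬∃ | no ¬q₀ = ⊥-elim ([ ¬q₀ , ¬∃ ]′ (split i qi))
    where
    split : ∀ i → Q i → Q zero ⊎ Satisfiable (Q ∘ suc)
    split zero    q = inj₁ q
    split (suc i) q = inj₂ (i , q)
  ... | no ¬∃ | yes q₀ = zero , q₀ , λ { zero _ → ≤.refl ; (suc k) q → contradiction (k , q) ¬∃ }
  ... | yes ∃q | b with argmin (Q ∘ suc) (r ∘ suc) ∃q
  ...   | j , qj , least with b
  ...     | no ¬q₀ = suc j , qj , λ { zero q → contradiction q ¬q₀ ; (suc k) q → least k q }
  ...     | yes q₀ with ≤.total (r zero) (r (suc j))
  ...       | inj₁ r₀≤ = zero , q₀ , λ { zero _ → ≤.refl ; (suc k) q → ≤.trans r₀≤ (least k q) }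
  ...       | inj₂ ≤r₀ = suc j , qj , λ { zero _ → ≤r₀ ; (suc k) q → least k q }

  -- Start at a point where the affine functions k are α k ≤ 0 and move in a
  -- direction where their slopes are β k, until one of them vanishes.
  walk : ∀ {n} (Q : Pred (Fin n) 0ℓ) (α β : Fin n → Carrier) →
         (∀ k → Q k → α k ≤ 0#) → (∃ λ k → Q k × 0# < β k) →
         ∃ λ t → 0# ≤ t × (∃ λ k → Q k × 0# < β k × α k + t * β k ≈ 0#) × (∀ k → Q k → α k + t * β k ≤ 0#)
  walk Q α β α≤0 ∃0<β with argmin (λ k → Q k × 0# < β k) (λ k → - α k * β k ⁻¹) ∃0<β
  ... | i , (qi , 0<βi) , least = t , 0≤t , (i , qi , 0<βi , tight) , valid
    where
    -- The ratio test of the simplex algorithm: among the rising functions, the one with the least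
    -- ratio reaches 0 first.
    t : Carrier
    t = - α i * β i ⁻¹
    0≤t : 0# ≤ t
    0≤t = *-nonNeg (0≤- (α≤0 i qi)) (<⇒≤ (0<⁻¹ 0<βi))
    cancel : ∀ k → 0# < β k → - α k * β k ⁻¹ * β k ≈ - α k
    cancel k 0<βk = begin
      - α k * β k ⁻¹ * β k     ≈⟨ solve 3 (λ a b c → a :* b :* c := a :* (c :* b)) refl _ _ _ ⟩
      - α k * (β k * β k ⁻¹)   ≈⟨ *-congˡ (⁻¹-inverse (<⇒≉ 0<βk ∘ sym)) ⟩
      - α k * 1#               ≈⟨ *-identityʳ _ ⟩
      - α k                    ∎
    tight : α i + t * β i ≈ 0#
    tight = trans (+-congˡ (cancel i 0<βi)) (-‿inverseʳ _)
    valid : ∀ k → Q k → α k + t * β k ≤ 0#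
    valid k qk with em {0# < β k}
    ... | yes 0<βk = ≤0-by-neg (≤-resp refl eq (*-nonNeg (≤⇒0≤- (least k (qk , 0<βk))) (<⇒≤ 0<βk)))
      where
      eq : (- α k * β k ⁻¹ - t) * β k ≈ - (α k + t * β k)
      eq = begin
        (- α k * β k ⁻¹ - t) * β k         ≈⟨ solve 3 (λ a t b → (a :- t) :* b := a :* b :- t :* b) refl _ t (β k) ⟩
        - α k * β k ⁻¹ * β k - t * β k     ≈⟨ +-congʳ (cancel k 0<βk) ⟩
        - α k - t * β k                    ≈⟨ solve 2 (λ a b → (:- a) :- b := :- (a :+ b)) refl (α k) (t * β k) ⟩
        - (α k + t * β k)                  ∎
    ... | no ¬0<βk = +≤0 (α≤0 k qk) (*≤0 0≤t (by-contradiction ¬0<βk))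

  -- The length of `walk` will do. It is positive, since length 0 would require a function that
  -- vanishes at the start and still rises. If no function rises, any length is admissible, and 1 is
  -- taken.
  small-step : ∀ {n} (Q : Pred (Fin n) 0ℓ) (α β : Fin n → Carrier) →
               (∀ k → Q k → α k ≤ 0#) → (∀ k → Q k → α k ≈ 0# → β k ≤ 0#) →
               ∃ λ ε → 0# < ε × (∀ k → Q k → α k + ε * β k ≤ 0#)
  small-step Q α β α≤0 β≤0 = step (em {∃ λ k → Q k × 0# < β k})
    where
    Step : Set
    Step = ∃ λ ε → 0# < ε × (∀ k → Q k → α k + ε * β k ≤ 0#)
    stopped : (∃ λ t → 0# ≤ t × (∃ λ k → Q k × 0# < β k × α k + t * β k ≈ 0#) ×
                       (∀ k → Q k → α k + t * β k ≤ 0#)) → Step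
    stopped (t , 0≤t , (i , qi , 0<βi , tight) , valid) =
      t , ≤∧≉⇒< 0≤t (λ 0≈t → 0<βi (β≤0 i qi (α≈0 (sym 0≈t)))) , valid
      where
      α≈0 : t ≈ 0# → α i ≈ 0#
      α≈0 t≈0 = begin
        α i                ≈⟨ +-identityʳ _ ⟨
        α i + 0#           ≈⟨ +-congˡ (zeroˡ (β i)) ⟨
        α i + 0# * β i     ≈⟨ +-congˡ (*-congʳ t≈0) ⟨
        α i + t * β i      ≈⟨ tight ⟩
        0#                 ∎
    step : Dec (∃ λ k → Q k × 0# < β k) → Step
    step (no ¬∃)    =
      1# , 0<1 , λ k qk → +≤0 (α≤0 k qk) (*≤0 0≤1 (by-contradiction λ 0<βk → ¬∃ (k , qk , 0<βk)))
    step (yes ∃0<β) = stopped (walk Q α β α≤0 ∃0<β)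

  -- To solve r + 1 equations, combine a solution w of the last r of them,
  -- w j ≉ 0, with another one whose j-th coordinate is 0.
  nontrivial-solution : ∀ r {q} → r ℕ.< q → (A : Fin r → Fin q → Carrier) →
                        ∃ λ (w : Fin q → Carrier) →
                        (∃ λ j → ¬ (w j ≈ 0#)) × (∀ i → sum (λ j → w j * A i j) ≈ 0#)
  nontrivial-solution zero    {suc q} _ A = (λ _ → 1#) , (zero , 0≉1 ∘ sym) , λ ()
  nontrivial-solution (suc r) {suc q} (s≤s r<q) A
    with nontrivial-solution r (ℕ.m<n⇒m<1+n r<q) (A ∘ suc)
  ... | w , (j , wj≉0) , w-solves with nontrivial-solution r r<q (λ i k → A (suc i) (punchIn j k))
  ...   | w̄ , (k , w̄k≉0) , w̄-solves = combination (em {φ w′ ≈ 0#})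
    where
    w′ : Fin (suc q) → Carrier
    w′ = insertAt w̄ j 0#
    φ : (Fin (suc q) → Carrier) → Carrier
    φ w = sum (λ j → w j * A zero j)
    sum-w′ : ∀ i → sum (λ l → w′ l * A i l) ≈ sum (λ l → w̄ l * A i (punchIn j l))
    sum-w′ i = begin
      sum (λ l → w′ l * A i l)                                              ≈⟨ sum-remove {i = j} (λ l → w′ l * A i l) ⟩
      w′ j * A i j + sum (λ l → w′ (punchIn j l) * A i (punchIn j l))       ≈⟨ +-cong
        (trans (*-congʳ (reflexive (Vector.insertAt-lookup w̄ j 0#))) (zeroˡ _))
        (sum-cong λ l → *-congʳ (reflexive (Vector.insertAt-punchIn w̄ j 0# l))) ⟩
      0# + sum (λ l → w̄ l * A i (punchIn j l))                              ≈⟨ +-identityˡ _ ⟩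
      sum (λ l → w̄ l * A i (punchIn j l))                                   ∎
    w′-solves : ∀ i → sum (λ l → w′ l * A (suc i) l) ≈ 0#
    w′-solves i = trans (sum-w′ (suc i)) (w̄-solves i)
    combination : Dec (φ w′ ≈ 0#) → _
    combination (yes φw′≈0) =
      w′ , (punchIn j k , λ e → w̄k≉0 (trans (reflexive (≡.sym (Vector.insertAt-punchIn w̄ j 0# k))) e)) ,
      λ { zero → φw′≈0 ; (suc i) → w′-solves i }
    combination (no φw′≉0) = v , (j , vj≉0) , v-solves
      where
      -- This combination is annihilated by `φ` by construction, and since `w′ j` is 0 its
      -- coordinate `j` is the product `φ w′ * w j` of two nonzero factors.
      v : Fin (suc q) → Carrier
      v l = φ w′ * w l - φ w * w′ l
      vj≉0 : ¬ (v j ≈ 0#)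
      vj≉0 e = *-≉0 φw′≉0 wj≉0 (begin
        φ w′ * w j                     ≈⟨ solve 2 (λ a b → a := a :- b :* 0′) refl _ (φ w) ⟩
        φ w′ * w j - φ w * 0#          ≈⟨ +-congˡ (-‿cong (*-congˡ (reflexive (Vector.insertAt-lookup w̄ j 0#)))) ⟨
        v j                            ≈⟨ e ⟩
        0#                             ∎)
      sum-v : ∀ i → sum (λ l → v l * A i l) ≈ φ w′ * sum (λ l → w l * A i l) - φ w * sum (λ l → w′ l * A i l)
      sum-v i = begin
        sum (λ l → v l * A i l)
          ≈⟨ sum-cong (λ l → solve 5 (λ a b c d e → (a :* b :- c :* d) :* e := a :* (b :* e) :- c :* (d :* e))
               refl (φ w′) (w l) (φ w) (w′ l) (A i l)) ⟩
        sum (λ l → φ w′ * (w l * A i l) - φ w * (w′ l * A i l))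
          ≈⟨ sum-sub (λ l → φ w′ * (w l * A i l)) (λ l → φ w * (w′ l * A i l)) ⟩
        sum (λ l → φ w′ * (w l * A i l)) - sum (λ l → φ w * (w′ l * A i l))
          ≈⟨ +-cong (*-sum (φ w′) (λ l → w l * A i l)) (-‿cong (*-sum (φ w) (λ l → w′ l * A i l))) ⟨
        φ w′ * sum (λ l → w l * A i l) - φ w * sum (λ l → w′ l * A i l) ∎
      v-solves : ∀ i → sum (λ l → v l * A i l) ≈ 0#
      v-solves zero = trans (sum-v zero) (solve 2 (λ a b → a :* b :- b :* a := 0′) refl (φ w′) (φ w))
      v-solves (suc i) = begin
        sum (λ l → v l * A (suc i) l)        ≈⟨ sum-v (suc i) ⟩
        φ w′ * sum (λ l → w l * A (suc i) l) - φ w * sum (λ l → w′ l * A (suc i) l)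
          ≈⟨ +-cong (*-congˡ (w-solves i)) (-‿cong (*-congˡ (w′-solves i))) ⟩
        φ w′ * 0# - φ w * 0#                 ≈⟨ solve 2 (λ a b → a :* 0′ :- b :* 0′ := 0′) refl (φ w′) (φ w) ⟩
        0#                                   ∎

-- Linear combinations, and affine independence against spanning

module Vectors (em : ExcludedMiddle 0ℓ) (ℝ : CompleteOrderedField) where
  open Classical em
  open CompleteOrderedField ℝ hiding (zero)
  open RingSolver commutativeRing
  open Algebra.Properties.Semiring.Sum semiring using (sum; ∑-distrib-+; ∑-comm)
  open OrderedField em ℝ
  open Geometry ℝ using (Point; _≋_; _·_; AffinelyIndependent)
  open Relation.Binary.Reasoning.Setoid setoid

  module _ {I : Set} where

    infixl 6 _⊕_ _⊖_
    infixr 7 _⊛_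

    _⊕_ _⊖_ : Point I → Point I → Point I
    (x ⊕ y) i = x i + y i
    (x ⊖ y) i = x i - y i

    _⊛_ : Carrier → Point I → Point I
    (t ⊛ x) i = t * x i

    𝟎 : Point I
    𝟎 i = 0#

    lin : ∀ {k} → (Fin k → Carrier) → (Fin k → Point I) → Point I
    lin t z i = sum (λ j → t j * z j i)

    ≋-refl : ∀ {x : Point I} → x ≋ x
    ≋-refl i = refl

    ≋-sym : ∀ {x y : Point I} → x ≋ y → y ≋ x
    ≋-sym e i = sym (e i)

    ≋-trans : ∀ {x y z : Point I} → x ≋ y → y ≋ z → x ≋ z
    ≋-trans e e′ i = trans (e i) (e′ i)

    lin-zero : ∀ {k} {t : Fin k → Carrier} (z : Fin k → Point I) → (∀ j → t j ≈ 0#) → lin t z ≋ 𝟎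
    lin-zero z e i = sum-zero λ j → trans (*-congʳ (e j)) (zeroˡ _)

    lin-⊕⊛ : ∀ {k} (s : Fin k → Carrier) c t (z : Fin k → Point I) →
             lin (λ j → s j + c * t j) z ≋ lin s z ⊕ c ⊛ lin t z
    lin-⊕⊛ s c t z i = begin
      sum (λ j → (s j + c * t j) * z j i)
        ≈⟨ sum-cong (λ j → solve 4 (λ s c t z → (s :+ c :* t) :* z := s :* z :+ c :* (t :* z)) refl (s j) c (t j) (z j i)) ⟩
      sum (λ j → s j * z j i + c * (t j * z j i))
        ≈⟨ ∑-distrib-+ (λ j → s j * z j i) (λ j → c * (t j * z j i)) ⟩
      lin s z i + sum (λ j → c * (t j * z j i))
        ≈⟨ +-congˡ (*-sum c (λ j → t j * z j i)) ⟨
      lin s z i + c * lin t z i ∎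

    lin-≟ : ∀ {k} (j : Fin k) (z : Fin k → Point I) → lin (λ l → [ l ≟ j ]) z ≋ z j
    lin-≟ j z i = sum-≟ j (λ l → z l i)

  module _ {n : ℕ} where

    ·-cong : ∀ (c : Point (Fin n)) {x y} → x ≋ y → c · x ≈ c · y
    ·-cong c e = sum-cong λ i → *-congˡ (e i)

    ·-⊕ : ∀ (c x y : Point (Fin n)) → c · (x ⊕ y) ≈ c · x + c · y
    ·-⊕ c x y = trans (sum-cong λ i → distribˡ (c i) (x i) (y i)) (∑-distrib-+ (λ i → c i * x i) (λ i → c i * y i))

    ·-⊛ : ∀ (c : Point (Fin n)) t x → c · (t ⊛ x) ≈ t * (c · x)
    ·-⊛ c t x = trans (sum-cong λ i → solve 3 (λ c t x → c :* (t :* x) := t :* (c :* x)) refl (c i) t (x i))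
                      (sym (*-sum t (λ i → c i * x i)))

    ·-⊖ : ∀ (c x y : Point (Fin n)) → c · (x ⊖ y) ≈ c · x - c · y
    ·-⊖ c x y = trans (sum-cong λ i → solve 3 (λ c x y → c :* (x :- y) := c :* x :- c :* y) refl (c i) (x i) (y i))
                      (sum-sub (λ i → c i * x i) (λ i → c i * y i))

    ·-⊕⊛ : ∀ (c x : Point (Fin n)) t y → c · (x ⊕ t ⊛ y) ≈ c · x + t * (c · y)
    ·-⊕⊛ c x t y = trans (·-⊕ c x (t ⊛ y)) (+-congˡ (·-⊛ c t y))

    ·-𝟎 : ∀ (c : Point (Fin n)) → c · 𝟎 ≈ 0#
    ·-𝟎 c = sum-zero λ i → zeroʳ (c i)

    ·-neg : ∀ (c x : Point (Fin n)) → (λ i → - c i) · x ≈ - (c · x)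
    ·-neg c x = trans (sum-cong λ i → solve 2 (λ c x → (:- c) :* x := :- (c :* x)) refl (c i) (x i))
                      (sum-neg (λ i → c i * x i))

    ·-lin : ∀ {k} (c : Point (Fin n)) (t : Fin k → Carrier) z → c · lin t z ≈ sum (λ j → t j * (c · z j))
    ·-lin c t z = begin
      sum (λ i → c i * sum (λ j → t j * z j i))
        ≈⟨ sum-cong (λ i → *-sum (c i) (λ j → t j * z j i)) ⟩
      sum (λ i → sum (λ j → c i * (t j * z j i)))
        ≈⟨ ∑-comm (λ i j → c i * (t j * z j i)) ⟩
      sum (λ j → sum (λ i → c i * (t j * z j i)))
        ≈⟨ sum-cong (λ j → sum-cong λ i → solve 3 (λ c t x → c :* (t :* x) := t :* (c :* x)) refl (c i) (t j) (z j i)) ⟩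
      sum (λ j → sum (λ i → t j * (c i * z j i)))
        ≈⟨ sum-cong (λ j → sym (*-sum (t j) (λ i → c i * z j i))) ⟩
      sum (λ j → t j * (c · z j)) ∎

    lin-· : ∀ {k} (t : Fin k → Carrier) a (x : Point (Fin n)) → lin t a · x ≈ sum (λ j → t j * (a j · x))
    lin-· t a x = begin
      sum (λ i → lin t a i * x i)     ≈⟨ sum-cong (λ i → *-comm (lin t a i) (x i)) ⟩
      x · lin t a                     ≈⟨ ·-lin x t a ⟩
      sum (λ j → t j * (x · a j))     ≈⟨ sum-cong (λ j → *-congˡ (sum-cong λ i → *-comm (x i) (a j i))) ⟩
      sum (λ j → t j * (a j · x))     ∎

  module _ {I : Set} where

    affine-relation : ∀ {q k} (p : Fin q → Point I) v (z : Fin k → Point I) (A : Fin q → Fin k → Carrier) →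
                      (∀ j → p j ≋ v ⊕ lin (A j) z) → (w : Fin q → Carrier) → sum w ≈ 0# →
                      (∀ l → sum (λ j → w j * A j l) ≈ 0#) → ∀ i → sum (λ j → w j * p j i) ≈ 0#
    affine-relation p v z A p≋ w Σw≈0 Σwa≈0 i = begin
      sum (λ j → w j * p j i)
        ≈⟨ sum-cong (λ j → trans (*-congˡ (p≋ j i)) (distribˡ (w j) (v i) (lin (A j) z i))) ⟩
      sum (λ j → w j * v i + w j * lin (A j) z i)
        ≈⟨ ∑-distrib-+ (λ j → w j * v i) (λ j → w j * lin (A j) z i) ⟩
      sum (λ j → w j * v i) + sum (λ j → w j * lin (A j) z i)
        ≈⟨ +-cong (trans (sym (sum-* (v i) w)) (trans (*-congʳ Σw≈0) (zeroˡ (v i)))) (begin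
          sum (λ j → w j * lin (A j) z i)
            ≈⟨ sum-cong (λ j → *-sum (w j) (λ l → A j l * z l i)) ⟩
          sum (λ j → sum (λ l → w j * (A j l * z l i)))
            ≈⟨ ∑-comm (λ j l → w j * (A j l * z l i)) ⟩
          sum (λ l → sum (λ j → w j * (A j l * z l i)))
            ≈⟨ sum-zero (λ l → begin
              sum (λ j → w j * (A j l * z l i))  ≈⟨ sum-cong (λ j → *-assoc (w j) (A j l) (z l i)) ⟨
              sum (λ j → w j * A j l * z l i)    ≈⟨ sum-* (z l i) (λ j → w j * A j l) ⟨
              sum (λ j → w j * A j l) * z l i    ≈⟨ *-congʳ (Σwa≈0 l) ⟩
              0# * z l i                         ≈⟨ zeroˡ _ ⟩
              0#                                 ∎) ⟩
          0# ∎) ⟩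
      0# + 0#   ≈⟨ +-identityʳ 0# ⟩
      0#        ∎

    -- An affine relation among the points follows from k + 1 linear equations for the weights: one
    -- for each generator in `z`, and one for the sum of the weights.
    independent⇒≤ : ∀ {q k} (p : Fin q → Point I) v (z : Fin k → Point I) →
                    AffinelyIndependent p → (∀ j → ∃ λ t → p j ≋ v ⊕ lin t z) → q ℕ.≤ suc k
    independent⇒≤ {q} {k} p v z independent p∈span = ℕ.≮⇒≥ λ 1+k<q → absurd (nontrivial-solution (suc k) 1+k<q system)
      where
      A : Fin q → Fin k → Carrier
      A j = proj₁ (p∈span j)
      system : Fin (suc k) → Fin q → Carrier
      system zero    j = 1#
      system (suc l) j = A j l
      absurd : ¬ (∃ λ (w : Fin q → Carrier) → (∃ λ j → ¬ (w j ≈ 0#)) × (∀ i → sum (λ j → w j * system i j) ≈ 0#))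
      absurd (w , (j , wj≉0) , solves) = wj≉0 (independent w Σw≈0
        (affine-relation p v z A (λ j → proj₂ (p∈span j)) w Σw≈0 (solves ∘ suc)) j)
        where
        Σw≈0 : sum w ≈ 0#
        Σw≈0 = trans (sum-cong λ j → sym (*-identityʳ (w j))) (solves zero)

    -- If lin s z ≋ 𝟎 with s l ≉ 0, then z l can be eliminated from the
    -- affine combinations, which frees one equation of the linear system.
    spanning⇒independent : ∀ {q k} (p : Fin q → Point I) v (z : Fin k → Point I) →
                           AffinelyIndependent p → (∀ j → ∃ λ t → p j ≋ v ⊕ lin t z) → k ℕ.< q →
                           ∀ s → lin s z ≋ 𝟎 → ∀ l → s l ≈ 0#
    spanning⇒independent {q} {k} p v z independent p∈span k<q s s-relation l =
      by-contradiction λ sl≉0 → absurd sl≉0 (nontrivial-solution k k<q system)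
      where
      A : Fin q → Fin k → Carrier
      A j l′ = proj₁ (p∈span j) l′ + - (proj₁ (p∈span j) l * s l ⁻¹) * s l′
      A-combination : ∀ j → p j ≋ v ⊕ lin (A j) z
      A-combination j i = begin
        p j i                    ≈⟨ proj₂ (p∈span j) i ⟩
        v i + lin t z i          ≈⟨ +-congˡ (solve 2 (λ x c → x := x :+ c :* 0′) refl (lin t z i) c) ⟩
        v i + (lin t z i + c * 0#) ≈⟨ +-congˡ (+-congˡ (*-congˡ (s-relation i))) ⟨
        v i + (lin t z i + c * lin s z i) ≈⟨ +-congˡ (lin-⊕⊛ t c s z i) ⟨
        v i + lin (A j) z i      ∎
        where
        t = proj₁ (p∈span j)
        c = - (t l * s l ⁻¹)
      A-eliminated : ¬ (s l ≈ 0#) → ∀ j → A j l ≈ 0#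
      A-eliminated sl≉0 j = begin
        t + - (t * s l ⁻¹) * s l
          ≈⟨ solve 3 (λ t i s → t :+ (:- (t :* i)) :* s := t :- t :* (s :* i)) refl t (s l ⁻¹) (s l) ⟩
        t - t * (s l * s l ⁻¹)     ≈⟨ +-congˡ (-‿cong (*-congˡ (⁻¹-inverse sl≉0))) ⟩
        t - t * 1#                 ≈⟨ solve 1 (λ t → t :- t :* 1′ := 0′) refl t ⟩
        0#                         ∎
        where t = proj₁ (p∈span j) l
      -- The equation of the eliminated generator holds trivially, so its place is given to the
      -- condition that the weights sum to 0.
      system : Fin k → Fin q → Carrier
      system = (λ l′ j → A j l′) [ l ≔ (λ j → 1#) ]
      absurd : ¬ (s l ≈ 0#) →
               ¬ (∃ λ (w : Fin q → Carrier) → (∃ λ j → ¬ (w j ≈ 0#)) × (∀ i → sum (λ j → w j * system i j) ≈ 0#))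
      absurd sl≉0 (w , (j , wj≉0) , solves) =
        wj≉0 (independent w Σw≈0 (affine-relation p v z A A-combination w Σw≈0 vanish) j)
        where
        Σw≈0 : sum w ≈ 0#
        Σw≈0 = trans (sum-cong λ j → sym (*-identityʳ (w j)))
          (≡.subst (λ row → sum (λ j → w j * row j) ≈ 0#) (≔-same (λ l′ j → A j l′) l (λ j → 1#)) (solves l))
        vanish : ∀ l′ → sum (λ j → w j * A j l′) ≈ 0#
        vanish l′ with l′ Fin.≟ l
        ... | yes ≡.refl = sum-zero λ j → trans (*-congˡ (A-eliminated sl≉0 j)) (zeroʳ (w j))
        ... | no l′≢l    =
          ≡.subst (λ row → sum (λ j → w j * row j) ≈ 0#) (≔-other (λ l′ j → A j l′) l (λ j → 1#) l′≢l) (solves l′)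

-- Polyhedral cones: extreme rays, Minkowski's theorem and flags

module Cones (em : ExcludedMiddle 0ℓ) (ℝ : CompleteOrderedField) where
  open Classical em
  open CompleteOrderedField ℝ hiding (zero)
  open RingSolver commutativeRing
  open OrderedField em ℝ
  open Vectors em ℝ
  open Geometry ℝ using (Point; _≋_; _·_)
  open Relation.Binary.Reasoning.Setoid setoid

  module _ {m n : ℕ} (a : Fin m → Point (Fin n)) where

    Cone : Subset m → Pred (Point (Fin n)) 0ℓ
    Cone I y = ∀ k → k ∈ₛ I → a k · y ≤ 0#

    Pointed : Subset m → Set
    Pointed I = ∀ w → (∀ k → k ∈ₛ I → a k · w ≈ 0#) → w ≋ 𝟎

    tight slack : Subset m → Point (Fin n) → Subset m
    tight I y = ⟪ (λ k → k ∈ₛ I × a k · y ≈ 0#) ⟫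
    slack I y = ⟪ (λ k → k ∈ₛ I × ¬ (a k · y ≈ 0#)) ⟫

    -- For `z` in the cone, this says that `y` lies in the linear hull of the smallest face
    -- containing `z`; if `y` is in the cone too, it lies in that face.
    _≼[_]_ : Point (Fin n) → Subset m → Point (Fin n) → Set
    y ≼[ I ] z = ∀ k → k ∈ₛ I → a k · z ≈ 0# → a k · y ≈ 0#

    -- An extreme ray, as a direction determined up to a scalar by its tight rows. Directions are
    -- compared only through the rows of I, so that the notion also fits cones with a lineality
    -- space; `flag` applies it to the rows tight at a point, whose cone is of this kind.
    record Ray (I : Subset m) (z : Point (Fin n)) : Set where
      field
        in-cone  : Cone I z
        non-zero : ∃ λ k → k ∈ₛ I × ¬ (a k · z ≈ 0#)
        unique   : ∀ w → w ≼[ I ] z → ∃ λ c → ∀ k → k ∈ₛ I → a k · w ≈ c * (a k · z)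

    slack-⊂ : ∀ {I y y′} → y′ ≼[ I ] y → (∃ λ k → k ∈ₛ I × ¬ (a k · y ≈ 0#) × a k · y′ ≈ 0#) → ∣ slack I y′ ∣ ℕ.< ∣ slack I y ∣
    slack-⊂ {I} {y} {y′} y′≼y (k , k∈I , ≉0 , ≈0) = Subset.p⊂q⇒∣p∣<∣q∣ {p = slack I y′} {q = slack I y}
      ( (λ {l} l∈ → let l∈I , l≉0 = ∈⟪⟫⁻ l∈ in ∈⟪⟫⁺ (l∈I , l≉0 ∘ y′≼y l l∈I))
      , k , ∈⟪⟫⁺ (k∈I , ≉0) , λ k∈ → proj₂ (∈⟪⟫⁻ k∈) ≈0)

    -- If z is in the cone and has slack at i, but is not a ray, then some w
    -- vanishes on the tight constraints of z and on i, but not on all of I.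
    -- Moving from z in direction w makes another constraint tight.
    ray-below : ∀ I y → Cone I y → (∃ λ k → k ∈ₛ I × ¬ (a k · y ≈ 0#)) → ∃ λ z → Ray I z × z ≼[ I ] y
    ray-below I y = search (suc ∣ slack I y ∣) y ℕ.≤-refl
      where
      Goal : Point (Fin n) → Set
      Goal y = ∃ λ z → Ray I z × z ≼[ I ] y
      search : ∀ fuel y → ∣ slack I y ∣ ℕ.< fuel → Cone I y → (∃ λ k → k ∈ₛ I × ¬ (a k · y ≈ 0#)) → Goal y
      search (suc fuel) y slack≤ y∈ (i , i∈I , aiy≉0) =
        conclude (em {∀ w → w ≼[ I ] y → ∃ λ c → ∀ k → k ∈ₛ I → a k · w ≈ c * (a k · y)})
        where
        turn : ∀ w → w ≼[ I ] y → a i · w ≈ 0# → (∃ λ k → k ∈ₛ I × 0# < a k · w) → Goal y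
        turn w w≼y aiw≈0 ∃0<aw = arrive (walk (_∈ₛ I) (λ k → a k · y) (λ k → a k · w) y∈ ∃0<aw)
          where
          arrive : (∃ λ t → 0# ≤ t × (∃ λ k → k ∈ₛ I × 0# < a k · w × a k · y + t * (a k · w) ≈ 0#) ×
                          (∀ k → k ∈ₛ I → a k · y + t * (a k · w) ≤ 0#)) → Goal y
          arrive (t , 0≤t , (k , k∈I , 0<akw , tight-k) , valid) =
            let z , ray , z≼y′ = search fuel y′
                                   (ℕ.<-≤-trans (slack-⊂ y′≼y (k , k∈I , (λ e → <⇒≉ 0<akw (sym (w≼y k k∈I e))) , trans (ay′ k) tight-k))
                                     (ℕ.≤-pred slack≤))
                                   (λ l l∈I → ≤-resp (sym (ay′ l)) refl (valid l l∈I))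
                                   (i , i∈I , λ e → aiy≉0 (begin
                                     a i · y                  ≈⟨ solve 2 (λ x t → x := x :+ t :* 0′) refl (a i · y) t ⟩
                                     a i · y + t * 0#         ≈⟨ +-congˡ (*-congˡ aiw≈0) ⟨
                                     a i · y + t * (a i · w)  ≈⟨ ay′ i ⟨
                                     a i · y′                 ≈⟨ e ⟩
                                     0#                       ∎))
            in z , ray , λ l l∈I e → z≼y′ l l∈I (y′≼y l l∈I e)
            where
            y′ : Point (Fin n)
            y′ = y ⊕ t ⊛ w
            ay′ : ∀ k → a k · y′ ≈ a k · y + t * (a k · w)
            ay′ k = ·-⊕⊛ (a k) y t w
            y′≼y : y′ ≼[ I ] y
            y′≼y l l∈I e = begin
              a l · y′                 ≈⟨ ay′ l ⟩
              a l · y + t * (a l · w)  ≈⟨ +-cong e (*-congˡ (w≼y l l∈I e)) ⟩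
              0# + t * 0#              ≈⟨ solve 1 (λ t → 0′ :+ t :* 0′ := 0′) refl t ⟩
              0#                       ∎
        deviate : ∀ w → w ≼[ I ] y → ¬ (∃ λ c → ∀ k → k ∈ₛ I → a k · w ≈ c * (a k · y)) → Goal y
        deviate w w≼y ¬multiple = orient (by-contradiction λ ¬∃ → ¬multiple (c , λ k k∈I → begin
            a k · w                                 ≈⟨ solve 2 (λ x y → x := (x :- y) :+ y) refl (a k · w) (c * (a k · y)) ⟩
            (a k · w - c * (a k · y)) + c * (a k · y)
              ≈⟨ +-congʳ (trans (sym (aw′ k)) (by-contradiction λ ≉0 → ¬∃ (k , k∈I , ≉0))) ⟩
            0# + c * (a k · y)                      ≈⟨ +-identityˡ _ ⟩
            c * (a k · y)                           ∎))
          where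
          -- This multiple of `y` makes row `i` vanish on `w′`. The walk then preserves the slack of
          -- `y` at `i`, so its end is still nonzero on I.
          c : Carrier
          c = a i · w * (a i · y) ⁻¹
          w′ : Point (Fin n)
          w′ = w ⊖ c ⊛ y
          aw′ : ∀ k → a k · w′ ≈ a k · w - c * (a k · y)
          aw′ k = trans (·-⊖ (a k) w (c ⊛ y)) (+-congˡ (-‿cong (·-⊛ (a k) c y)))
          w′≼y : w′ ≼[ I ] y
          w′≼y k k∈I e = begin
            a k · w′                  ≈⟨ aw′ k ⟩
            a k · w - c * (a k · y)   ≈⟨ +-cong (w≼y k k∈I e) (-‿cong (*-congˡ e)) ⟩
            0# - c * 0#               ≈⟨ solve 1 (λ c → 0′ :- c :* 0′ := 0′) refl c ⟩
            0#                        ∎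
          aiw′≈0 : a i · w′ ≈ 0#
          aiw′≈0 = begin
            a i · w′                                        ≈⟨ aw′ i ⟩
            a i · w - a i · w * (a i · y) ⁻¹ * (a i · y)
              ≈⟨ solve 3 (λ x y z → x :- x :* z :* y := x :- x :* (y :* z)) refl (a i · w) (a i · y) _ ⟩
            a i · w - a i · w * (a i · y * (a i · y) ⁻¹)    ≈⟨ +-congˡ (-‿cong (*-congˡ (⁻¹-inverse aiy≉0))) ⟩
            a i · w - a i · w * 1#                          ≈⟨ solve 1 (λ t → t :- t :* 1′ := 0′) refl (a i · w) ⟩
            0#                                              ∎
          a-neg : ∀ k → a k · ((- 1#) ⊛ w′) ≈ - (a k · w′)
          a-neg k = trans (·-⊛ (a k) (- 1#) w′) (solve 1 (λ x → (:- 1′) :* x := :- x) refl (a k · w′))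
          orient : (∃ λ k → k ∈ₛ I × ¬ (a k · w′ ≈ 0#)) → Goal y
          orient (k , k∈I , ≉0) = [ (λ 0≤ → turn w′ w′≼y aiw′≈0 (k , k∈I , ≤∧≉⇒< 0≤ (≉0 ∘ sym)))
                                  , (λ ≤0 → turn ((- 1#) ⊛ w′)
                                      (λ l l∈I e → trans (a-neg l) (trans (-‿cong (w′≼y l l∈I e)) -0≈0))
                                      (trans (a-neg i) (trans (-‿cong aiw′≈0) -0≈0))
                                      (k , k∈I , <-resp refl (sym (a-neg k)) (0<- (≤∧≉⇒< ≤0 ≉0)))) ]′
                                  (≤.total 0# (a k · w′))
            where
            -0≈0 : - 0# ≈ 0#
            -0≈0 = solve 0 (:- 0′ := 0′) refl
        conclude : Dec (∀ w → w ≼[ I ] y → ∃ λ c → ∀ k → k ∈ₛ I → a k · w ≈ c * (a k · y)) → Goal y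
        conclude (yes multiple) = y , record { in-cone = y∈ ; non-zero = i , i∈I , aiy≉0 ; unique = multiple } , λ _ _ e → e
        conclude (no ¬multiple) =
          let w , ¬w = ¬∀⇒∃¬ ¬multiple
          in deviate w (by-contradiction λ ¬≼ → ¬w λ ≼ → contradiction ≼ ¬≼) (λ multiple → ¬w λ _ → multiple)

    -- Minkowski's theorem, as an induction principle.
    minkowski : ∀ I → Pointed I → (K : Pred (Point (Fin n)) 0ℓ) →
                (∀ {x y} → x ≋ y → K x → K y) → K 𝟎 →
                (∀ y z t → K y → Ray I z → 0# ≤ t → K (y ⊕ t ⊛ z)) →
                ∀ y → Cone I y → K y
    minkowski I pointed K K-resp K-𝟎 K-ray y = go (suc ∣ slack I y ∣) y ℕ.≤-refl
      where
      go : ∀ fuel y → ∣ slack I y ∣ ℕ.< fuel → Cone I y → K y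
      go (suc fuel) y slack≤ y∈ = split (em {∃ λ k → k ∈ₛ I × ¬ (a k · y ≈ 0#)})
        where
        -- The largest multiple of the ray that can be subtracted within the cone makes a further
        -- row tight, while the rows tight at `y` stay tight; the number of slack rows drops.
        shrink : ∀ z → Ray I z → z ≼[ I ] y → K y
        shrink z ray z≼y = arrive (walk (_∈ₛ I) (λ k → a k · y) (λ k → - (a k · z)) y∈
            (let k , k∈I , ≉0 = Ray.non-zero ray in k , k∈I , 0<- (≤∧≉⇒< (Ray.in-cone ray k k∈I) ≉0)))
          where
          arrive : (∃ λ t → 0# ≤ t × (∃ λ k → k ∈ₛ I × 0# < - (a k · z) × a k · y + t * - (a k · z) ≈ 0#) ×
                          (∀ k → k ∈ₛ I → a k · y + t * - (a k · z) ≤ 0#)) → K y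
          arrive (t , 0≤t , (k , k∈I , 0<-akz , tight-k) , valid) =
            K-resp (λ i → solve 3 (λ y t z → (y :+ (:- t) :* z) :+ t :* z := y) refl (y i) t (z i))
              (K-ray y′ z t
                (go fuel y′ (ℕ.<-≤-trans (slack-⊂ y′≼y (k , k∈I , (λ e → <⇒≉ 0<-akz (begin
                    0#           ≈⟨ solve 0 (0′ := :- 0′) refl ⟩
                    - 0#         ≈⟨ -‿cong (z≼y k k∈I e) ⟨
                    - (a k · z)  ∎)) , trans (ay′ k) tight-k)) (ℕ.≤-pred slack≤))
                  (λ l l∈I → ≤-resp (sym (ay′ l)) refl (valid l l∈I)))
                ray 0≤t)
            where
            y′ : Point (Fin n)
            y′ = y ⊕ (- t) ⊛ z
            ay′ : ∀ k → a k · y′ ≈ a k · y + t * - (a k · z)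
            ay′ k = trans (·-⊕⊛ (a k) y (- t) z) (+-congˡ (solve 2 (λ t x → (:- t) :* x := t :* (:- x)) refl t (a k · z)))
            y′≼y : y′ ≼[ I ] y
            y′≼y l l∈I e = begin
              a l · y′                    ≈⟨ ay′ l ⟩
              a l · y + t * - (a l · z)   ≈⟨ +-cong e (*-congˡ (-‿cong (z≼y l l∈I e))) ⟩
              0# + t * - 0#               ≈⟨ solve 1 (λ t → 0′ :+ t :* (:- 0′) := 0′) refl t ⟩
              0#                          ∎
        split : Dec (∃ λ k → k ∈ₛ I × ¬ (a k · y ≈ 0#)) → K y
        split (yes nz) = let z , ray , z≼y = ray-below I y y∈ nz in shrink z ray z≼y
        split (no ¬nz) = K-resp (≋-sym (pointed y λ k k∈I → by-contradiction λ ≉0 → ¬nz (k , k∈I , ≉0))) K-𝟎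

    Spanned : Pred (Point (Fin n)) 0ℓ → {k : ℕ} → (Fin k → Point (Fin n)) → Set
    Spanned E b = ∀ w → E w → ∃ λ t → w ≋ lin t b

    -- Each step to the next larger face of a flag raises both the dimension
    -- (the number of vectors b) and any monotone measure φ, the former by 1.
    flag : ∀ I (φ : Point (Fin n) → ℕ) →
           (∀ y y′ → Cone I y → Cone I y′ → y ≼[ I ] y′ → (∃ λ k → k ∈ₛ I × a k · y ≈ 0# × ¬ (a k · y′ ≈ 0#)) → φ y ℕ.< φ y′) →
           ∀ y → Cone I y → ∀ {r} (b : Fin r → Point (Fin n)) → Spanned (_≼[ I ] y) b →
           ∃ λ r′ → ∃ λ (b′ : Fin r′ → Point (Fin n)) → Spanned (Cone I) b′ ×
           ∃ λ y′ → Cone I y′ × φ y ℕ.+ r′ ℕ.≤ φ y′ ℕ.+ r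
    flag I φ φ-mono y = climb (suc ∣ tight I y ∣) y ℕ.≤-refl
      where
      Goal : Point (Fin n) → ℕ → Set
      Goal y r = ∃ λ r′ → ∃ λ (b′ : Fin r′ → Point (Fin n)) → Spanned (Cone I) b′ ×
                 ∃ λ y′ → Cone I y′ × φ y ℕ.+ r′ ℕ.≤ φ y′ ℕ.+ r
      climb : ∀ fuel y → ∣ tight I y ∣ ℕ.< fuel → Cone I y → ∀ {r} (b : Fin r → Point (Fin n)) → Spanned (_≼[ I ] y) b → Goal y r
      climb (suc fuel) y tight≤ y∈ {r} b spanned = split (em {∃ λ y₀ → Cone I y₀ × ¬ (y₀ ≼[ I ] y)})
        where
        step : ∀ z → Ray (tight I y) z → Goal y r
        step z ray = next (small-step (_∈ₛ I) (λ k → a k · y) (λ k → a k · z) y∈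
                             (λ k k∈I e → Ray.in-cone ray k (∈⟪⟫⁺ (k∈I , e))))
          where
          next : (∃ λ ε → 0# < ε × (∀ k → k ∈ₛ I → a k · y + ε * (a k · z) ≤ 0#)) → Goal y r
          next (ε , 0<ε , valid) =
            let r′ , b′ , spans , y″ , y″∈ , φ≤ =
                  climb fuel y′ (ℕ.<-≤-trans (Subset.p⊂q⇒∣p∣<∣q∣ {p = tight I y′} {q = tight I y}
                      ( (λ {l} l∈ → let l∈I , e = ∈⟪⟫⁻ l∈ in ∈⟪⟫⁺ (l∈I , y≼y′ l l∈I e))
                      , k₀ , ∈⟪⟫⁺ (k₀∈I , k₀-tight) , λ k∈ → k₀-slack (proj₂ (∈⟪⟫⁻ k∈))))
                    (ℕ.≤-pred tight≤)) y′∈ (z ∷ᵥ b) spanned′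
            in r′ , b′ , spans , y″ , y″∈ ,
               ℕ.≤-pred (ℕ.≤-trans (ℕ.+-monoˡ-≤ r′ (φ-mono y y′ y∈ y′∈ y≼y′ (k₀ , k₀∈I , k₀-tight , k₀-slack)))
                          (ℕ.≤-trans φ≤ (ℕ.≤-reflexive (ℕ.+-suc (φ y″) r))))
            where
            -- `y ⊕ ε ⊛ z` alone may make a row tight that is slack at `y`. Adding `y` once more
            -- keeps all such rows slack, which is what `y ≼[ I ] y′` asks for.
            y′ : Point (Fin n)
            y′ = y ⊕ (y ⊕ ε ⊛ z)
            ay′ : ∀ k → a k · y′ ≈ a k · y + (a k · y + ε * (a k · z))
            ay′ k = trans (·-⊕ (a k) y (y ⊕ ε ⊛ z)) (+-congˡ (·-⊕⊛ (a k) y ε z))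
            ay′-tight : ∀ k → a k · y ≈ 0# → a k · y′ ≈ ε * (a k · z)
            ay′-tight k e = trans (ay′ k) (trans (+-cong e (+-congʳ e)) (solve 1 (λ x → 0′ :+ (0′ :+ x) := x) refl _))
            y′∈ : Cone I y′
            y′∈ k k∈I = ≤-resp (sym (ay′ k)) refl (+≤0 (y∈ k k∈I) (valid k k∈I))
            y≼y′ : y ≼[ I ] y′
            y≼y′ k k∈I e = by-contradiction λ ≉0 →
              <⇒≉ (+<0 (≤∧≉⇒< (y∈ k k∈I) ≉0) (valid k k∈I)) (trans (sym (ay′ k)) e)
            k₀ = proj₁ (Ray.non-zero ray)
            k₀∈ = ∈⟪⟫⁻ (proj₁ (proj₂ (Ray.non-zero ray)))
            k₀∈I = proj₁ k₀∈
            k₀-tight = proj₂ k₀∈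
            k₀-slack : ¬ (a k₀ · y′ ≈ 0#)
            k₀-slack e = proj₂ (proj₂ (Ray.non-zero ray))
              (*-cancel-0 (<⇒≉ 0<ε ∘ sym) (trans (sym (ay′-tight k₀ k₀-tight)) e))
            -- On the rows tight at `y`, the vector `w` is a multiple of the ray `z`. Once this
            -- multiple is subtracted, the old generators span the rest, so the dimension grows by
            -- one generator only.
            spanned′ : Spanned (_≼[ I ] y′) (z ∷ᵥ b)
            spanned′ w w≼y′ = proj₁ c ∷ᵥ proj₁ rest , λ i → begin
              w i                                   ≈⟨ solve 2 (λ x y → x := y :+ (x :- y)) refl (w i) (proj₁ c * z i) ⟩
              proj₁ c * z i + (w ⊖ proj₁ c ⊛ z) i   ≈⟨ +-congˡ (proj₂ rest i) ⟩
              proj₁ c * z i + lin (proj₁ rest) b i  ∎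
              where
              c : ∃ λ c → ∀ k → k ∈ₛ tight I y → a k · w ≈ c * (a k · z)
              c = Ray.unique ray w λ k k∈ e → let k∈I , k-tight = ∈⟪⟫⁻ k∈ in
                    w≼y′ k k∈I (trans (ay′-tight k k-tight) (trans (*-congˡ e) (zeroʳ ε)))
              rest : ∃ λ t → w ⊖ proj₁ c ⊛ z ≋ lin t b
              rest = spanned (w ⊖ proj₁ c ⊛ z) λ k k∈I e → begin
                a k · (w ⊖ proj₁ c ⊛ z)                ≈⟨ ·-⊖ (a k) w (proj₁ c ⊛ z) ⟩
                a k · w - a k · (proj₁ c ⊛ z)
                  ≈⟨ +-cong (proj₂ c k (∈⟪⟫⁺ (k∈I , e))) (-‿cong (·-⊛ (a k) (proj₁ c) z)) ⟩
                proj₁ c * (a k · z) - proj₁ c * (a k · z) ≈⟨ -‿inverseʳ _ ⟩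
                0#                                     ∎
        split : Dec (∃ λ y₀ → Cone I y₀ × ¬ (y₀ ≼[ I ] y)) → Goal y r
        split (no ¬∃) = r , b , (λ w w∈ → spanned w (by-contradiction λ ¬≼ → ¬∃ (w , w∈ , ¬≼))) , y , y∈ , ℕ.≤-refl
        split (yes (y₀ , y₀∈ , ¬≼)) =
          let z , ray , _ = ray-below (tight I y) y₀ (λ k k∈ → y₀∈ k (proj₁ (∈⟪⟫⁻ k∈)))
                (by-contradiction λ ¬∃ → ¬≼ λ k k∈I e → by-contradiction λ ≉0 → ¬∃ (k , ∈⟪⟫⁺ (k∈I , e) , ≉0))
          in step z ray

-- Prisms: edges at a vertex, and faces described by these edges

count : (m : ℕ) → (Fin m → ℕ) → ℕ
count zero    g = 0
count (suc m) g = g zero ℕ.+ count m (g ∘ suc)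

enum : (m : ℕ) (g : Fin m → ℕ) → Fin (count m g) → Σ (Fin m) (Fin ∘ g)
enum (suc m) g a = [ (λ x → zero , x) , (λ b → let i , x = enum m (g ∘ suc) b in suc i , x) ]′ (Fin.splitAt (g zero) a)

enum-surjective : ∀ m g (p : Σ (Fin m) (Fin ∘ g)) → ∃ λ a → enum m g a ≡ p
enum-surjective (suc m) g (zero , x) =
  x Fin.↑ˡ count m (g ∘ suc) , ≡.cong [ _ , _ ]′ (Fin.splitAt-↑ˡ (g zero) x _)
enum-surjective (suc m) g (suc i , x) with enum-surjective m (g ∘ suc) (i , x)
... | b , ≡.refl = g zero Fin.↑ʳ b , ≡.cong [ _ , _ ]′ (Fin.splitAt-↑ʳ (g zero) _ b)

enum-injective : ∀ m g {a b} → enum m g a ≡ enum m g b → a ≡ b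
enum-injective (suc m) g {a} {b} e = splitAt-injective (cases (Fin.splitAt (g zero) a) (Fin.splitAt (g zero) b) e)
  where
  splitAt-injective : Fin.splitAt (g zero) a ≡ Fin.splitAt (g zero) b → a ≡ b
  splitAt-injective e′ = ≡.trans (≡.sym (Fin.join-splitAt (g zero) _ a))
    (≡.trans (≡.cong (Fin.join (g zero) _) e′) (Fin.join-splitAt (g zero) _ b))
  pair : Fin (g zero) ⊎ Fin (count m (g ∘ suc)) → Σ (Fin (suc m)) (Fin ∘ g)
  pair = [ (λ x → zero , x) , (λ b → let i , x = enum m (g ∘ suc) b in suc i , x) ]′
  suc-injective : ∀ {p q : Σ (Fin m) (Fin ∘ g ∘ suc)} →
                  _≡_ {A = Σ (Fin (suc m)) (Fin ∘ g)} (suc (proj₁ p) , proj₂ p) (suc (proj₁ q) , proj₂ q) → p ≡ q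
  suc-injective ≡.refl = ≡.refl
  cases : ∀ x y → pair x ≡ pair y → x ≡ y
  cases (inj₁ x) (inj₁ y) ≡.refl = ≡.refl
  cases (inj₁ x) (inj₂ y) ()
  cases (inj₂ x) (inj₁ y) ()
  cases (inj₂ x) (inj₂ y) e      = ≡.cong inj₂ (enum-injective m (g ∘ suc) (suc-injective e))

module Prisms (em : ExcludedMiddle 0ℓ) (ℝ : CompleteOrderedField) (P′ : Geometry.Prism ℝ) where
  open Classical em
  open CompleteOrderedField ℝ hiding (zero)
  open RingSolver commutativeRing
  open Algebra.Properties.Semiring.Sum semiring using (sum; ∑-comm)
  open OrderedField em ℝ
  open Vectors em ℝ
  open Geometry ℝ using (Point; _≋_; _·_; Simplex; HasDimension; AffinelyIndependent; module PrismFaces)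
  open Geometry.Prism P′
  open PrismFaces P′ using (Face; IsVertexAt) renaming (points to pointsOf)
  open Relation.Binary.Reasoning.Setoid setoid

  open module Factor i = Simplex (Δ i) using (dim; vertex; independent)

  infix 4 _∈ᵥ_
  _∈ᵥ_ : U → Face → Set
  u ∈ᵥ G = vertexPoint u ∈ pointsOf G

  value : Point Index → ∀ i → Fin (suc (dim i)) → Carrier
  value c i x = (λ j → c (i , j)) · vertex i x

  dot-cong : ∀ c {x y} → x ≋ y → dot c x ≈ dot c y
  dot-cong c e = sum-cong λ i → ·-cong (λ j → c (i , j)) λ j → e (i , j)

  vertexPoint∈points : ∀ u → vertexPoint u ∈ points
  vertexPoint∈points u i =
    (λ x → [ x ≟ u i ]) , (λ x → 0≤≟ x (u i)) , sum-≟1 (u i) , λ j → sym (sum-≟ (u i) (λ x → vertex i x j))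

  points-resp : ∀ {x y} → x ≋ y → x ∈ points → y ∈ points
  points-resp e x∈ i = let w , 0≤w , Σw , x≈ = x∈ i in w , 0≤w , Σw , λ j → trans (sym (e (i , j))) (x≈ j)

  face-resp : ∀ (G : Face) {x y} → x ≋ y → x ∈ pointsOf G → y ∈ pointsOf G
  face-resp G e (x∈ , eq) = points-resp e x∈ , trans (dot-cong (Face.normal G) (≋-sym e)) eq

  vertexPoint-cong : ∀ {u w} → u ≗ w → vertexPoint u ≋ vertexPoint w
  vertexPoint-cong e (i , j) = reflexive (≡.cong (λ x → vertex i x j) (e i))

  ∈ᵥ-resp : ∀ G {u w} → u ≗ w → u ∈ᵥ G → w ∈ᵥ G
  ∈ᵥ-resp G e = face-resp G (vertexPoint-cong e)

  ≔-self : ∀ (u : U) i → u [ i ≔ u i ] ≗ u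
  ≔-self u i = ≔-all (λ k x → x ≡ u k) u i (u i) (λ _ _ → ≡.refl) ≡.refl

  vertex-injective : ∀ i {x y} → vertex i x ≋ vertex i y → x ≡ y
  vertex-injective i {x} {y} e = by-contradiction λ x≢y → 0≉1 (sym (begin
    1#                           ≈⟨ solve 0 (1′ := 1′ :- 0′) refl ⟩
    1# - 0#                      ≈⟨ +-cong (≟-same {i = x} ≡.refl) (-‿cong (≟-distinct x≢y)) ⟨
    [ x ≟ x ] - [ x ≟ y ]        ≈⟨ independent i (λ z → [ z ≟ x ] - [ z ≟ y ])
      (trans (sum-sub (λ z → [ z ≟ x ]) (λ z → [ z ≟ y ])) (trans (+-cong (sum-≟1 x) (-‿cong (sum-≟1 y))) (-‿inverseʳ 1#)))
      (λ j → begin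
        sum (λ z → ([ z ≟ x ] - [ z ≟ y ]) * vertex i z j)
          ≈⟨ sum-cong (λ z → solve 3 (λ a b c → (a :- b) :* c := a :* c :- b :* c) refl [ z ≟ x ] [ z ≟ y ] (vertex i z j)) ⟩
        sum (λ z → [ z ≟ x ] * vertex i z j - [ z ≟ y ] * vertex i z j)
          ≈⟨ sum-sub (λ z → [ z ≟ x ] * vertex i z j) (λ z → [ z ≟ y ] * vertex i z j) ⟩
        sum (λ z → [ z ≟ x ] * vertex i z j) - sum (λ z → [ z ≟ y ] * vertex i z j)
          ≈⟨ +-cong (sum-≟ x (λ z → vertex i z j)) (-‿cong (sum-≟ y (λ z → vertex i z j))) ⟩
        vertex i x j - vertex i y j
          ≈⟨ +-congʳ (e j) ⟩
        vertex i y j - vertex i y j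
          ≈⟨ -‿inverseʳ _ ⟩
        0# ∎) x ⟩
    0#                           ∎))

  vertexPoint-injective : ∀ {u w} → vertexPoint u ≋ vertexPoint w → u ≗ w
  vertexPoint-injective e i = vertex-injective i λ j → e (i , j)

  module _ (c : Point Index) (u : U) where

    -- A functional splits over the factors of the prism, so its drop from `u` to another vertex is
    -- the sum of its drops along edges at `u`. This is the source of the Boolean structure of the
    -- faces at `u`.
    gap : ∀ i → Fin (suc (dim i)) → Carrier
    gap i x = value c i (u i) - value c i x

    dot-gap : ∀ w → dot c (vertexPoint u) - dot c (vertexPoint w) ≈ sum (λ i → gap i (w i))
    dot-gap w = sym (sum-sub (λ i → value c i (u i)) (λ i → value c i (w i)))

    gap-self : ∀ i → gap i (u i) ≈ 0#
    gap-self i = -‿inverseʳ _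

    dot-gap-≔ : ∀ i x → dot c (vertexPoint u) - dot c (vertexPoint (u [ i ≔ x ])) ≈ gap i x
    dot-gap-≔ i x = begin
      dot c (vertexPoint u) - dot c (vertexPoint (u [ i ≔ x ]))   ≈⟨ dot-gap (u [ i ≔ x ]) ⟩
      sum (λ k → gap k ((u [ i ≔ x ]) k))
        ≈⟨ sum-single _ i (λ k k≢i → trans (reflexive (≡.cong (gap k) (≔-other u i x k≢i))) (gap-self k)) ⟩
      gap i ((u [ i ≔ x ]) i)                                     ≡⟨ ≡.cong (gap i) (≔-same u i x) ⟩
      gap i x                                                     ∎

    -- The same splitting for an arbitrary point, whose barycentric coordinates in the factors
    -- weight the drops.
    dot-weights : ∀ {x} (x∈ : x ∈ points) →
                  dot c (vertexPoint u) - dot c x ≈ sum (λ i → sum (λ y → proj₁ (x∈ i) y * gap i y))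
    dot-weights {x} x∈ = trans
      (sym (sum-sub (λ i → value c i (u i)) (λ i → (λ j → c (i , j)) · (λ j → x (i , j)))))
      (sum-cong λ i → let w , _ , Σw , x≈ = x∈ i in begin
        value c i (u i) - (λ j → c (i , j)) · (λ j → x (i , j))
          ≈⟨ +-cong
               (begin
                 value c i (u i)           ≈⟨ *-identityˡ _ ⟨
                 1# * value c i (u i)      ≈⟨ *-congʳ Σw ⟨
                 sum w * value c i (u i)   ≈⟨ sum-* (value c i (u i)) w ⟩
                 sum (λ y → w y * value c i (u i)) ∎)
               (-‿cong (trans (·-cong (λ j → c (i , j)) x≈) (·-lin (λ j → c (i , j)) w (vertex i)))) ⟩
        sum (λ y → w y * value c i (u i)) - sum (λ y → w y * value c i y)
          ≈⟨ sum-sub (λ y → w y * value c i (u i)) (λ y → w y * value c i y) ⟨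
        sum (λ y → w y * value c i (u i) - w y * value c i y)
          ≈⟨ sum-cong (λ y → solve 3 (λ w a b → w :* a :- w :* b := w :* (a :- b)) refl (w y) (value c i (u i)) (value c i y)) ⟩
        sum (λ y → w y * gap i y) ∎)

  module _ (G : Face) {u : U} (u∈G : u ∈ᵥ G) where
    private c = Face.normal G

    0≤gap : ∀ i x → 0# ≤ gap c u i x
    0≤gap i x = ≤-resp refl (trans (+-congʳ (sym (proj₂ u∈G))) (dot-gap-≔ c u i x))
                  (≤⇒0≤- (Face.valid G _ (vertexPoint∈points (u [ i ≔ x ]))))

    ∈⇒gap≈0 : ∀ {i x} → (u [ i ≔ x ]) ∈ᵥ G → gap c u i x ≈ 0#
    ∈⇒gap≈0 {i} {x} (_ , e) = begin
      gap c u i x                                                ≈⟨ dot-gap-≔ c u i x ⟨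
      dot c (vertexPoint u) - dot c (vertexPoint (u [ i ≔ x ]))  ≈⟨ +-cong (proj₂ u∈G) (-‿cong e) ⟩
      Face.offset G - Face.offset G                              ≈⟨ -‿inverseʳ _ ⟩
      0#                                                         ∎

    dot≈⇒∈ : ∀ {x} → x ∈ points → dot c (vertexPoint u) - dot c x ≈ 0# → x ∈ pointsOf G
    dot≈⇒∈ {x} x∈ e = x∈ , (begin
      dot c x
        ≈⟨ solve 2 (λ a b → a := b :- (b :- a)) refl (dot c x) (dot c (vertexPoint u)) ⟩
      dot c (vertexPoint u) - (dot c (vertexPoint u) - dot c x)    ≈⟨ +-cong (proj₂ u∈G) (-‿cong e) ⟩
      Face.offset G - 0#                                           ≈⟨ solve 1 (λ a → a :- 0′ := a) refl _ ⟩
      Face.offset G                                                ∎)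

    gap≈0⇒∈ : ∀ {i x} → gap c u i x ≈ 0# → (u [ i ≔ x ]) ∈ᵥ G
    gap≈0⇒∈ {i} {x} e = dot≈⇒∈ (vertexPoint∈points _) (trans (dot-gap-≔ c u i x) e)

    neighbours∈⇒∈ : ∀ w → (∀ i → (u [ i ≔ w i ]) ∈ᵥ G) → w ∈ᵥ G
    neighbours∈⇒∈ w w∈ = dot≈⇒∈ (vertexPoint∈points w) (trans (dot-gap c u w) (sum-zero λ i → ∈⇒gap≈0 (w∈ i)))

    -- The functional of G is maximal at `u`, so no drop is negative; if their sum vanishes, each of
    -- them does.
    ∈⇒neighbours∈ : ∀ w → w ∈ᵥ G → ∀ i → (u [ i ≔ w i ]) ∈ᵥ G
    ∈⇒neighbours∈ w (_ , e) i = gap≈0⇒∈ (sum-nonneg-zero (λ i → 0≤gap i (w i))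
      (trans (sym (dot-gap c u w)) (trans (+-cong (proj₂ u∈G) (-‿cong e)) (-‿inverseʳ _))) i)

    ∈⇒weights : ∀ {x} (x∈G : x ∈ pointsOf G) → ∀ i y → proj₁ (proj₁ x∈G i) y * gap c u i y ≈ 0#
    ∈⇒weights {x} (x∈ , e) i = sum-nonneg-zero (λ y → *-nonNeg (proj₁ (proj₂ (x∈ i)) y) (0≤gap i y))
      (sum-nonneg-zero (λ i → sum-nonneg λ y → *-nonNeg (proj₁ (proj₂ (x∈ i)) y) (0≤gap i y))
        (trans (sym (dot-weights c u x∈)) (trans (+-cong (proj₂ u∈G) (-‿cong e)) (-‿inverseʳ _))) i)

    weight≈0 : ∀ {x} (x∈G : x ∈ pointsOf G) i y → ¬ ((u [ i ≔ y ]) ∈ᵥ G) → proj₁ (proj₁ x∈G i) y ≈ 0#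
    weight≈0 x∈G i y y∉G = *-cancel-0 (λ e → y∉G (gap≈0⇒∈ e)) (trans (*-comm _ _) (∈⇒weights x∈G i y))

  -- A point of G has weight only on vertices of the factors to which `u` can move inside G, and
  -- there the functional of H does not drop either.
  face-⊆ : ∀ (G H : Face) {u} → u ∈ᵥ G → u ∈ᵥ H →
           (∀ i x → (u [ i ≔ x ]) ∈ᵥ G → (u [ i ≔ x ]) ∈ᵥ H) → pointsOf G ⊆ pointsOf H
  face-⊆ G H {u} u∈G u∈H G⇒H {x} x∈G = dot≈⇒∈ H u∈H (proj₁ x∈G)
    (trans (dot-weights (Face.normal H) u (proj₁ x∈G)) (sum-zero λ i → sum-zero λ y → term i y (em {(u [ i ≔ y ]) ∈ᵥ G})))
    where
    term : ∀ i y → Dec ((u [ i ≔ y ]) ∈ᵥ G) → proj₁ (proj₁ x∈G i) y * gap (Face.normal H) u i y ≈ 0#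
    term i y (yes y∈G) = trans (*-congˡ (∈⇒gap≈0 H u∈H (G⇒H i y y∈G))) (zeroʳ _)
    term i y (no y∉G)  = trans (*-congʳ (weight≈0 G u∈G x∈G i y y∉G)) (zeroˡ _)

  isolated⇒IsVertexAt : ∀ (G : Face) {u} → u ∈ᵥ G → (∀ i x → x ≢ u i → ¬ ((u [ i ≔ x ]) ∈ᵥ G)) →
                        IsVertexAt G (vertexPoint u)
  isolated⇒IsVertexAt G {u} u∈G isolated = only , λ e → face-resp G e u∈G
    where
    only : ∀ {x} → x ∈ pointsOf G → vertexPoint u ≋ x
    only {x} x∈G (i , j) = sym (begin
      x (i , j)                            ≈⟨ proj₂ (proj₂ (proj₂ (proj₁ x∈G i))) j ⟩
      sum (λ y → w y * vertex i y j)
        ≈⟨ sum-single (λ y → w y * vertex i y j) (u i) (λ y y≢ → trans (*-congʳ (w≈0 y y≢)) (zeroˡ _)) ⟩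
      w (u i) * vertex i (u i) j           ≈⟨ *-congʳ (sum-single w (u i) w≈0) ⟨
      sum w * vertex i (u i) j             ≈⟨ *-congʳ (proj₁ (proj₂ (proj₂ (proj₁ x∈G i)))) ⟩
      1# * vertex i (u i) j                ≈⟨ *-identityˡ _ ⟩
      vertex i (u i) j                     ∎)
      where
      w = proj₁ (proj₁ x∈G i)
      w≈0 : ∀ y → y ≢ u i → w y ≈ 0#
      w≈0 y y≢ = weight≈0 G u∈G x∈G i y (isolated i y y≢)

  -- Maximizing the functional in every factor separately gives a vertex at which it is at least as
  -- large as at the given point of the face.
  nonempty⇒vertex : ∀ (G : Face) {x} → x ∈ pointsOf G → ∃ λ u → u ∈ᵥ G
  nonempty⇒vertex G {x} (x∈ , e) = u , vertexPoint∈points u , ≤.antisym (Face.valid G _ (vertexPoint∈points u))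
    (≤-resp e refl (0≤-⇒≤ (≤-resp refl (sym (dot-weights c u x∈))
      (sum-nonneg λ i → sum-nonneg λ y → *-nonNeg (proj₁ (proj₂ (x∈ i)) y) (0≤gap′ i y)))))
    where
    c = Face.normal G
    best : ∀ i → _
    best i = argmin (λ _ → Unit) (λ y → - value c i y) (zero , unit)
      where open import Data.Unit using () renaming (⊤ to Unit; tt to unit)
    u : U
    u i = proj₁ (best i)
    0≤gap′ : ∀ i y → 0# ≤ gap c u i y
    0≤gap′ i y = ≤-resp refl (solve 2 (λ a b → (:- b) :- (:- a) := a :- b) refl (value c i (u i)) (value c i y))
                   (≤⇒0≤- (proj₂ (proj₂ (best i)) y _))

  -- The number of edges of P′ at each vertex: in every factor, one towards each of the other
  -- vertices of that simplex.
  D : ℕ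
  D = count m dim

  coordinate : Fin D → Fin m
  coordinate a = proj₁ (enum m dim a)

  replacement : (u : U) (a : Fin D) → Fin (suc (dim (coordinate a)))
  replacement u a = punchIn (u (coordinate a)) (proj₂ (enum m dim a))

  neighbour : U → Fin D → U
  neighbour u a = u [ coordinate a ≔ replacement u a ]

  -- The conclusion is an equality of pairs because the type of the new coordinate depends on the
  -- factor; matching on it replaces both components at once.
  neighbour-surjective : ∀ u i x → x ≢ u i →
                         ∃ λ a → _≡_ {A = Σ (Fin m) (Fin ∘ suc ∘ dim)} (coordinate a , replacement u a) (i , x)
  neighbour-surjective u i x x≢ =
    let a , e = enum-surjective m dim (i , punchOut (x≢ ∘ ≡.sym))
    in a , ≡.trans (≡.cong (λ (i , k) → i , punchIn (u i) k) e) (≡.cong (i ,_) (Fin.punchIn-punchOut _))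

  neighbour-at : ∀ u a b → neighbour u b (coordinate a) ≡ replacement u a → a ≡ b
  neighbour-at u a b = enum-injective m dim ∘ same (enum m dim a) (enum m dim b)
    where
    same : (p q : Σ (Fin m) (Fin ∘ dim)) →
           (u [ proj₁ q ≔ punchIn (u (proj₁ q)) (proj₂ q) ]) (proj₁ p) ≡ punchIn (u (proj₁ p)) (proj₂ p) → p ≡ q
    same (i , k) (j , l) e with i Fin.≟ j
    ... | yes ≡.refl = ≡.cong (i ,_) (Fin.punchIn-injective (u i) k l (≡.sym e))
    ... | no _       = contradiction (≡.sym e) (Fin.punchInᵢ≢i (u i) k)

  -- `u` and its neighbours are affinely independent: in an affine relation the total weight at each
  -- vertex of each factor is 0, and `replacement u a` is used by the neighbour `a` only. If d < D,
  -- the first d + 2 of these points would contradict the dimension.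
  D≤dimension : U → ∀ {d} → HasDimension points d → D ℕ.≤ d
  D≤dimension u {d} (_ , no-more) = ℕ.≮⇒≥ λ d<D →
    no-more (λ j → vertexPoint (corner (τ d<D j))) (λ j → vertexPoint∈points (corner (τ d<D j))) (independent-corners d<D)
    where
    corner : Fin (suc D) → U
    corner zero    = u
    corner (suc a) = neighbour u a
    τ : d ℕ.< D → Fin (suc (suc d)) → Fin (suc D)
    τ d<D j = Fin.inject≤ j (s≤s d<D)
    independent-corners : ∀ d<D → AffinelyIndependent (λ j → vertexPoint (corner (τ d<D j)))
    independent-corners d<D w Σw≈0 relation j = coefficient (τ d<D j) ≡.refl
      where
      total : ∀ i → Fin (suc (dim i)) → Carrier
      total i x = sum (λ k → w k * [ x ≟ corner (τ d<D k) i ])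
      total≈0 : ∀ i x → total i x ≈ 0#
      total≈0 i = independent i (total i)
        (begin
          sum (λ x → sum (λ k → w k * [ x ≟ corner (τ d<D k) i ]))
            ≈⟨ ∑-comm (λ x k → w k * [ x ≟ corner (τ d<D k) i ]) ⟩
          sum (λ k → sum (λ x → w k * [ x ≟ corner (τ d<D k) i ]))
            ≈⟨ sum-cong (λ k → trans (sym (*-sum (w k) (λ x → [ x ≟ corner (τ d<D k) i ])))
                                (trans (*-congˡ (sum-≟1 (corner (τ d<D k) i))) (*-identityʳ (w k)))) ⟩
          sum w
            ≈⟨ Σw≈0 ⟩
          0# ∎)
        (λ j → begin
          sum (λ x → total i x * vertex i x j)
            ≈⟨ sum-cong (λ x → sum-* (vertex i x j) (λ k → w k * [ x ≟ corner (τ d<D k) i ])) ⟩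
          sum (λ x → sum (λ k → w k * [ x ≟ corner (τ d<D k) i ] * vertex i x j))
            ≈⟨ ∑-comm (λ x k → w k * [ x ≟ corner (τ d<D k) i ] * vertex i x j) ⟩
          sum (λ k → sum (λ x → w k * [ x ≟ corner (τ d<D k) i ] * vertex i x j))
            ≈⟨ sum-cong (λ k → begin
                 sum (λ x → w k * [ x ≟ corner (τ d<D k) i ] * vertex i x j)
                   ≈⟨ sum-cong (λ x → *-assoc (w k) [ x ≟ corner (τ d<D k) i ] (vertex i x j)) ⟩
                 sum (λ x → w k * ([ x ≟ corner (τ d<D k) i ] * vertex i x j))
                   ≈⟨ *-sum (w k) (λ x → [ x ≟ corner (τ d<D k) i ] * vertex i x j) ⟨
                 w k * sum (λ x → [ x ≟ corner (τ d<D k) i ] * vertex i x j)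
                   ≈⟨ *-congˡ (sum-≟ (corner (τ d<D k) i) (λ x → vertex i x j)) ⟩
                 w k * vertex i (corner (τ d<D k) i) j ∎) ⟩
          sum (λ k → w k * vertex i (corner (τ d<D k) i) j)
            ≈⟨ relation (i , j) ⟩
          0# ∎)
      neighbour-coefficient : ∀ k a → τ d<D k ≡ suc a → w k ≈ 0#
      neighbour-coefficient k a τk≡ = begin
        w k                                             ≈⟨ *-identityʳ (w k) ⟨
        w k * 1#                                        ≈⟨ *-congˡ (≟-same (≡.sym at-k)) ⟨
        w k * [ x ≟ corner (τ d<D k) i ]                ≈⟨ sum-single (λ l → w l * [ x ≟ corner (τ d<D l) i ]) k
                                                             (λ l l≢k → trans (*-congˡ (≟-distinct (λ x≡ → l≢k (only l (τ d<D l) ≡.refl (≡.sym x≡))))) (zeroʳ (w l))) ⟨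
        total i x                                       ≈⟨ total≈0 i x ⟩
        0#                                              ∎
        where
        i = coordinate a
        x = replacement u a
        at-k : corner (τ d<D k) i ≡ x
        at-k = ≡.trans (≡.cong (λ t → corner t i) τk≡) (≔-same u i x)
        only : ∀ l t → τ d<D l ≡ t → corner t i ≡ x → l ≡ k
        only l zero    _   e = contradiction (≡.sym e) (Fin.punchInᵢ≢i (u i) _)
        only l (suc b) τl≡ e = Fin.inject≤-injective (s≤s d<D) (s≤s d<D) l k
          (≡.trans τl≡ (≡.trans (≡.cong suc (≡.sym (neighbour-at u a b e))) (≡.sym τk≡)))
      coefficient : ∀ t → τ d<D j ≡ t → w j ≈ 0#
      coefficient (suc a) e = neighbour-coefficient j a e
      coefficient zero    e = trans (sym (sum-single w j λ k k≢j → other k k≢j (τ d<D k) ≡.refl)) Σw≈0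
        where
        other : ∀ k → k ≢ j → ∀ t → τ d<D k ≡ t → w k ≈ 0#
        other k k≢j (suc a) e′ = neighbour-coefficient k a e′
        other k k≢j zero    e′ = contradiction (Fin.inject≤-injective (s≤s d<D) (s≤s d<D) k j (≡.trans e′ (≡.sym e))) k≢j

-- Polyhedra: faces cut out by tight rows, and tangent cones

module Polyhedra (em : ExcludedMiddle 0ℓ) (ℝ : CompleteOrderedField) {n : ℕ} (P : Geometry.Polyhedron ℝ n) where
  open Classical em
  open CompleteOrderedField ℝ hiding (zero)
  open RingSolver commutativeRing
  open Algebra.Properties.Semiring.Sum semiring using (sum)
  open OrderedField em ℝ
  open Vectors em ℝ
  open Cones em ℝ
  open Geometry ℝ using (Point; _≋_; _·_; ⟦_⟧; Halfspace; module PolyhedronFaces)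
  open PolyhedronFaces P using (Face; IsVertexAt) renaming (points to pointsOf)
  open Relation.Binary.Reasoning.Setoid setoid

  #rows : ℕ
  #rows = length P

  row : Fin #rows → Point (Fin n)
  row k = Halfspace.normal (lookup P k)

  bound : Fin #rows → Carrier
  bound k = Halfspace.offset (lookup P k)

  ∈⇒≤ : ∀ {x} → x ∈ ⟦ P ⟧ → ∀ k → row k · x ≤ bound k
  ∈⇒≤ x∈ k = All.lookup x∈ (∈-lookup k)

  ≤⇒∈ : ∀ {x} → (∀ k → row k · x ≤ bound k) → x ∈ ⟦ P ⟧
  ≤⇒∈ {x} x≤ = All.tabulate λ H∈ → ≡.subst (λ H → x ∈ Halfspace.points H) (≡.sym (Any.lookup-index H∈)) (x≤ (Any.index H∈))

  ∈-resp : ∀ {x y} → x ≋ y → x ∈ ⟦ P ⟧ → y ∈ ⟦ P ⟧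
  ∈-resp e x∈ = ≤⇒∈ λ k → ≤-resp (·-cong (row k) e) refl (∈⇒≤ x∈ k)

  face-resp : ∀ (G : Face) {x y} → x ≋ y → x ∈ pointsOf G → y ∈ pointsOf G
  face-resp G e (x∈ , eq) = ∈-resp e x∈ , trans (·-cong (Face.normal G) (≋-sym e)) eq

  indicator : Subset #rows → Fin #rows → Carrier
  indicator I k with k Subset.∈? I
  ... | yes _ = 1#
  ... | no _  = 0#

  opaque

    -- The sum of the inequalities of I is valid, and it is an equality exactly where each of them
    -- is.
    rowFace : Subset #rows → Face
    rowFace I = record
      { normal = lin (indicator I) row
      ; offset = sum (λ k → indicator I k * bound k)
      ; valid  = λ x x∈ → 0≤-⇒≤ (≤-resp refl (sym (slack-sum x)) (sum-nonneg (0≤slack x∈)))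
      }
      module rowFace where
      slack-sum : ∀ x → sum (λ k → indicator I k * bound k) - lin (indicator I) row · x ≈
                        sum (λ k → indicator I k * (bound k - row k · x))
      slack-sum x = begin
        sum (λ k → indicator I k * bound k) - lin (indicator I) row · x
          ≈⟨ +-congˡ (-‿cong (lin-· (indicator I) row x)) ⟩
        sum (λ k → indicator I k * bound k) - sum (λ k → indicator I k * (row k · x))
          ≈⟨ sum-sub (λ k → indicator I k * bound k) (λ k → indicator I k * (row k · x)) ⟨
        sum (λ k → indicator I k * bound k - indicator I k * (row k · x))
          ≈⟨ sum-cong (λ k → solve 3 (λ w a b → w :* a :- w :* b := w :* (a :- b)) refl (indicator I k) (bound k) (row k · x)) ⟩
        sum (λ k → indicator I k * (bound k - row k · x)) ∎
      0≤slack : ∀ {x} → x ∈ ⟦ P ⟧ → ∀ k → 0# ≤ indicator I k * (bound k - row k · x)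
      0≤slack x∈ k with k Subset.∈? I
      ... | yes _ = *-nonNeg 0≤1 (≤⇒0≤- (∈⇒≤ x∈ k))
      ... | no _  = *-nonNeg ≤.refl (≤⇒0≤- (∈⇒≤ x∈ k))

  opaque
    unfolding rowFace

    ∈rowFace⁺ : ∀ I {x} → x ∈ ⟦ P ⟧ → (∀ k → k ∈ₛ I → row k · x ≈ bound k) → x ∈ pointsOf (rowFace I)
    ∈rowFace⁺ I {x} x∈ tight-I = x∈ , (begin
      lin (indicator I) row · x                          ≈⟨ lin-· (indicator I) row x ⟩
      sum (λ k → indicator I k * (row k · x))            ≈⟨ sum-cong term ⟩
      sum (λ k → indicator I k * bound k)                ∎)
      where
      term : ∀ k → indicator I k * (row k · x) ≈ indicator I k * bound k
      term k with k Subset.∈? I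
      ... | yes k∈I = *-congˡ (tight-I k k∈I)
      ... | no _    = trans (zeroˡ _) (sym (zeroˡ _))

    ∈rowFace⁻ : ∀ I {x} → x ∈ pointsOf (rowFace I) → ∀ k → k ∈ₛ I → row k · x ≈ bound k
    ∈rowFace⁻ I {x} (x∈ , e) k k∈I = begin
      row k · x                             ≈⟨ solve 2 (λ a b → a := b :- (b :- a)) refl (row k · x) (bound k) ⟩
      bound k - (bound k - row k · x)       ≈⟨ +-congˡ (-‿cong (term k k∈I (sum-nonneg-zero (rowFace.0≤slack I x∈)
                                                (trans (sym (rowFace.slack-sum I x)) (trans (+-congˡ (-‿cong e)) (-‿inverseʳ _))) k))) ⟩
      bound k - 0#                          ≈⟨ solve 1 (λ a → a :- 0′ := a) refl _ ⟩
      bound k                               ∎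
      where
      term : ∀ k → k ∈ₛ I → indicator I k * (bound k - row k · x) ≈ 0# → bound k - row k · x ≈ 0#
      term k k∈I e with k Subset.∈? I
      ... | yes _  = trans (sym (*-identityˡ _)) e
      ... | no k∉I = contradiction k∈I k∉I

  rowFace-anti : ∀ {I J} → (∀ {k} → k ∈ₛ J → k ∈ₛ I) → pointsOf (rowFace I) ⊆ pointsOf (rowFace J)
  rowFace-anti {I} {J} J⊆I x∈ = ∈rowFace⁺ J (proj₁ x∈) λ k k∈J → ∈rowFace⁻ I x∈ k (J⊆I k∈J)

  ∅-face : Face
  ∅-face = record { normal = 𝟎 ; offset = 1# ; valid = λ x _ → ≤-resp (sym (𝟎· x)) refl 0≤1 }
    module ∅-face where
    𝟎· : ∀ (x : Point (Fin n)) → 𝟎 · x ≈ 0#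
    𝟎· x = sum-zero λ i → zeroˡ (x i)

  ∉∅-face : ∀ {x} → ¬ (x ∈ pointsOf ∅-face)
  ∉∅-face {x} (_ , e) = 0≉1 (trans (sym (∅-face.𝟎· x)) e)

  module Tangent {v : Point (Fin n)} (v∈ : v ∈ ⟦ P ⟧) where

    active : Subset #rows
    active = ⟪ (λ k → row k · v ≈ bound k) ⟫

    Tangent : Pred (Point (Fin n)) 0ℓ
    Tangent = Cone row active

    v⊕ : ∀ x → v ⊕ (x ⊖ v) ≋ x
    v⊕ x i = solve 2 (λ v x → v :+ (x :- v) := x) refl (v i) (x i)

    ⊖v : ∀ {x y t} → x ≋ v ⊕ t ⊛ y → x ⊖ v ≋ t ⊛ y
    ⊖v {x} {y} {t} e i = trans (+-congʳ (e i)) (solve 2 (λ v y → v :+ y :- v := y) refl (v i) (t * y i))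

    row-⊖v : ∀ x {k} → k ∈ₛ active → row k · (x ⊖ v) ≈ row k · x - bound k
    row-⊖v x {k} k∈ = trans (·-⊖ (row k) x v) (+-congˡ (-‿cong (∈⟪⟫⁻ k∈)))

    tight⇒row≈ : ∀ x {k} → k ∈ₛ active → row k · (x ⊖ v) ≈ 0# → row k · x ≈ bound k
    tight⇒row≈ x {k} k∈ e = begin
      row k · x                         ≈⟨ solve 2 (λ a b → a := (a :- b) :+ b) refl (row k · x) (bound k) ⟩
      (row k · x - bound k) + bound k   ≈⟨ +-congʳ (trans (sym (row-⊖v x k∈)) e) ⟩
      0# + bound k                      ≈⟨ +-identityˡ _ ⟩
      bound k                           ∎

    row≈⇒tight : ∀ x {k} → k ∈ₛ active → row k · x ≈ bound k → row k · (x ⊖ v) ≈ 0#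
    row≈⇒tight x {k} k∈ e = trans (row-⊖v x k∈) (trans (+-congʳ e) (-‿inverseʳ _))

    ∈⇒Tangent : ∀ {x} → x ∈ ⟦ P ⟧ → Tangent (x ⊖ v)
    ∈⇒Tangent {x} x∈ k k∈ = ≤-resp (sym (row-⊖v x k∈)) refl
      (≤-resp refl (-‿inverseʳ _) (+-monoˡ-≤ (- bound k) (∈⇒≤ x∈ k)))

    move-∈ : ∀ {t y} → (∀ k → (row k · v - bound k) + t * (row k · y) ≤ 0#) → v ⊕ t ⊛ y ∈ ⟦ P ⟧
    move-∈ {t} {y} valid = ≤⇒∈ λ k → 0≤-⇒≤ (≤-resp refl
      (trans (solve 3 (λ a b c → :- (a :- b :+ c) := b :- (a :+ c)) refl (row k · v) (bound k) (t * (row k · y)))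
             (+-congˡ (-‿cong (sym (·-⊕⊛ (row k) v t y)))))
      (0≤- (valid k)))

    at-v : ∀ k → row k · v - bound k ≤ 0#
    at-v k = ≤-resp refl (-‿inverseʳ _) (+-monoˡ-≤ (- bound k) (∈⇒≤ v∈ k))

    -- Active rows do not rise along `y` and the other rows have room, so `small-step` applies.
    Tangent⇒∈ : ∀ {y} → Tangent y → ∃ λ ε → 0# < ε × v ⊕ ε ⊛ y ∈ ⟦ P ⟧
    Tangent⇒∈ {y} y∈ =
      let ε , 0<ε , valid = small-step (λ _ → ⟦P⟧-row) (λ k → row k · v - bound k) (λ k → row k · y) (λ k _ → at-v k)
                              (λ k _ e → y∈ k (∈⟪⟫⁺ (begin
                                row k · v
                                  ≈⟨ solve 2 (λ a b → a := (a :- b) :+ b) refl (row k · v) (bound k) ⟩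
                                (row k · v - bound k) + bound k ≈⟨ +-congʳ e ⟩
                                0# + bound k                    ≈⟨ +-identityˡ _ ⟩
                                bound k                         ∎)))
      in ε , 0<ε , move-∈ (λ k → valid k _)
      where open import Data.Unit using () renaming (⊤ to ⟦P⟧-row)

    infix 4 _≼_
    _≼_ : Point (Fin n) → Point (Fin n) → Set
    y ≼ z = _≼[_]_ row y active z

    module _ (y : Point (Fin n)) where

      -- For `y` in the tangent cone, the smallest face of P that contains `v ⊕ ε ⊛ y` for small
      -- positive `ε`.
      localFace : Face
      localFace = rowFace (tight row active y)

      ∈localFace⁺ : ∀ {x} → x ∈ ⟦ P ⟧ → (x ⊖ v) ≼ y → x ∈ pointsOf localFace
      ∈localFace⁺ {x} x∈ x≼y = ∈rowFace⁺ (tight row active y) x∈ λ k k∈ →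
        let k-active , e = ∈⟪⟫⁻ k∈ in tight⇒row≈ x k-active (x≼y k k-active e)

      ∈localFace⁻ : ∀ {x} → x ∈ pointsOf localFace → (x ⊖ v) ≼ y
      ∈localFace⁻ {x} x∈ k k-active e = row≈⇒tight x k-active (∈rowFace⁻ (tight row active y) x∈ k (∈⟪⟫⁺ (k-active , e)))

    module _ (F : Face) (F-vertex : IsVertexAt F v) where

      -- A direction on which all active rows vanish can be followed both ways inside P. The
      -- functional of F is then constant along it, and since F contains `v` only, the direction is
      -- zero.
      vertex-pointed : Pointed row active
      vertex-pointed w w-tight i =
        let ε , 0<ε , ε∈ = Tangent⇒∈ {w} (λ k k∈ → ≤.reflexive (w-tight k k∈))
            η , 0<η , η∈ = Tangent⇒∈ {(- 1#) ⊛ w} (λ k k∈ → ≤.reflexive (trans (·-⊛ (row k) (- 1#) w)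
                             (trans (*-congˡ (w-tight k k∈)) (zeroʳ _))))
            cw≤0 = below ε w 0<ε ε∈
            0≤cw = ≤-resp refl (trans (-‿cong (·-⊛ c (- 1#) w)) (solve 1 (λ x → :- ((:- 1′) :* x) := x) refl (c · w)))
                     (0≤- (below η ((- 1#) ⊛ w) 0<η η∈))
            ∈F = proj₁ F-vertex (ε∈ , (begin
                  c · (v ⊕ ε ⊛ w)          ≈⟨ ·-⊕⊛ c v ε w ⟩
                  c · v + ε * (c · w)      ≈⟨ +-cong cv≈δ (*-congˡ (≤.antisym cw≤0 0≤cw)) ⟩
                  δ + ε * 0#               ≈⟨ solve 2 (λ d e → d :+ e :* 0′ := d) refl δ ε ⟩
                  δ                        ∎))
        in *-cancel-0 (<⇒≉ 0<ε ∘ sym) (begin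
            ε * w i                  ≈⟨ solve 2 (λ v x → x := (v :+ x) :- v) refl (v i) (ε * w i) ⟩
            (v i + ε * w i) - v i    ≈⟨ +-congʳ (∈F i) ⟨
            v i - v i                ≈⟨ -‿inverseʳ _ ⟩
            0#                       ∎)
        where
        c = Face.normal F
        δ = Face.offset F
        cv≈δ : c · v ≈ δ
        cv≈δ = proj₂ (proj₂ F-vertex ≋-refl)
        below : ∀ ε y → 0# < ε → v ⊕ ε ⊛ y ∈ ⟦ P ⟧ → c · y ≤ 0#
        below ε y 0<ε ∈P = ≤0-by-neg (0≤*⇒0≤ 0<ε (≤-resp refl (begin
          δ - c · (v ⊕ ε ⊛ y)              ≈⟨ +-cong (sym cv≈δ) (-‿cong (·-⊕⊛ c v ε y)) ⟩
          c · v - (c · v + ε * (c · y))    ≈⟨ solve 3 (λ a e b → a :- (a :+ e :* b) := e :* (:- b)) refl (c · v) ε (c · y) ⟩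
          ε * - (c · y)                    ∎) (≤⇒0≤- (Face.valid F _ ∈P))))

-- The face map at a vertex: rays and edges, spanned faces, ends of edges

module FaceMaps (em : ExcludedMiddle 0ℓ) (ℝ : CompleteOrderedField) {d n : ℕ} (P : Geometry.Polyhedron ℝ n)
                (dimension : Geometry.HasDimension ℝ (Geometry.⟦_⟧ ℝ P) d)
                (P′ : Geometry.Prism ℝ) (dimension′ : Geometry.HasDimension ℝ (Geometry.Prism.points P′) d)
                (f : Geometry.FaceMap ℝ P P′) where
  open Classical em
  open CompleteOrderedField ℝ hiding (zero)
  open RingSolver commutativeRing
  open Algebra.Properties.Semiring.Sum semiring using (sum)
  open OrderedField em ℝ
  open Vectors em ℝ
  open Cones em ℝ
  open Polyhedra em ℝ P
  open Prisms em ℝ P′ using (_∈ᵥ_; D; D≤dimension; neighbour; neighbour-surjective; coordinate; replacement;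
    vertexPoint-injective; vertexPoint-cong; face-⊆; isolated⇒IsVertexAt; nonempty⇒vertex; ∈ᵥ-resp; ≔-self;
    ∈⇒neighbours∈; neighbours∈⇒∈)
  open Geometry ℝ using (Point; _≋_; _·_; ⟦_⟧; module PolyhedronFaces; module PrismFaces; module FaceMap)
  open PolyhedronFaces P using (Face; IsVertexAt) renaming (points to pointsOf)
  open PrismFaces P′ using () renaming (IsVertexAt to IsVertexAt′; points to pointsOf′)
  open Geometry.Prism P′ using (U; _≗_; vertexPoint; Factors; _∈ᵇ_)
  open FaceMap f using (map; mono; injective)
  open Relation.Binary.Reasoning.Setoid setoid

  record Vertex (u : U) (v : Point (Fin n)) : Set where
    field
      face      : Face
      isVertex  : IsVertexAt face v
      isVertex′ : IsVertexAt′ (map face) (vertexPoint u)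

  Vertex-resp : ∀ {u w v} → u ≗ w → Vertex u v → Vertex w v
  Vertex-resp e V = record
    { Vertex V
    ; isVertex′ = (λ x∈ i → trans (sym (vertexPoint-cong e i)) (proj₁ (Vertex.isVertex′ V) x∈ i))
                , (λ ≋x → proj₂ (Vertex.isVertex′ V) λ i → trans (vertexPoint-cong e i) (≋x i))
    }

  Vertex-unique : ∀ {u x y} → Vertex u x → Vertex u y → x ≋ y
  Vertex-unique V W = proj₁ (Vertex.isVertex V) (proj₂ (injective
      ( (λ x∈ → proj₂ (Vertex.isVertex′ W) (proj₁ (Vertex.isVertex′ V) x∈))
      , (λ x∈ → proj₂ (Vertex.isVertex′ V) (proj₁ (Vertex.isVertex′ W) x∈)))) (proj₂ (Vertex.isVertex W) ≋-refl))

  Vertex-unique′ : ∀ {u w x} → Vertex u x → Vertex w x → u ≗ w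
  Vertex-unique′ V W = vertexPoint-injective (proj₁ (Vertex.isVertex′ V)
    (mono {Vertex.face W} {Vertex.face V} (λ x∈ → proj₂ (Vertex.isVertex V) (proj₁ (Vertex.isVertex W) x∈))
      (proj₂ (Vertex.isVertex′ W) (λ _ → refl))))

  Vertex-at : ∀ {u v w} → Vertex u v → v ≋ w → Vertex u w
  Vertex-at V e = record
    { Vertex V
    ; isVertex = (λ x∈ → ≋-trans (≋-sym e) (proj₁ (Vertex.isVertex V) x∈)) , (λ w≋ → proj₂ (Vertex.isVertex V) (≋-trans e w≋))
    }

  module Local {u : U} {v : Point (Fin n)} (V : Vertex u v) where
    open Vertex V renaming (face to F)

    v∈F : v ∈ pointsOf F
    v∈F = proj₂ isVertex ≋-refl

    open Tangent (proj₁ v∈F)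

    pointed : Pointed row active
    pointed = vertex-pointed F isVertex

    F⊆ : ∀ {G : Face} → v ∈ pointsOf G → pointsOf F ⊆ pointsOf G
    F⊆ {G} v∈G x∈ = face-resp G (proj₁ isVertex x∈) v∈G

    u∈ : ∀ {G : Face} → v ∈ pointsOf G → u ∈ᵥ map G
    u∈ {G} v∈G = mono {F} {G} (F⊆ {G} v∈G) (proj₂ isVertex′ (λ _ → refl))

    -- The edges of P′ at u, indexed by Fin D, that lie in the face f(G).
    edges : Face → Subset D
    edges G = ⟪ (λ a → neighbour u a ∈ᵥ map G) ⟫

    edges-mono : ∀ {G H : Face} → pointsOf G ⊆ pointsOf H → ∀ {a} → a ∈ₛ edges G → a ∈ₛ edges H
    edges-mono {G} {H} G⊆H a∈ = ∈⟪⟫⁺ (mono {G} {H} G⊆H (∈⟪⟫⁻ a∈))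

    edges-reflect : ∀ {G H : Face} → u ∈ᵥ map G → u ∈ᵥ map H → (∀ {a} → a ∈ₛ edges G → a ∈ₛ edges H) →
                    pointsOf′ (map G) ⊆ pointsOf′ (map H)
    edges-reflect {G} {H} u∈G u∈H G⇒H = face-⊆ (map G) (map H) u∈G u∈H lemma
      where
      lemma : ∀ i x → (u [ i ≔ x ]) ∈ᵥ map G → (u [ i ≔ x ]) ∈ᵥ map H
      lemma i x ∈G with x Fin.≟ u i
      ... | yes ≡.refl = ∈ᵥ-resp (map H) (λ k → ≡.sym (≔-self u i k)) u∈H
      ... | no x≢ with neighbour-surjective u i x x≢
      ...   | a , ≡.refl = ∈⟪⟫⁻ (G⇒H {a} (∈⟪⟫⁺ ∈G))

    -- Equal edge sets at `u` give equal images, and f is injective. Only the images are assumed to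
    -- pass through `u`: whether `v` lies in G or H can thus be a conclusion, as in `face-transfer`,
    -- or be refuted, as in `u∉W`.
    edges-injective : ∀ {G H : Face} → u ∈ᵥ map G → u ∈ᵥ map H →
                      (∀ {a} → a ∈ₛ edges G → a ∈ₛ edges H) → (∀ {a} → a ∈ₛ edges H → a ∈ₛ edges G) →
                      pointsOf G ≐ pointsOf H
    edges-injective {G} {H} u∈G u∈H G⇒H H⇒G =
      injective (edges-reflect {G} {H} u∈G u∈H G⇒H , edges-reflect {H} {G} u∈H u∈G H⇒G)

    edges-strict : ∀ {G H : Face} → v ∈ pointsOf G → pointsOf G ⊆ pointsOf H → ¬ (pointsOf H ⊆ pointsOf G) →
                   edges G ⊂ edges H
    edges-strict {G} {H} v∈G G⊆H ¬H⊆G = edges-mono {G} {H} G⊆H , by-contradiction λ ¬∃ →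
      ¬H⊆G (proj₂ (edges-injective {G} {H} (u∈ {G} v∈G) (u∈ {H} (G⊆H v∈G)) (edges-mono {G} {H} G⊆H)
        λ {a} a∈H → by-contradiction λ a∉G → ¬∃ (a , a∈H , a∉G)))

    v∈localFace : ∀ y → v ∈ pointsOf (localFace y)
    v∈localFace y = ∈localFace⁺ y (proj₁ v∈F) λ k _ _ → trans (·-⊖ (row k) v v) (-‿inverseʳ _)

    ray∈localFace : ∀ y {ε z} → v ⊕ ε ⊛ z ∈ ⟦ P ⟧ → z ≼ y → v ⊕ ε ⊛ z ∈ pointsOf (localFace y)
    ray∈localFace y {ε} {z} ∈P z≼y = ∈localFace⁺ y ∈P λ k k∈ e → begin
      row k · (v ⊕ ε ⊛ z ⊖ v)   ≈⟨ ·-cong (row k) (⊖v {t = ε} ≋-refl) ⟩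
      row k · (ε ⊛ z)           ≈⟨ ·-⊛ (row k) ε z ⟩
      ε * (row k · z)           ≈⟨ *-congˡ (z≼y k k∈ e) ⟩
      ε * 0#                    ≈⟨ zeroʳ ε ⟩
      0#                        ∎

    localFace-≼ : ∀ y {ε z} → 0# < ε → v ⊕ ε ⊛ z ∈ pointsOf (localFace y) → z ≼ y
    localFace-≼ y {ε} {z} 0<ε ∈G k k∈ e = *-cancel-0 (<⇒≉ 0<ε ∘ sym) (begin
      ε * (row k · z)           ≈⟨ ·-⊛ (row k) ε z ⟨
      row k · (ε ⊛ z)           ≈⟨ ·-cong (row k) (⊖v {t = ε} ≋-refl) ⟨
      row k · (v ⊕ ε ⊛ z ⊖ v)   ≈⟨ ∈localFace⁻ y ∈G k k∈ e ⟩
      0#                        ∎)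

    -- Makes the number of edges of the image a measure as `flag` requires it.
    localFace-strict : ∀ y y′ → Tangent y′ → y ≼ y′ → ¬ (y′ ≼ y) → edges (localFace y) ⊂ edges (localFace y′)
    localFace-strict y y′ y′∈ y≼y′ ¬y′≼y = edges-strict {localFace y} {localFace y′} (v∈localFace y)
      (λ x∈ → ∈localFace⁺ y′ (proj₁ x∈) λ k k∈ e → ∈localFace⁻ y x∈ k k∈ (y≼y′ k k∈ e))
      λ ⊇ → let ε , 0<ε , ∈P = Tangent⇒∈ y′∈ in
        ¬y′≼y (localFace-≼ y 0<ε (⊇ (ray∈localFace y′ ∈P λ _ _ e → e)))

    basePoints : Fin (suc d) → Point (Fin n)
    basePoints = proj₁ (proj₁ dimension)

    Spanning : ∀ {k} → (Fin k → Point (Fin n)) → Set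
    Spanning z = ∀ y → Tangent y → ∃ λ t → y ≋ lin t z

    basePoints-spanned : ∀ {k} (z : Fin k → Point (Fin n)) → Spanning z → ∀ j → ∃ λ t → basePoints j ≋ v ⊕ lin t z
    basePoints-spanned z spans j =
      let t , e = spans (basePoints j ⊖ v) (∈⇒Tangent (proj₁ (proj₂ (proj₁ dimension)) j))
      in t , λ i → trans (sym (v⊕ (basePoints j) i)) (+-congˡ (e i))

    spanning⇒d≤ : ∀ {k} (z : Fin k → Point (Fin n)) → Spanning z → d ℕ.≤ k
    spanning⇒d≤ z spans = ℕ.≤-pred (independent⇒≤ basePoints v z (proj₂ (proj₂ (proj₁ dimension))) (basePoints-spanned z spans))

    D≤d : D ℕ.≤ d
    D≤d = D≤dimension u dimension′

    IsRay : Pred (Point (Fin n)) 0ℓ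
    IsRay = Ray row active

    ray-multiple : ∀ z → IsRay z → ∀ w → w ≼ z → ∃ λ c → w ≋ c ⊛ z
    ray-multiple z ray w w≼z =
      let c , e = Ray.unique ray w w≼z
          w-cz = pointed (w ⊖ c ⊛ z) λ k k∈ → trans (·-⊖ (row k) w (c ⊛ z))
                   (trans (+-cong (e k k∈) (-‿cong (·-⊛ (row k) c z))) (-‿inverseʳ _))
      in c , λ i → trans (solve 2 (λ w x → w := (w :- x) :+ x) refl (w i) (c * z i))
                     (trans (+-congʳ (w-cz i)) (+-identityˡ _))

    -- A flag from v through the edge of P in direction z has at least d + 1
    -- faces besides the empty one, and its image has at most D + 1 ≤ d + 1.
    ray-edges≤1 : ∀ z → IsRay z → ∣ edges (localFace z) ∣ ℕ.≤ 1
    ray-edges≤1 z ray =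
      let r , b , spans , y , _ , φ≤ =
            flag row active (λ y → ∣ edges (localFace y) ∣)
              (λ y y′ _ y′∈ y≼y′ (k , k∈ , e , ≉0) → Subset.p⊂q⇒∣p∣<∣q∣ (localFace-strict y y′ y′∈ y≼y′ λ y′≼y → ≉0 (y′≼y k k∈ e)))
              z (Ray.in-cone ray) {1} (λ _ → z) multiples
          -- The flag ends with `r` generators that span the tangent cone, so D ≤ d ≤ r, and its
          -- last edge set has at most D elements. Cancelling D leaves at most one edge for the ray.
          φz+D≤1+D = ℕ.≤-trans (ℕ.+-monoʳ-≤ ∣ edges (localFace z) ∣ (ℕ.≤-trans D≤d (spanning⇒d≤ b spans)))
                       (ℕ.≤-trans φ≤ (ℕ.≤-trans (ℕ.+-monoˡ-≤ 1 (Subset.∣p∣≤n (edges (localFace y)))) (ℕ.≤-reflexive (ℕ.+-comm D 1))))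
      in ℕ.+-cancelʳ-≤ D _ 1 φz+D≤1+D
      where
      multiples : ∀ w → w ≼ z → ∃ λ (t : Fin 1 → Carrier) → w ≋ lin t (λ _ → z)
      multiples w w≼z =
        let c , e = ray-multiple z ray w w≼z in (λ _ → c) , λ i → trans (e i) (sym (+-identityʳ _))

    IsRayAt : Fin D → Pred (Point (Fin n)) 0ℓ
    IsRayAt a z = IsRay z × a ∈ₛ edges (localFace z)

    -- The face of a ray is strictly larger than the one for `𝟎`, so its image gains an edge.
    ray-has-edge : ∀ {z} → IsRay z → ∃ λ a → IsRayAt a z
    ray-has-edge {z} ray =
      let k , k∈ , ≉0 = Ray.non-zero ray
          _ , a , a∈ , _ = localFace-strict 𝟎 z (Ray.in-cone ray) (λ k _ _ → ·-𝟎 (row k)) λ z≼𝟎 → ≉0 (z≼𝟎 k k∈ (·-𝟎 (row k)))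
      in a , ray , a∈

    ray-edge-unique : ∀ {z a b} → IsRayAt a z → b ∈ₛ edges (localFace z) → a ≡ b
    ray-edge-unique {z} {a} {b} (ray , a∈) b∈ = by-contradiction λ a≢b →
      ℕ.<⇒≱ (ℕ.≤-<-trans (ℕ.≤-reflexive (≡.sym (Subset.∣⁅x⁆∣≡1 a)))
              (Subset.p⊂q⇒∣p∣<∣q∣ {p = ⁅ a ⁆} {q = edges (localFace z)}
                ((λ {c} c∈ → ≡.subst (_∈ₛ edges (localFace z)) (≡.sym (Subset.x∈⁅y⁆⇒x≡y a c∈)) a∈) ,
                 b , b∈ , λ b∈⁅a⁆ → a≢b (≡.sym (Subset.x∈⁅y⁆⇒x≡y a b∈⁅a⁆)))))
            (ray-edges≤1 z ray)

    -- Both images have `a` as their only edge at `u`, so the two faces coincide and the rays are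
    -- proportional. The factor is nonnegative because some active row is negative on `z` and not
    -- positive on `z′`.
    same-edge⇒multiple : ∀ {a z z′} → IsRayAt a z → IsRayAt a z′ → ∃ λ c → 0# ≤ c × z′ ≋ c ⊛ z
    same-edge⇒multiple {a} {z} {z′} r@(ray , a∈) r′@(ray′ , a∈′) = c , 0≤c , z′≋cz
      where
      same : pointsOf (localFace z) ≐ pointsOf (localFace z′)
      same = edges-injective {localFace z} {localFace z′} (u∈ {localFace z} (v∈localFace z)) (u∈ {localFace z′} (v∈localFace z′))
        (λ b∈ → ≡.subst (_∈ₛ edges (localFace z′)) (ray-edge-unique r b∈) a∈′)
        (λ b∈ → ≡.subst (_∈ₛ edges (localFace z)) (ray-edge-unique r′ b∈) a∈)
      z′≼z : z′ ≼ z
      z′≼z = let ε , 0<ε , ∈P = Tangent⇒∈ (Ray.in-cone ray′)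
             in localFace-≼ z 0<ε (proj₂ same (ray∈localFace z′ ∈P λ _ _ e → e))
      multiple = ray-multiple z ray z′ z′≼z
      c = proj₁ multiple
      z′≋cz = proj₂ multiple
      0≤c : 0# ≤ c
      0≤c = let k , k∈ , ≉0 = Ray.non-zero ray in
        0≤*⇒0≤ (0<- (≤∧≉⇒< (Ray.in-cone ray k k∈) ≉0)) (≤-resp refl (begin
          - (row k · z′)           ≈⟨ -‿cong (trans (·-cong (row k) z′≋cz) (·-⊛ (row k) c z)) ⟩
          - (c * (row k · z))      ≈⟨ solve 2 (λ c x → :- (c :* x) := (:- x) :* c) refl c (row k · z) ⟩
          - (row k · z) * c        ∎) (0≤- (Ray.in-cone ray′ k k∈)))

    -- An edge of P′ might still carry no ray and is then given `𝟎`. This case is excluded in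
    -- `direction-ray`, as an independent family does not contain `𝟎`.
    directions : ∀ a → ∃ λ z → (∀ {y} → IsRayAt a y → IsRayAt a z) × (¬ ∃ (IsRayAt a) → z ≡ 𝟎)
    directions a = pick (IsRayAt a) 𝟎

    direction : Fin D → Point (Fin n)
    direction a = proj₁ (directions a)

    direction-ray⁺ : ∀ {a z} → IsRayAt a z → IsRayAt a (direction a)
    direction-ray⁺ {a} {z} r = proj₁ (proj₂ (directions a)) {z} r

    direction-absent : ∀ {a} → ¬ (∃ (IsRayAt a)) → direction a ≋ 𝟎
    direction-absent {a} ¬∃ i = reflexive (≡.cong (λ z → z i) (proj₂ (proj₂ (directions a)) ¬∃))

    directions-generate : ∀ y → Tangent y → ∃ λ t → (∀ a → 0# ≤ t a) × y ≋ lin t direction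
    directions-generate = minkowski row active pointed K K-resp K-𝟎 K-ray
      where
      K : Pred (Point (Fin n)) 0ℓ
      K y = ∃ λ t → (∀ a → 0# ≤ t a) × y ≋ lin t direction
      K-resp : ∀ {x y} → x ≋ y → K x → K y
      K-resp x≋y (t , 0≤t , e) = t , 0≤t , ≋-trans (≋-sym x≋y) e
      K-𝟎 : K 𝟎
      K-𝟎 = (λ _ → 0#) , (λ _ → ≤.refl) , ≋-sym (lin-zero direction λ _ → refl)
      K-ray : ∀ y z s → K y → IsRay z → 0# ≤ s → K (y ⊕ s ⊛ z)
      K-ray y z s (t , 0≤t , e) ray 0≤s =
        let a , r = ray-has-edge ray
            c , 0≤c , z≋ = same-edge⇒multiple (direction-ray⁺ r) r
        in (λ b → t b + (s * c) * [ b ≟ a ]) ,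
           (λ b → 0≤+ (0≤t b) (*-nonNeg (*-nonNeg 0≤s 0≤c) (0≤≟ b a))) ,
           λ i → begin
             y i + s * z i                                                       ≈⟨ +-cong (e i) (*-congˡ (z≋ i)) ⟩
             lin t direction i + s * (c * direction a i)                         ≈⟨ +-congˡ (*-assoc s c _) ⟨
             lin t direction i + (s * c) * direction a i                         ≈⟨ +-congˡ (*-congˡ (lin-≟ a direction i)) ⟨
             lin t direction i + (s * c) * lin (λ b → [ b ≟ a ]) direction i
               ≈⟨ lin-⊕⊛ t (s * c) (λ b → [ b ≟ a ]) direction i ⟨
             lin (λ b → t b + (s * c) * [ b ≟ a ]) direction i                   ∎

    directions-span : Spanning direction
    directions-span y y∈ = let t , _ , e = directions-generate y y∈ in t , e

    -- The d + 1 affinely independent points of P lie in `v` plus the span of only D ≤ d directions,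
    -- which leaves no room for a relation between these.
    directions-independent : ∀ s → lin s direction ≋ 𝟎 → ∀ a → s a ≈ 0#
    directions-independent = spanning⇒independent basePoints v direction (proj₂ (proj₂ (proj₁ dimension)))
      (basePoints-spanned direction directions-span) (s≤s D≤d)

    direction-ray : ∀ a → IsRayAt a (direction a)
    direction-ray a = direction-ray⁺ (proj₂ (by-contradiction λ ¬∃ → 0≉1 (sym (begin
      1#         ≈⟨ ≟-same {i = a} ≡.refl ⟨
      [ a ≟ a ]  ≈⟨ directions-independent (λ b → [ b ≟ a ]) (≋-trans (lin-≟ a direction) (direction-absent ¬∃)) a ⟩
      0#         ∎))))

    direction∈ : ∀ a → Tangent (direction a)
    direction∈ a = Ray.in-cone (proj₁ (direction-ray a))

    -- Otherwise the sum of the other edge directions minus a small multiple of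
    -- direction a would be a nonnegative combination of all directions.
    facet : ∀ a → ∃ λ k → k ∈ₛ active × (∀ b → b ≢ a → row k · direction b ≈ 0#) × row k · direction a < 0#
    -- An active row that vanishes on `y` vanishes on all other directions, so without a facet row
    -- it is not negative on `direction a`. Hence a little of `direction a` can be subtracted from
    -- `y` within the tangent cone.
    facet a = by-contradiction λ ¬∃ → contradict
      (small-step (_∈ₛ active) (λ k → row k · y) (λ k → - (row k · direction a)) y≤0
        λ k k∈ e → -≤0 (by-contradiction λ <0 → ¬∃ (k , k∈ , others k k∈ e , <0)))
      where
      others-weight : Fin D → Carrier
      others-weight b = 1# - [ b ≟ a ]
      weight-other : ∀ {b} → b ≢ a → others-weight b ≈ 1#
      weight-other b≢a = trans (+-congˡ (-‿cong (≟-distinct b≢a))) (solve 0 (1′ :- 0′ := 1′) refl)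
      weight-self : others-weight a ≈ 0#
      weight-self = trans (+-congˡ (-‿cong (≟-same {i = a} ≡.refl))) (-‿inverseʳ 1#)
      0≤weight : ∀ b → 0# ≤ others-weight b
      0≤weight b with b Fin.≟ a
      ... | yes _ = ≤.reflexive (sym (-‿inverseʳ 1#))
      ... | no _  = ≤-resp refl (solve 0 (1′ := 1′ :- 0′) refl) 0≤1
      y : Point (Fin n)
      y = lin others-weight direction
      negated-sum : ∀ k → sum (λ b → - (others-weight b * (row k · direction b))) ≈ - (row k · y)
      negated-sum k = trans (sum-neg (λ b → others-weight b * (row k · direction b)))
        (-‿cong (sym (·-lin (row k) others-weight direction)))
      0≤term : ∀ k → k ∈ₛ active → ∀ b → 0# ≤ - (others-weight b * (row k · direction b))
      0≤term k k∈ b = 0≤- (*≤0 (0≤weight b) (direction∈ b k k∈))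
      y≤0 : ∀ k → k ∈ₛ active → row k · y ≤ 0#
      y≤0 k k∈ = ≤0-by-neg (≤-resp refl (negated-sum k) (sum-nonneg (0≤term k k∈)))
      others : ∀ k → k ∈ₛ active → row k · y ≈ 0# → ∀ b → b ≢ a → row k · direction b ≈ 0#
      others k k∈ e b b≢a = begin
        row k · direction b
          ≈⟨ solve 1 (λ x → x := :- (:- (1′ :* x))) refl (row k · direction b) ⟩
        - (- (1# * (row k · direction b)))               ≈⟨ -‿cong (-‿cong (*-congʳ (weight-other b≢a))) ⟨
        - (- (others-weight b * (row k · direction b)))
          ≈⟨ -‿cong (sum-nonneg-zero (0≤term k k∈) (trans (negated-sum k) (trans (-‿cong e) -0≈0)) b) ⟩
        - 0#                                             ≈⟨ -0≈0 ⟩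
        0#                                               ∎
        where
        -0≈0 : - 0# ≈ 0#
        -0≈0 = solve 0 (:- 0′ := 0′) refl
      contradict : ¬ (∃ λ ε → 0# < ε × (∀ k → k ∈ₛ active → row k · y + ε * - (row k · direction a) ≤ 0#))
      contradict (ε , 0<ε , valid) =
        let t , 0≤t , e = directions-generate (y ⊕ (- ε) ⊛ direction a) (λ k k∈ → ≤-resp
                            (trans (+-congˡ (solve 2 (λ e x → e :* (:- x) := (:- e) :* x) refl ε (row k · direction a)))
                                   (sym (·-⊕⊛ (row k) y (- ε) (direction a)))) refl (valid k k∈))
            -- The difference of the two representations of this vector; its coefficient at `a` is
            -- `- (ε + t a)`, which is negative.
            s : Fin D → Carrier
            s b = (others-weight b + (- ε) * [ b ≟ a ]) + (- 1#) * t b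
            sa≈0 = directions-independent s (λ i → begin
              lin s direction i
                ≈⟨ lin-⊕⊛ (λ b → others-weight b + (- ε) * [ b ≟ a ]) (- 1#) t direction i ⟩
              lin (λ b → others-weight b + (- ε) * [ b ≟ a ]) direction i + (- 1#) * lin t direction i
                ≈⟨ +-congʳ (lin-⊕⊛ others-weight (- ε) (λ b → [ b ≟ a ]) direction i) ⟩
              (y i + (- ε) * lin (λ b → [ b ≟ a ]) direction i) + (- 1#) * lin t direction i
                ≈⟨ +-cong (+-congˡ (*-congˡ (lin-≟ a direction i))) (*-congˡ (sym (e i))) ⟩
              (y i + (- ε) * direction a i) + (- 1#) * (y i + (- ε) * direction a i)
                ≈⟨ solve 1 (λ x → x :+ (:- 1′) :* x := 0′) refl _ ⟩
              0# ∎) a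
        in 0<+ 0<ε (0≤t a) (≤.reflexive (begin
             ε + t a
               ≈⟨ solve 2 (λ e t → e :+ t := :- ((0′ :+ (:- e) :* 1′) :+ (:- 1′) :* t)) refl ε (t a) ⟩
             - ((0# + (- ε) * 1#) + (- 1#) * t a)
               ≈⟨ -‿cong (+-congʳ (+-cong weight-self (*-congˡ (≟-same {i = a} ≡.refl)))) ⟨
             - s a                                              ≈⟨ -‿cong sa≈0 ⟩
             - 0#                                               ≈⟨ solve 0 (:- 0′ := 0′) refl ⟩
             0#                                                 ∎))

    facetRow : Fin D → Fin #rows
    facetRow a = proj₁ (facet a)

    -- The face of P spanned by the edges in J.
    face : Subset D → Face
    face J = rowFace ⟪ (λ k → ∃ λ a → ¬ (a ∈ₛ J) × k ≡ facetRow a) ⟫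

    ∈face⁺ : ∀ J {x} → x ∈ ⟦ P ⟧ → (∀ a → ¬ (a ∈ₛ J) → row (facetRow a) · (x ⊖ v) ≈ 0#) → x ∈ pointsOf (face J)
    ∈face⁺ J {x} x∈ tight-J = ∈rowFace⁺ _ x∈ λ k k∈ → on-row k (∈⟪⟫⁻ k∈)
      where
      on-row : ∀ k → (∃ λ a → ¬ (a ∈ₛ J) × k ≡ facetRow a) → row k · x ≈ bound k
      on-row _ (a , a∉J , ≡.refl) = tight⇒row≈ x (proj₁ (proj₂ (facet a))) (tight-J a a∉J)

    ∈face⁻ : ∀ J {x} → x ∈ pointsOf (face J) → ∀ a → ¬ (a ∈ₛ J) → row (facetRow a) · (x ⊖ v) ≈ 0#
    ∈face⁻ J {x} x∈ a a∉J = row≈⇒tight x (proj₁ (proj₂ (facet a))) (∈rowFace⁻ _ x∈ (facetRow a) (∈⟪⟫⁺ (a , a∉J , ≡.refl)))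

    -- The facet row of `a` vanishes on all directions but `direction a` and so reads off the
    -- coefficient at `a`; outside J this row is tight on the face.
    face-generated : ∀ J {x} → x ∈ pointsOf (face J) →
                     ∃ λ t → (∀ a → 0# ≤ t a) × (∀ a → ¬ (a ∈ₛ J) → t a ≈ 0#) × x ⊖ v ≋ lin t direction
    face-generated J {x} x∈ =
      let t , 0≤t , e = directions-generate (x ⊖ v) (∈⇒Tangent (proj₁ x∈))
      in t , 0≤t , (λ a a∉J → let _ , _ , zero-at , <0 = facet a in
           *-cancel-0 (<⇒≉ <0) (begin
             row (facetRow a) · direction a * t a       ≈⟨ *-comm _ _ ⟩
             t a * (row (facetRow a) · direction a)
               ≈⟨ sum-single (λ b → t b * (row (facetRow a) · direction b)) a (λ b b≢a → trans (*-congˡ (zero-at b b≢a)) (zeroʳ (t b))) ⟨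
             sum (λ b → t b * (row (facetRow a) · direction b))  ≈⟨ ·-lin (row (facetRow a)) t direction ⟨
             row (facetRow a) · lin t direction         ≈⟨ ·-cong (row (facetRow a)) e ⟨
             row (facetRow a) · (x ⊖ v)                 ≈⟨ ∈face⁻ J x∈ a a∉J ⟩
             0#                                         ∎)) , e

    v∈face : ∀ J → v ∈ pointsOf (face J)
    v∈face J = ∈face⁺ J (proj₁ v∈F) λ a _ → trans (·-⊖ (row (facetRow a)) v v) (-‿inverseʳ _)

    face-mono : ∀ {J K} → (∀ {a} → a ∈ₛ J → a ∈ₛ K) → pointsOf (face J) ⊆ pointsOf (face K)
    face-mono {J} {K} J⊆K x∈ = ∈face⁺ K (proj₁ x∈) λ a a∉K → ∈face⁻ J x∈ a (a∉K ∘ J⊆K)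

    ray∈face⁺ : ∀ J a → a ∈ₛ J → ∀ {t} → v ⊕ t ⊛ direction a ∈ ⟦ P ⟧ → v ⊕ t ⊛ direction a ∈ pointsOf (face J)
    ray∈face⁺ J a a∈J {t} ∈P = ∈face⁺ J ∈P λ b b∉J → let _ , _ , zero-at , _ = facet b in begin
      row (facetRow b) · (v ⊕ t ⊛ direction a ⊖ v)   ≈⟨ ·-cong (row (facetRow b)) (⊖v {t = t} ≋-refl) ⟩
      row (facetRow b) · (t ⊛ direction a)           ≈⟨ ·-⊛ (row (facetRow b)) t (direction a) ⟩
      t * (row (facetRow b) · direction a)           ≈⟨ *-congˡ (zero-at a λ { ≡.refl → b∉J a∈J }) ⟩
      t * 0#                                         ≈⟨ zeroʳ t ⟩
      0#                                             ∎

    face-strict : ∀ J a → ¬ (a ∈ₛ J) → ∃ λ ε → v ⊕ ε ⊛ direction a ∈ ⟦ P ⟧ × ¬ (v ⊕ ε ⊛ direction a ∈ pointsOf (face J))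
    face-strict J a a∉J =
      let ε , 0<ε , ∈P = Tangent⇒∈ (direction∈ a)
          _ , _ , _ , <0 = facet a
      in ε , ∈P , λ ∈G → *-≉0 (<⇒≉ 0<ε ∘ sym) (<⇒≉ <0) (begin
           ε * (row (facetRow a) · direction a)           ≈⟨ ·-⊛ (row (facetRow a)) ε (direction a) ⟨
           row (facetRow a) · (ε ⊛ direction a)           ≈⟨ ·-cong (row (facetRow a)) (⊖v {t = ε} ≋-refl) ⟨
           row (facetRow a) · (v ⊕ ε ⊛ direction a ⊖ v)   ≈⟨ ∈face⁻ J ∈G a a∉J ⟩
           0#                                             ∎)

    localFace⊆face : ∀ J a → a ∈ₛ J → pointsOf (localFace (direction a)) ⊆ pointsOf (face J)
    localFace⊆face J a a∈J x∈ = ∈face⁺ J (proj₁ x∈) λ b b∉J →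
      let _ , k∈ , zero-at , _ = facet b in ∈localFace⁻ (direction a) x∈ (facetRow b) k∈ (zero-at a λ { ≡.refl → b∉J a∈J })

    edges-face⁺ : ∀ J {a} → a ∈ₛ J → a ∈ₛ edges (face J)
    edges-face⁺ J {a} a∈J = edges-mono {localFace (direction a)} {face J} (localFace⊆face J a a∈J) (proj₂ (direction-ray a))

    with-edge : Subset D → Fin D → Subset D
    with-edge J a = ⟪ (λ b → b ∈ₛ J ⊎ b ≡ a) ⟫

    -- If `a` were an edge of the image, the faces spanned by J and by J with `a` would have images
    -- with the same edges at `u`, hence would coincide, against `face-strict`.
    edges-face-step : ∀ J a → ¬ (a ∈ₛ J) → (∀ {b} → b ∈ₛ edges (face (with-edge J a)) → b ∈ₛ with-edge J a) →
                      ¬ (a ∈ₛ edges (face J))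
    edges-face-step J a a∉J edges⊆J⁺ a∈ =
      let ε , ∈P , ∉face = face-strict J a a∉J
      in ∉face (proj₂ same (ray∈face⁺ J⁺ a (∈⟪⟫⁺ (inj₂ ≡.refl)) {ε} ∈P))
      where
      J⁺ : Subset D
      J⁺ = with-edge J a
      back : ∀ {b} → b ∈ₛ J ⊎ b ≡ a → b ∈ₛ edges (face J)
      back (inj₁ b∈)     = edges-face⁺ J b∈
      back (inj₂ ≡.refl) = a∈
      same : pointsOf (face J) ≐ pointsOf (face J⁺)
      same = edges-injective {face J} {face J⁺} (u∈ {face J} (v∈face J)) (u∈ {face J⁺} (v∈face J⁺))
        (edges-mono {face J} {face J⁺} (face-mono {J} {J⁺} λ b∈ → ∈⟪⟫⁺ (inj₁ b∈)))
        (λ b∈ → back (∈⟪⟫⁻ (edges⊆J⁺ b∈)))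

    with-edge-size : ∀ J a → ¬ (a ∈ₛ J) → ∣ J ∣ ℕ.< ∣ with-edge J a ∣
    with-edge-size J a a∉J =
      Subset.p⊂q⇒∣p∣<∣q∣ {p = J} {q = with-edge J a} ((λ b∈ → ∈⟪⟫⁺ (inj₁ b∈)) , a , ∈⟪⟫⁺ (inj₂ ≡.refl) , a∉J)

    -- Induction on the number of edges missing from J, which `fuel` exceeds: the claim for J
    -- follows from the claim for J with one more edge.
    edges-face-bounded : ∀ fuel J → D ℕ.< ∣ J ∣ ℕ.+ fuel → ∀ {a} → a ∈ₛ edges (face J) → a ∈ₛ J
    edges-face-bounded zero    J D< a∈ =
      contradiction (Subset.∣p∣≤n J) (ℕ.<⇒≱ (ℕ.<-≤-trans D< (ℕ.≤-reflexive (ℕ.+-identityʳ _))))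
    edges-face-bounded (suc fuel) J D< {a} a∈ = by-contradiction λ a∉J →
      edges-face-step J a a∉J
        (edges-face-bounded fuel (with-edge J a)
          (ℕ.<-≤-trans D< (ℕ.≤-trans (ℕ.≤-reflexive (ℕ.+-suc ∣ J ∣ fuel)) (ℕ.+-monoˡ-≤ fuel (with-edge-size J a a∉J)))))
        a∈

    edges-face⁻ : ∀ J {a} → a ∈ₛ edges (face J) → a ∈ₛ J
    edges-face⁻ J = edges-face-bounded (suc D) J (ℕ.≤-trans (s≤s (ℕ.m≤n+m D ∣ J ∣)) (ℕ.≤-reflexive (≡.sym (ℕ.+-suc ∣ J ∣ D))))

    -- Every coordinate in which `w` differs from `u` provides an edge of the face at `u`, which
    -- must be `a`; so only one coordinate changes.
    edge-vertex : ∀ {G a} → u ∈ᵥ map G → (∀ {b} → b ∈ₛ edges G → a ≡ b) →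
                  ∀ w → w ∈ᵥ map G → ¬ (w ≗ u) → w ≗ neighbour u a
    edge-vertex {G} {a} u∈G only w w∈G w≢u =
      let i , wi≢ = ¬∀⇒∃¬ w≢u in moved i (differs i wi≢)
      where
      found : ∀ {p} → (∃ λ b → (coordinate b , replacement u b) ≡ p) → (u [ proj₁ p ≔ proj₂ p ]) ∈ᵥ map G →
              (coordinate a , replacement u a) ≡ p
      found (b , ≡.refl) b∈ = ≡.cong (λ b → coordinate b , replacement u b) (only (∈⟪⟫⁺ b∈))
      differs : ∀ i → w i ≢ u i → (coordinate a , replacement u a) ≡ (i , w i)
      differs i wi≢ = found (neighbour-surjective u i (w i) wi≢) (∈⇒neighbours∈ (map G) u∈G w w∈G i)
      moved : ∀ i → (coordinate a , replacement u a) ≡ (i , w i) → w ≗ neighbour u a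
      moved i e = ≔-all (λ k x → w k ≡ x) u (coordinate a) (replacement u a)
        (λ k k≢ → by-contradiction λ wk≢ → k≢ (≡.sym (≡.cong proj₁ (differs k wk≢))))
        (≡.subst (λ p → w (proj₁ p) ≡ proj₂ p) (≡.sym e) ≡.refl)

    Recession : Pred (Point (Fin n)) 0ℓ
    Recession z = ∀ k → row k · z ≤ 0#

    ray-≉v : ∀ {z t} → IsRay z → 0# < t → ¬ (v ≋ v ⊕ t ⊛ z)
    ray-≉v {z} {t} ray 0<t e = let k , _ , ≉0 = Ray.non-zero ray in
      ≉0 (trans (·-cong (row k) (λ i → *-cancel-0 (<⇒≉ 0<t ∘ sym) (begin
        t * z i                 ≈⟨ solve 2 (λ v x → x := (v :+ x) :- v) refl (v i) (t * z i) ⟩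
        (v i + t * z i) - v i   ≈⟨ +-congʳ (e i) ⟨
        v i - v i               ≈⟨ -‿inverseʳ _ ⟩
        0#                      ∎))) (·-𝟎 (row k)))

    -- The end of a bounded edge, where the constraint k stops it.
    module EdgeEnd (a : Fin D) (t : Carrier) (k : Fin #rows) (0<t : 0# < t) (0<slope : 0# < row k · direction a)
                   (tight-k : (row k · v - bound k) + t * (row k · direction a) ≈ 0#)
                   (w∈P : v ⊕ t ⊛ direction a ∈ ⟦ P ⟧) where
      z w : Point (Fin n)
      z = direction a
      w = v ⊕ t ⊛ z

      ray : IsRay z
      ray = proj₁ (direction-ray a)

      constraints : Subset #rows
      constraints = ⟪ (λ l → l ∈ₛ tight row active z ⊎ l ≡ k) ⟫

      G W : Face
      G = localFace z
      W = rowFace constraints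

      W⊆G : pointsOf W ⊆ pointsOf G
      W⊆G = rowFace-anti λ l∈ → ∈⟪⟫⁺ (inj₁ l∈)

      w∈G : w ∈ pointsOf G
      w∈G = ray∈localFace z w∈P λ _ _ e → e

      w∈W : w ∈ pointsOf W
      w∈W = ∈rowFace⁺ constraints w∈P λ l l∈ → on-row l (∈⟪⟫⁻ l∈)
        where
        on-row : ∀ l → l ∈ₛ tight row active z ⊎ l ≡ k → row l · w ≈ bound l
        on-row l (inj₁ l∈)     = ∈rowFace⁻ (tight row active z) w∈G l l∈
        on-row l (inj₂ ≡.refl) = begin
          row k · w                                                 ≈⟨ ·-⊕⊛ (row k) v t z ⟩
          row k · v + t * (row k · z)
            ≈⟨ solve 3 (λ a b c → a :+ c := (a :- b :+ c) :+ b) refl _ (bound k) _ ⟩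
          ((row k · v - bound k) + t * (row k · z)) + bound k       ≈⟨ +-congʳ tight-k ⟩
          0# + bound k                                              ≈⟨ +-identityˡ _ ⟩
          bound k                                                   ∎

      W-only : ∀ {x} → x ∈ pointsOf W → w ≋ x
      W-only {x} x∈ = λ i → begin
        v i + t * z i           ≈⟨ +-congˡ (*-congʳ t≈c) ⟩
        v i + c * z i           ≈⟨ +-congˡ (e i) ⟨
        v i + (x i - v i)       ≈⟨ v⊕ x i ⟩
        x i                     ∎
        where
        multiple = ray-multiple z ray (x ⊖ v) (∈localFace⁻ z (W⊆G x∈))
        c = proj₁ multiple
        e = proj₂ multiple
        t≈c : t ≈ c
        t≈c = begin
          t              ≈⟨ solve 2 (λ t c → t := c :+ (t :- c)) refl t c ⟩
          c + (t - c)    ≈⟨ +-congˡ (*-cancel-0 (<⇒≉ 0<slope ∘ sym) (begin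
            row k · z * (t - c)
              ≈⟨ solve 5 (λ s t c a b → s :* (t :- c) := ((a :- b) :+ t :* s) :- (a :+ c :* s :- b)) refl (row k · z) t c (row k · v) (bound k) ⟩
            ((row k · v - bound k) + t * (row k · z)) - (row k · v + c * (row k · z) - bound k)
              ≈⟨ +-cong tight-k (-‿cong (+-congʳ (begin
                   row k · v + c * (row k · z)   ≈⟨ ·-⊕⊛ (row k) v c z ⟨
                   row k · (v ⊕ c ⊛ z)           ≈⟨ ·-cong (row k) (λ i → trans (+-congˡ (sym (e i))) (v⊕ x i)) ⟩
                   row k · x                     ≈⟨ ∈rowFace⁻ constraints x∈ k (∈⟪⟫⁺ (inj₂ ≡.refl)) ⟩
                   bound k                       ∎))) ⟩
            0# - (bound k - bound k)
              ≈⟨ solve 1 (λ b → 0′ :- (b :- b) := 0′) refl (bound k) ⟩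
            0# ∎)) ⟩
          c + 0#         ≈⟨ +-identityʳ c ⟩
          c              ∎

      v≉w : ¬ (v ≋ w)
      v≉w = ray-≉v {z} {t} ray 0<t

      u∈G : u ∈ᵥ map G
      u∈G = u∈ {G} (v∈localFace z)

      -- If the image of W contained `u`, its only possible edge at `u` would be `a`. With this edge
      -- W equals G and contains `v`; without it W equals F and cannot contain `w`. Both contradict
      -- that `v` and `w` differ.
      u∉W : ¬ (u ∈ᵥ map W)
      u∉W u∈W = cases (em {a ∈ₛ edges W})
        where
        cases : Dec (a ∈ₛ edges W) → ⊥
        cases (yes a∈) = v≉w (≋-sym (W-only (proj₂
          (edges-injective {W} {G} u∈W u∈G (edges-mono {W} {G} W⊆G)
            λ b∈ → ≡.subst (_∈ₛ edges W) (ray-edge-unique (direction-ray a) b∈) a∈) (v∈localFace z))))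
        cases (no a∉) = v≉w (proj₁ isVertex (proj₁
          (edges-injective {W} {F} u∈W (u∈ {F} v∈F)
            (λ {b} b∈ → ⊥-elim (a∉ (≡.subst (_∈ₛ edges W) (≡.sym (ray-edge-unique (direction-ray a) (edges-mono {W} {G} W⊆G b∈))) b∈)))
            λ {b} b∈ → ⊥-elim (Fin.punchInᵢ≢i (u (coordinate b)) _
              (≡.sym (≡.trans (vertexPoint-injective (proj₁ isVertex′ (∈⟪⟫⁻ b∈)) (coordinate b)) (≔-same u (coordinate b) (replacement u b))))))
          w∈W))

      W-vertices : ∀ x → x ∈ᵥ map W → x ≗ neighbour u a
      W-vertices x x∈W = edge-vertex {G} {a} u∈G (ray-edge-unique (direction-ray a)) x (mono {W} {G} W⊆G x∈W)
        λ x≗u → u∉W (∈ᵥ-resp (map W) x≗u x∈W)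

      -- The image of the empty face lies below that of W. If the latter were empty, the two would
      -- coincide, and W would be empty by injectivity.
      W-nonempty : ∃ λ x → x ∈ᵥ map W
      W-nonempty = nonempty⇒vertex (map W) (proj₂ (by-contradiction λ ¬∃ → ∉∅-face (proj₁
        (injective {W} {∅-face} ((λ {x} x∈ → ⊥-elim (¬∃ (x , x∈))) , mono {∅-face} {W} λ x∈ → ⊥-elim (∉∅-face x∈))) w∈W)))

      end : Vertex (neighbour u a) w
      end = record
        { face      = W
        ; isVertex  = W-only , λ e → face-resp W e w∈W
        ; isVertex′ = isolated⇒IsVertexAt (map W)
            (∈ᵥ-resp (map W) (W-vertices (proj₁ W-nonempty) (proj₂ W-nonempty)) (proj₂ W-nonempty))
            λ i x x≢ x∈W → x≢ (≡.trans (≡.sym (≔-same (neighbour u a) i x)) (W-vertices _ x∈W i))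
        }

    -- Either no row rises along the edge, or the ratio test stops it. The distance is then
    -- positive, because the rows active at `v` do not rise in a tangent direction.
    edge-end : ∀ a → Recession (direction a) ⊎ (∃ λ t → 0# < t × Vertex (neighbour u a) (v ⊕ t ⊛ direction a))
    edge-end a = bounded (em {∃ λ k → 0# < row k · direction a})
      where
      End : Set
      End = ∃ λ t → 0# < t × Vertex (neighbour u a) (v ⊕ t ⊛ direction a)
      arrive : (∃ λ t → 0# ≤ t ×
                  (∃ λ k → Unit × 0# < row k · direction a ×
                           (row k · v - bound k) + t * (row k · direction a) ≈ 0#) ×
                  (∀ k → Unit → (row k · v - bound k) + t * (row k · direction a) ≤ 0#)) → End
      arrive (t , 0≤t , (k , _ , 0<slope , tight-k) , valid) =
        t , 0<t , EdgeEnd.end a t k 0<t 0<slope tight-k (move-∈ {t} {direction a} λ k → valid k _)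
        where
        0<t : 0# < t
        0<t = ≤∧≉⇒< 0≤t λ 0≈t → 0<slope (direction∈ a k (∈⟪⟫⁺ (begin
          row k · v
            ≈⟨ solve 3 (λ a b s → a := (a :- b :+ 0′ :* s) :+ b) refl _ (bound k) (row k · direction a) ⟩
          ((row k · v - bound k) + 0# * (row k · direction a)) + bound k
                                                        ≈⟨ +-congʳ (+-congˡ (*-congʳ 0≈t)) ⟩
          ((row k · v - bound k) + t * (row k · direction a)) + bound k
                                                        ≈⟨ +-congʳ tight-k ⟩
          0# + bound k                                  ≈⟨ +-identityˡ _ ⟩
          bound k                                       ∎)))
      bounded : Dec (∃ λ k → 0# < row k · direction a) → Recession (direction a) ⊎ End
      bounded (no ¬∃) = inj₁ λ k → by-contradiction λ 0<slope → ¬∃ (k , 0<slope)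
      bounded (yes (k , 0<slope)) =
        inj₂ (arrive (walk (λ _ → Unit) (λ k → row k · v - bound k) (λ k → row k · direction a)
          (λ k _ → at-v k) (k , unit , 0<slope)))

    boxEdges : Factors → Subset D
    boxEdges B = ⟪ (λ a → replacement u a ∈ₛ B (coordinate a)) ⟫

    box⊆face : ∀ B w → w ∈ᵇ B → w ∈ᵥ map (face (boxEdges B))
    box⊆face B w w∈B = neighbours∈⇒∈ (map (face (boxEdges B))) u∈J w λ i → along i (w i Fin.≟ u i)
      where
      u∈J : u ∈ᵥ map (face (boxEdges B))
      u∈J = u∈ {face (boxEdges B)} (v∈face (boxEdges B))
      found : ∀ {p} → (∃ λ b → (coordinate b , replacement u b) ≡ p) → proj₂ p ∈ₛ B (proj₁ p) →
              (u [ proj₁ p ≔ proj₂ p ]) ∈ᵥ map (face (boxEdges B))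
      found (b , ≡.refl) ∈B = ∈⟪⟫⁻ (edges-face⁺ (boxEdges B) (∈⟪⟫⁺ ∈B))
      along : ∀ i → Dec (w i ≡ u i) → (u [ i ≔ w i ]) ∈ᵥ map (face (boxEdges B))
      along i (yes e) = ≡.subst (λ x → (u [ i ≔ x ]) ∈ᵥ map (face (boxEdges B))) (≡.sym e)
                          (∈ᵥ-resp (map (face (boxEdges B))) (λ k → ≡.sym (≔-self u i k)) u∈J)
      along i (no wi≢) = found (neighbour-surjective u i (w i) wi≢) (w∈B i)

  -- Seen from two of its vertices, a face is spanned by edges in two ways.
  face-transfer : ∀ {u v w x} (V : Vertex u v) (W : Vertex w x) J → w ∈ᵥ map (Local.face V J) →
                  pointsOf (Local.face V J) ≐ pointsOf (Local.face W (Local.edges W (Local.face V J)))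
  face-transfer V W J w∈ = Local.edges-injective W {G} {Local.face W K} w∈ (Local.u∈ W {Local.face W K} (Local.v∈face W K))
    (Local.edges-face⁺ W K) (Local.edges-face⁻ W K)
    where
    G = Local.face V J
    K = Local.edges W G

  -- The step from the image back to P: described from `w`, the face is spanned by edges at `x` and
  -- so contains `x`.
  vertex∈face : ∀ {u v w x} (V : Vertex u v) (W : Vertex w x) J → w ∈ᵥ map (Local.face V J) → x ∈ pointsOf (Local.face V J)
  vertex∈face V W J w∈ = proj₂ (face-transfer V W J w∈) (Local.v∈face W (Local.edges W (Local.face V J)))

-- Lexicographic signs of vectors

module Lexicographic (em : ExcludedMiddle 0ℓ) (ℝ : CompleteOrderedField) where
  open Classical em
  open CompleteOrderedField ℝ hiding (zero)
  open RingSolver commutativeRing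
  open OrderedField em ℝ
  open Vectors em ℝ
  open Geometry ℝ using (Point; _≋_; _·_)
  open Relation.Binary.Reasoning.Setoid setoid

  LexPositive : ∀ {k} → Point (Fin k) → Set
  LexPositive {zero}  y = ⊥
  LexPositive {suc k} y = 0# < y zero ⊎ (y zero ≈ 0# × LexPositive (y ∘ suc))

  LexPositive-resp : ∀ {k} {x y : Point (Fin k)} → x ≋ y → LexPositive x → LexPositive y
  LexPositive-resp {suc k} e (inj₁ 0<x)       = inj₁ (<-resp refl (e zero) 0<x)
  LexPositive-resp {suc k} e (inj₂ (x≈0 , p)) = inj₂ (trans (sym (e zero)) x≈0 , LexPositive-resp (e ∘ suc) p)

  LexPositive-⊕ : ∀ {k} {x y : Point (Fin k)} → LexPositive x → LexPositive y → LexPositive (x ⊕ y)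
  LexPositive-⊕ {suc k} (inj₁ 0<x) (inj₁ 0<y) = inj₁ (0<+ 0<x (<⇒≤ 0<y))
  LexPositive-⊕ {suc k} (inj₁ 0<x) (inj₂ (y≈0 , _)) = inj₁ (0<+ 0<x (≤.reflexive (sym y≈0)))
  LexPositive-⊕ {suc k} (inj₂ (x≈0 , _)) (inj₁ 0<y) = inj₁ (<-resp refl (+-comm _ _) (0<+ 0<y (≤.reflexive (sym x≈0))))
  LexPositive-⊕ {suc k} (inj₂ (x≈0 , p)) (inj₂ (y≈0 , q)) =
    inj₂ (trans (+-cong x≈0 y≈0) (+-identityʳ 0#) , LexPositive-⊕ p q)

  LexPositive-⊛ : ∀ {k} {t} {x : Point (Fin k)} → 0# < t → LexPositive x → LexPositive (t ⊛ x)
  LexPositive-⊛ {suc k} 0<t (inj₁ 0<x)       = inj₁ (0<* 0<t 0<x)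
  LexPositive-⊛ {suc k} 0<t (inj₂ (x≈0 , p)) = inj₂ (trans (*-congˡ x≈0) (zeroʳ _) , LexPositive-⊛ 0<t p)

  LexPositive-≋𝟎 : ∀ {k} {x : Point (Fin k)} → LexPositive x → ¬ (x ≋ 𝟎)
  LexPositive-≋𝟎 {suc k} (inj₁ 0<x)     e = 0<x (≤.reflexive (e zero))
  LexPositive-≋𝟎 {suc k} (inj₂ (_ , p)) e = LexPositive-≋𝟎 p (e ∘ suc)

  LexPositive-total : ∀ {k} (x : Point (Fin k)) → LexPositive x ⊎ x ≋ 𝟎 ⊎ LexPositive ((- 1#) ⊛ x)
  LexPositive-total {zero}  x = inj₂ (inj₁ λ ())
  LexPositive-total {suc k} x = cases (em {x zero ≈ 0#}) (LexPositive-total (x ∘ suc))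
    where
    neg : ∀ {c} → (- 1#) * c ≈ - c
    neg {c} = solve 1 (λ c → (:- 1′) :* c := :- c) refl c
    cases : Dec (x zero ≈ 0#) → LexPositive (x ∘ suc) ⊎ x ∘ suc ≋ 𝟎 ⊎ LexPositive ((- 1#) ⊛ (x ∘ suc)) →
            LexPositive x ⊎ x ≋ 𝟎 ⊎ LexPositive ((- 1#) ⊛ x)
    cases (yes x≈0) (inj₁ p)        = inj₁ (inj₂ (x≈0 , p))
    cases (yes x≈0) (inj₂ (inj₁ e)) = inj₂ (inj₁ λ { zero → x≈0 ; (suc i) → e i })
    cases (yes x≈0) (inj₂ (inj₂ p)) = inj₂ (inj₂ (inj₂ (trans (*-congˡ x≈0) (zeroʳ _) , p)))
    cases (no x≉0)  _               = [ (λ 0≤x → inj₁ (inj₁ (≤∧≉⇒< 0≤x (x≉0 ∘ sym))))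
                                      , (λ x≤0 → inj₂ (inj₂ (inj₁ (<-resp refl (sym neg) (0<- (≤∧≉⇒< x≤0 x≉0)))))) ]′
                                      (≤.total 0# (x zero))

  -- The functional c, with ties broken lexicographically.
  module Order {n : ℕ} (c : Point (Fin n)) where

    -- With `y` itself appended, only `𝟎` has no sign, so distinct vertices are never tied.
    -- Positivity is still preserved by sums and positive multiples, like the sign of a functional.
    Positive NonNegative : Pred (Point (Fin n)) 0ℓ
    Positive y    = LexPositive (c · y ∷ᵥ y)
    NonNegative y = y ≋ 𝟎 ⊎ Positive y

    private
      ∷-cong : ∀ {a b} {x y : Point (Fin n)} → a ≈ b → x ≋ y → (a ∷ᵥ x) ≋ (b ∷ᵥ y)
      ∷-cong a≈b x≋y zero    = a≈b
      ∷-cong a≈b x≋y (suc i) = x≋y i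

      ∷-⊕ : ∀ a b (x y : Point (Fin n)) → (a ∷ᵥ x) ⊕ (b ∷ᵥ y) ≋ (a + b) ∷ᵥ (x ⊕ y)
      ∷-⊕ a b x y zero    = refl
      ∷-⊕ a b x y (suc i) = refl

      ∷-⊛ : ∀ t a (x : Point (Fin n)) → t ⊛ (a ∷ᵥ x) ≋ (t * a) ∷ᵥ (t ⊛ x)
      ∷-⊛ t a x zero    = refl
      ∷-⊛ t a x (suc i) = refl

    Positive-resp : ∀ {x y} → x ≋ y → Positive x → Positive y
    Positive-resp e = LexPositive-resp (∷-cong (·-cong c e) e)

    Positive-⊕ : ∀ {x y} → Positive x → Positive y → Positive (x ⊕ y)
    Positive-⊕ {x} {y} p q = LexPositive-resp
      (≋-trans (∷-⊕ (c · x) (c · y) x y) (∷-cong (sym (·-⊕ c x y)) ≋-refl)) (LexPositive-⊕ {x = c · x ∷ᵥ x} {c · y ∷ᵥ y} p q)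

    Positive-⊛ : ∀ {t x} → 0# < t → Positive x → Positive (t ⊛ x)
    Positive-⊛ {t} {x} 0<t p = LexPositive-resp
      (≋-trans (∷-⊛ t (c · x) x) (∷-cong (sym (·-⊛ c t x)) ≋-refl)) (LexPositive-⊛ {x = c · x ∷ᵥ x} 0<t p)

    Positive-≋𝟎 : ∀ {x} → Positive x → ¬ (x ≋ 𝟎)
    Positive-≋𝟎 {x} p e = LexPositive-≋𝟎 {x = c · x ∷ᵥ x} p λ { zero → trans (·-cong c e) (·-𝟎 c) ; (suc i) → e i }

    Positive-total : ∀ x → Positive x ⊎ x ≋ 𝟎 ⊎ Positive ((- 1#) ⊛ x)
    Positive-total x = cases (LexPositive-total (c · x ∷ᵥ x))
      where
      cases : LexPositive (c · x ∷ᵥ x) ⊎ (c · x ∷ᵥ x) ≋ 𝟎 ⊎ LexPositive ((- 1#) ⊛ (c · x ∷ᵥ x)) →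
              Positive x ⊎ x ≋ 𝟎 ⊎ Positive ((- 1#) ⊛ x)
      cases (inj₁ p)        = inj₁ p
      cases (inj₂ (inj₁ e)) = inj₂ (inj₁ (e ∘ suc))
      cases (inj₂ (inj₂ p)) = inj₂ (inj₂ (LexPositive-resp
        (≋-trans (∷-⊛ (- 1#) (c · x) x) (∷-cong (sym (·-⊛ c (- 1#) x)) ≋-refl)) p))

    NonNegative-resp : ∀ {x y} → x ≋ y → NonNegative x → NonNegative y
    NonNegative-resp e (inj₁ x≋𝟎) = inj₁ (≋-trans (≋-sym e) x≋𝟎)
    NonNegative-resp e (inj₂ p)   = inj₂ (Positive-resp e p)

    Positive-⊕-NonNegative : ∀ {x y} → Positive x → NonNegative y → Positive (x ⊕ y)
    Positive-⊕-NonNegative {x} p (inj₁ e) = Positive-resp (λ i → sym (trans (+-congˡ (e i)) (+-identityʳ (x i)))) p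
    Positive-⊕-NonNegative     p (inj₂ q) = Positive-⊕ p q

    NonNegative-⊕ : ∀ {x y} → NonNegative x → NonNegative y → NonNegative (x ⊕ y)
    NonNegative-⊕ {x} {y} (inj₁ e) q = NonNegative-resp (λ i → sym (trans (+-congʳ (e i)) (+-identityˡ (y i)))) q
    NonNegative-⊕         (inj₂ p) q = inj₂ (Positive-⊕-NonNegative p q)

    -- The sign of `x` is requested for nonzero `t` only, to suit combinations whose coefficients
    -- vanish outside a given set of edges.
    NonNegative-⊛ : ∀ {t x} → 0# ≤ t → (¬ (t ≈ 0#) → NonNegative x) → NonNegative (t ⊛ x)
    NonNegative-⊛ {t} {x} 0≤t 0≤x = cases (em {t ≈ 0#})
      where
      cases : Dec (t ≈ 0#) → NonNegative (t ⊛ x)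
      cases (yes t≈0) = inj₁ λ i → trans (*-congʳ t≈0) (zeroˡ (x i))
      cases (no t≉0)  = scale (0≤x t≉0)
        where
        scale : NonNegative x → NonNegative (t ⊛ x)
        scale (inj₁ e) = inj₁ λ i → trans (*-congˡ (e i)) (zeroʳ t)
        scale (inj₂ p) = inj₂ (Positive-⊛ (≤∧≉⇒< 0≤t (t≉0 ∘ sym)) p)

    NonNegative-lin : ∀ {k} (t : Fin k → Carrier) (z : Fin k → Point (Fin n)) →
                      (∀ j → 0# ≤ t j) → (∀ j → ¬ (t j ≈ 0#) → NonNegative (z j)) → NonNegative (lin t z)
    NonNegative-lin {zero}  t z 0≤t 0≤z = inj₁ λ i → refl
    NonNegative-lin {suc k} t z 0≤t 0≤z =
      NonNegative-⊕ (NonNegative-⊛ (0≤t zero) (0≤z zero)) (NonNegative-lin (t ∘ suc) (z ∘ suc) (0≤t ∘ suc) (0≤z ∘ suc))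

    opposite-signs : ∀ {x} → NonNegative x → ¬ Positive ((- 1#) ⊛ x)
    opposite-signs {x} q p = Positive-≋𝟎 (Positive-⊕-NonNegative p q)
      λ i → solve 1 (λ x → (:- 1′) :* x :+ x := 0′) refl (x i)

    ¬NonNegative⇒Positive : ∀ {x} → ¬ NonNegative x → Positive ((- 1#) ⊛ x)
    ¬NonNegative⇒Positive {x} ¬q = cases (Positive-total x)
      where
      cases : Positive x ⊎ x ≋ 𝟎 ⊎ Positive ((- 1#) ⊛ x) → Positive ((- 1#) ⊛ x)
      cases (inj₁ p)        = contradiction (inj₂ p) ¬q
      cases (inj₂ (inj₁ e)) = contradiction (inj₁ e) ¬q
      cases (inj₂ (inj₂ p)) = p

    -- The lexicographic order is not Archimedean, so the argument that excludes rays has to return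
    -- to the values of `c`.
    NonNegative⇒0≤ : ∀ {x} → NonNegative x → 0# ≤ c · x
    NonNegative⇒0≤ (inj₁ e)              = ≤.reflexive (sym (trans (·-cong c e) (·-𝟎 c)))
    NonNegative⇒0≤ (inj₂ (inj₁ 0<))      = <⇒≤ 0<
    NonNegative⇒0≤ (inj₂ (inj₂ (e , _))) = ≤.reflexive (sym e)

-- The sweep of b(P) by a functional

module PrismLike (em : ExcludedMiddle 0ℓ) (ℝ : CompleteOrderedField) {d n : ℕ} (P : Geometry.Polyhedron ℝ n)
                 (dimension : Geometry.HasDimension ℝ (Geometry.⟦_⟧ ℝ P) d)
                 (P′ : Geometry.Prism ℝ) (dimension′ : Geometry.HasDimension ℝ (Geometry.Prism.points P′) d)
                 (f : Geometry.FaceMap ℝ P P′) where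
  open Classical em
  open CompleteOrderedField ℝ hiding (zero)
  open RingSolver commutativeRing
  open Algebra.Properties.Semiring.Sum semiring using (sum)
  open OrderedField em ℝ
  open Vectors em ℝ
  open Cones em ℝ
  open Lexicographic em ℝ
  open Polyhedra em ℝ P
  open Prisms em ℝ P′ using (_∈ᵥ_; D; neighbour; neighbour-surjective; coordinate; replacement; ≔-self)
  open FaceMaps em ℝ P dimension P′ dimension′ f
  open Geometry ℝ using (Point; _≋_; _·_; ⟦_⟧; b; module PolyhedronFaces; module FaceMap)
  open PolyhedronFaces P using (Face) renaming (points to pointsOf)
  open Geometry.Prism P′ using (U; _≗_; _∈ᵇ_)
  open FaceMap f using (map)
  open Relation.Binary.Reasoning.Setoid setoid

  S : Pred U 0ℓ
  S = b P′ f

  ∈S⇒Vertex : ∀ {u} → u ∈ S → ∃ (Vertex u)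
  ∈S⇒Vertex (F , (v , isVertex) , isVertex′) = v , record { face = F ; isVertex = isVertex ; isVertex′ = isVertex′ }

  Vertex⇒∈S : ∀ {u v} → Vertex u v → u ∈ S
  Vertex⇒∈S {v = v} V = Vertex.face V , (v , Vertex.isVertex V) , Vertex.isVertex′ V

  IncreasingOnRays : Point (Fin n) → Set
  IncreasingOnRays c = ∀ {u v} (V : Vertex u v) a → Local.Recession V (Local.direction V a) → 0# < c · Local.direction V a

  -- The normal of a supporting hyperplane of P that meets P in a vertex only.
  increasing-functional : ∀ {u} → u ∈ S → ∃ IncreasingOnRays
  increasing-functional {u₀} u₀∈S = (λ i → - c i) , increasing
    where
    V₀ : ∃ (Vertex u₀)
    V₀ = ∈S⇒Vertex u₀∈S
    v₀ : Point (Fin n)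
    v₀ = proj₁ V₀
    F : Face
    F = Vertex.face (proj₂ V₀)
    c : Point (Fin n)
    c = Face.normal F
    v₀∈F : v₀ ∈ pointsOf F
    v₀∈F = proj₂ (Vertex.isVertex (proj₂ V₀)) λ _ → refl
    increasing : IncreasingOnRays (λ i → - c i)
    -- A recession direction can be followed from `v₀` as well. If `c` did not decrease along it,
    -- `w` would lie on the supporting hyperplane, which meets P in `v₀` only.
    increasing V a recession = <-resp refl (sym (·-neg c z)) (0<- λ 0≤cz → absurd 0≤cz)
      where
      z : Point (Fin n)
      z = Local.direction V a
      w : Point (Fin n)
      w = v₀ ⊕ 1# ⊛ z
      w∈P : w ∈ ⟦ P ⟧
      w∈P = ≤⇒∈ λ k → ≤-resp (sym (·-⊕⊛ (row k) v₀ 1# z)) (+-identityʳ _)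
        (+-mono-≤ (∈⇒≤ (proj₁ v₀∈F) k) (*≤0 0≤1 (recession k)))
      absurd : ¬ (0# ≤ c · z)
      absurd 0≤cz = ≉0 (trans (·-cong (row k) z≋𝟎) (·-𝟎 (row k)))
        where
        k = proj₁ (Ray.non-zero (proj₁ (Local.direction-ray V a)))
        ≉0 = proj₂ (proj₂ (Ray.non-zero (proj₁ (Local.direction-ray V a))))
        w∈F : w ∈ pointsOf F
        w∈F = w∈P , ≤.antisym (Face.valid F w w∈P)
          (≤-resp (trans (+-identityʳ _) (proj₂ v₀∈F)) (sym (·-⊕⊛ c v₀ 1# z)) (+-mono-≤ ≤.refl (*-nonNeg 0≤1 0≤cz)))
        z≋𝟎 : z ≋ 𝟎
        z≋𝟎 i = begin
          z i                      ≈⟨ solve 2 (λ v z → z := (v :+ 1′ :* z) :- v) refl (v₀ i) (z i) ⟩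
          w i - v₀ i               ≈⟨ +-congʳ (proj₁ (Vertex.isVertex (proj₂ V₀)) w∈F i) ⟨
          v₀ i - v₀ i              ≈⟨ -‿inverseʳ _ ⟩
          0#                       ∎

  module _ (c : Point (Fin n)) (increasing : IncreasingOnRays c) where
    open Order c

    _≺_ : U → U → Set
    u ≺ w = ∃ λ x → ∃ λ y → Vertex u x × Vertex w y × Positive (y ⊖ x)

    ≺⇒Positive : ∀ {u w x y} → Vertex u x → Vertex w y → u ≺ w → Positive (y ⊖ x)
    ≺⇒Positive X Y (x′ , y′ , X′ , Y′ , p) =
      Positive-resp (λ i → +-cong (Vertex-unique Y′ Y i) (-‿cong (Vertex-unique X′ X i))) p

    ⊖-neg : ∀ (x y : Point (Fin n)) → (- 1#) ⊛ (x ⊖ y) ≋ y ⊖ x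
    ⊖-neg x y i = solve 2 (λ x y → (:- 1′) :* (x :- y) := y :- x) refl (x i) (y i)

    ¬≺ : ∀ {u w x y} → Vertex u x → Vertex w y → NonNegative (x ⊖ y) → ¬ (u ≺ w)
    ¬≺ {x = x} {y} X Y q u≺w = opposite-signs q (Positive-resp (≋-sym (⊖-neg x y)) (≺⇒Positive X Y u≺w))

    S-resp : ∀ {u w} → u ≗ w → u ∈ S → w ∈ S
    S-resp e u∈S = Vertex⇒∈S (Vertex-resp e (proj₂ (∈S⇒Vertex u∈S)))

    module _ {u : U} {v : Point (Fin n)} (V : Vertex u v) where
      open Local V

      neighbour-on-edge : ∀ a {x} → Vertex (neighbour u a) x → ∃ λ t → 0# ≤ t × x ⊖ v ≋ t ⊛ direction a
      neighbour-on-edge a {x} X =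
        let x∈ = vertex∈face V X ⁅ a ⁆ (∈⟪⟫⁻ (edges-face⁺ ⁅ a ⁆ (Subset.x∈⁅x⁆ a)))
            t , 0≤t , t≈0 , e = face-generated ⁅ a ⁆ x∈
        in t a , 0≤t a , λ i → trans (e i) (sum-single (λ b → t b * direction b i) a
             (λ b b≢a → trans (*-congʳ (t≈0 b (λ b∈ → b≢a (Subset.x∈⁅y⁆⇒x≡y a b∈)))) (zeroˡ _)))

      face-above : ∀ J → (∀ a → a ∈ₛ J → NonNegative (direction a)) → ∀ {x} → x ∈ pointsOf (face J) → NonNegative (x ⊖ v)
      face-above J above x∈ =
        let t , 0≤t , t≈0 , e = face-generated J x∈
        in NonNegative-resp (≋-sym e) (NonNegative-lin t direction 0≤t
             λ a t≉0 → above a (by-contradiction λ a∉J → t≉0 (t≈0 a a∉J)))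

      face-below : ∀ J → (∀ a → a ∈ₛ J → NonNegative ((- 1#) ⊛ direction a)) → ∀ {x} → x ∈ pointsOf (face J) → NonNegative (v ⊖ x)
      face-below J below {x} x∈ =
        let t , 0≤t , t≈0 , e = face-generated J x∈
        in NonNegative-resp
             (λ i → begin
               sum (λ a → t a * ((- 1#) * direction a i))
                 ≈⟨ sum-cong (λ a → solve 2 (λ t z → t :* ((:- 1′) :* z) := :- (t :* z)) refl (t a) (direction a i)) ⟩
               sum (λ a → - (t a * direction a i))   ≈⟨ sum-neg (λ a → t a * direction a i) ⟩
               - lin t direction i                   ≈⟨ -‿cong (e i) ⟨
               - (x i - v i)                         ≈⟨ solve 2 (λ x v → :- (x :- v) := v :- x) refl (x i) (v i) ⟩
               v i - x i                             ∎)
             (NonNegative-lin t (λ a → (- 1#) ⊛ direction a) 0≤t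
               λ a t≉0 → below a (by-contradiction λ a∉J → t≉0 (t≈0 a a∉J)))

      -- On the face `c` is at most `c · v`, whereas it grows without bound along the ray.
      no-ray-below : ∀ J → (∀ {x} → x ∈ pointsOf (face J) → NonNegative (v ⊖ x)) →
                     ∀ {x z} → x ∈ pointsOf (face J) → 0# < c · z → ¬ (∀ t → 0# ≤ t → x ⊕ t ⊛ z ∈ pointsOf (face J))
      no-ray-below J below {x} {z} x∈ 0<cz ray⊆ = 0<1 (≤0-by-neg (≤-resp refl (begin
          c · (v ⊖ (x ⊕ t ⊛ z))               ≈⟨ ·-⊖ c v (x ⊕ t ⊛ z) ⟩
          c · v - c · (x ⊕ t ⊛ z)             ≈⟨ +-congˡ (-‿cong (·-⊕⊛ c x t z)) ⟩
          c · v - (c · x + t * (c · z))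
            ≈⟨ solve 3 (λ a b d → a :- (b :+ d) := (a :- b) :- d) refl (c · v) (c · x) (t * (c · z)) ⟩
          (c · v - c · x) - t * (c · z)       ≈⟨ +-cong (sym (·-⊖ c v x)) (-‿cong t-cz) ⟩
          h - (h + 1#)                        ≈⟨ solve 1 (λ h → h :- (h :+ 1′) := :- 1′) refl h ⟩
          - 1#                                ∎)
          (NonNegative⇒0≤ (below (ray⊆ t 0≤t)))))
        where
        -- `h` is the room left for `c` between `x` and `v`; after length `t` the functional exceeds
        -- `c · v` by 1.
        h t : Carrier
        h = c · (v ⊖ x)
        t = (h + 1#) * (c · z) ⁻¹
        0≤t : 0# ≤ t
        0≤t = *-nonNeg (0≤+ (NonNegative⇒0≤ (below x∈)) 0≤1) (<⇒≤ (0<⁻¹ 0<cz))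
        t-cz : t * (c · z) ≈ h + 1#
        t-cz = begin
          (h + 1#) * (c · z) ⁻¹ * (c · z)
            ≈⟨ solve 3 (λ h i z → h :* i :* z := h :* (z :* i)) refl (h + 1#) ((c · z) ⁻¹) (c · z) ⟩
          (h + 1#) * (c · z * (c · z) ⁻¹)     ≈⟨ *-congˡ (⁻¹-inverse (<⇒≉ 0<cz ∘ sym)) ⟩
          (h + 1#) * 1#                       ≈⟨ *-identityʳ _ ⟩
          h + 1#                              ∎

    descending-box : ∀ u B → u ∈ S → u ∈ᵇ B →
                     (∀ i x → x ∈ₛ B i → x ≢ u i → (u [ i ≔ x ]) ∈ S × (u [ i ≔ x ]) ≺ u) →
                     ∀ w → w ∈ᵇ B → w ∈ S × ¬ (u ≺ w)
    descending-box u B u∈S u∈B descends w w∈B =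
      w∈S , ¬≺ V (proj₂ (∈S⇒Vertex w∈S)) (below (vertex∈face V (proj₂ (∈S⇒Vertex w∈S)) J (box⊆face B w w∈B)))
      where
      v : Point (Fin n)
      v = proj₁ (∈S⇒Vertex u∈S)
      V : Vertex u v
      V = proj₂ (∈S⇒Vertex u∈S)
      open Local V
      J : Subset D
      J = boxEdges B
      edge-below : ∀ a → a ∈ₛ J → NonNegative ((- 1#) ⊛ direction a)
      edge-below a a∈J = inj₂ (¬NonNegative⇒Positive λ q → opposite-signs
          (NonNegative-resp (≋-sym e) (NonNegative-⊛ 0≤t λ _ → q))
          (Positive-resp (≋-sym (⊖-neg x v)) (≺⇒Positive X V (proj₂ down))))
        where
        down : neighbour u a ∈ S × neighbour u a ≺ u
        down = descends (coordinate a) (replacement u a) (∈⟪⟫⁻ a∈J) (Fin.punchInᵢ≢i (u (coordinate a)) _)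
        x : Point (Fin n)
        x = proj₁ (∈S⇒Vertex (proj₁ down))
        X : Vertex (neighbour u a) x
        X = proj₂ (∈S⇒Vertex (proj₁ down))
        on-edge = neighbour-on-edge V a X
        0≤t = proj₁ (proj₂ on-edge)
        e = proj₂ (proj₂ on-edge)
      below : ∀ {x} → x ∈ pointsOf (face J) → NonNegative (v ⊖ x)
      below = face-below V J edge-below
      -- By `face-transfer`, an edge of the box at any vertex reached so far belongs to the face
      -- spanned at `v`. It is not unbounded, by `no-ray-below`, so it ends in a vertex of P that is
      -- sent to the next vertex of the box.
      closed : ∀ w i x → w ∈ S → w ∈ᵇ B → x ∈ₛ B i → (w [ i ≔ x ]) ∈ S
      closed w i x w∈S w∈B x∈B = along (x Fin.≟ w i)
        where
        y : Point (Fin n)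
        y = proj₁ (∈S⇒Vertex w∈S)
        W : Vertex w y
        W = proj₂ (∈S⇒Vertex w∈S)
        w∈J : w ∈ᵥ map (face J)
        w∈J = box⊆face B w w∈B
        K : Subset D
        K = Local.edges W (face J)
        transfer = face-transfer V W J w∈J
        ends : ∀ {p} → (∃ λ a → (coordinate a , replacement w a) ≡ p) → proj₂ p ∈ₛ B (proj₁ p) → (w [ proj₁ p ≔ proj₂ p ]) ∈ S
        ends (a , ≡.refl) a∈B = end (Local.edge-end W a)
          where
          a∈K : a ∈ₛ K
          a∈K = ∈⟪⟫⁺ (box⊆face B (neighbour w a)
            (≔-all (λ k x → x ∈ₛ B k) w (coordinate a) (replacement w a) (λ k _ → w∈B k) a∈B))
          end : Local.Recession W (Local.direction W a) ⊎
                (∃ λ t → 0# < t × Vertex (neighbour w a) (y ⊕ t ⊛ Local.direction W a)) →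
                neighbour w a ∈ S
          end (inj₂ (_ , _ , X))  = Vertex⇒∈S X
          end (inj₁ recession) = contradiction
            (λ t 0≤t → proj₂ transfer (Local.ray∈face⁺ W K a a∈K {t} (≤⇒∈ λ k →
              ≤-resp (sym (·-⊕⊛ (row k) y t (Local.direction W a))) (+-identityʳ _)
                (+-mono-≤ (∈⇒≤ (proj₁ (Local.v∈F W)) k) (*≤0 0≤t (recession k))))))
            (no-ray-below V J below (vertex∈face V W J w∈J) (increasing W a recession))
        along : Dec (x ≡ w i) → (w [ i ≔ x ]) ∈ S
        along (yes ≡.refl) = S-resp (λ k → ≡.sym (≔-self w i k)) w∈S
        along (no x≢)      = ends (neighbour-surjective w i x x≢) x∈B
      w∈S : w ∈ S
      w∈S = ∈-box S-resp B u u∈S u∈B closed w w∈B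

    -- Unbounded edges of the box at `u` ascend by the choice of `c`, and a bounded one ends at a
    -- neighbour in b(P), to which minimality applies. So the whole face spanned by these edges lies
    -- above `v`.
    local-minimum : ∀ u B → u ∈ S → u ∈ᵇ B →
                    (∀ i x → x ∈ₛ B i → (u [ i ≔ x ]) ∈ S → ¬ ((u [ i ≔ x ]) ≺ u)) →
                    ∀ w → w ∈ᵇ B → w ∈ S → ¬ (w ≺ u)
    local-minimum u B u∈S u∈B minimal w w∈B w∈S =
      ¬≺ (proj₂ (∈S⇒Vertex w∈S)) V (face-above V J edge-above (vertex∈face V (proj₂ (∈S⇒Vertex w∈S)) J (box⊆face B w w∈B)))
      where
      v : Point (Fin n)
      v = proj₁ (∈S⇒Vertex u∈S)
      V : Vertex u v
      V = proj₂ (∈S⇒Vertex u∈S)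
      open Local V
      J : Subset D
      J = boxEdges B
      edge-above : ∀ a → a ∈ₛ J → NonNegative (direction a)
      edge-above a a∈J = end (edge-end a)
        where
        end : Recession (direction a) ⊎ (∃ λ t → 0# < t × Vertex (neighbour u a) (v ⊕ t ⊛ direction a)) →
              NonNegative (direction a)
        end (inj₁ recession)     = inj₂ (inj₁ (increasing V a recession))
        end (inj₂ (t , 0<t , X)) = by-contradiction λ ¬q →
          minimal (coordinate a) (replacement u a) (∈⟪⟫⁻ a∈J) (Vertex⇒∈S X)
            (_ , _ , X , V , Positive-resp
              (λ i → solve 3 (λ v t z → t :* ((:- 1′) :* z) := v :- (v :+ t :* z)) refl (v i) t (direction a i))
              (Positive-⊛ 0<t (¬NonNegative⇒Positive ¬q)))

    sweep : IsSweep S _≺_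
    sweep = record
      { S-resp         = S-resp
      ; ≺-respˡ        = λ { e (x , y , X , Y , p) → x , y , Vertex-resp e X , Y , p }
      ; ≺-respʳ        = λ { e (x , y , X , Y , p) → x , y , X , Vertex-resp e Y , p }
      ; ≺-irrefl       = λ { (x , y , X , Y , p) → Positive-≋𝟎 p λ i → trans (+-congʳ (Vertex-unique Y X i)) (-‿inverseʳ _) }
      ; ≺-trans        = λ { (x , y , X , Y , p) (y′ , z , Y′ , Z , q) → x , z , X , Z , Positive-resp
          (λ i → trans (+-congʳ (+-congˡ (-‿cong (Vertex-unique Y′ Y i))))
                       (solve 3 (λ x y z → (z :- y) :+ (y :- x) := z :- x) refl (x i) (y i) (z i)))
          (Positive-⊕ q p) }
      ; ≺-total        = total
      ; descending-box = descending-box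
      ; local-minimum  = local-minimum
      }
      where
      total : ∀ u w → u ∈ S → w ∈ S → u ≺ w ⊎ u ≗ w ⊎ w ≺ u
      total u w u∈S w∈S = cases (Positive-total (y ⊖ x))
        where
        x = proj₁ (∈S⇒Vertex u∈S)
        X = proj₂ (∈S⇒Vertex u∈S)
        y = proj₁ (∈S⇒Vertex w∈S)
        Y = proj₂ (∈S⇒Vertex w∈S)
        cases : Positive (y ⊖ x) ⊎ (y ⊖ x) ≋ 𝟎 ⊎ Positive ((- 1#) ⊛ (y ⊖ x)) → u ≺ w ⊎ u ≗ w ⊎ w ≺ u
        cases (inj₁ p)        = inj₁ (x , y , X , Y , p)
        cases (inj₂ (inj₂ p)) = inj₂ (inj₂ (y , x , Y , X , Positive-resp (⊖-neg y x) p))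
        cases (inj₂ (inj₁ e)) = inj₂ (inj₁ (Vertex-unique′ X (Vertex-at Y λ i → begin
          y i                ≈⟨ solve 2 (λ x y → y := (y :- x) :+ x) refl (x i) (y i) ⟩
          (y i - x i) + x i  ≈⟨ +-congʳ (e i) ⟩
          0# + x i           ≈⟨ +-identityˡ _ ⟩
          x i                ∎)))

  -- P may have no vertices, as a line does; then there is no supporting hyperplane at a vertex from
  -- which to obtain `c`.
  empty-sweep : ¬ (∃ λ u → u ∈ S) → IsSweep S (λ _ _ → ⊥)
  empty-sweep ¬∃ = record
    { S-resp         = λ {u} _ u∈S → contradiction (u , u∈S) ¬∃
    ; ≺-respˡ        = λ _ ()
    ; ≺-respʳ        = λ _ ()
    ; ≺-irrefl       = λ ()
    ; ≺-trans        = λ ()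
    ; ≺-total        = λ u _ u∈S _ → contradiction (u , u∈S) ¬∃
    ; descending-box = λ u _ u∈S _ _ _ _ → contradiction (u , u∈S) ¬∃
    ; local-minimum  = λ _ _ _ _ _ _ _ _ ()
    }

  exists-sweep : Dec (∃ λ u → u ∈ S) → ∃ (IsSweep S)
  exists-sweep (yes (_ , u∈S)) = let c , increasing = increasing-functional u∈S in _ , sweep c increasing
  exists-sweep (no ¬∃)         = _ , empty-sweep ¬∃

theorem17 : ExcludedMiddle 0ℓ → (ℝ : CompleteOrderedField) →
    let open Geometry ℝ in
    (d n : ℕ) (P : Polyhedron n) → IsPrismLike d P →
    (P′ : Prism) → HasDimension (Prism.points P′) d →
    (f : FaceMap P P′) →
    Prism.Ample P′ (b P′ f) × Prism.CornerPeeling P′ (b P′ f)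
theorem17 em ℝ d n P prismLike P′ dimension′ f =
  -- Every simplex has a first vertex, so U is inhabited.
  Sweep.ample em _ (proj₂ sweep) (λ _ → zero) , Sweep.corner-peeling em _ (proj₂ sweep)
  where
  sweep : ∃ (IsSweep (Geometry.b ℝ P′ f))
  sweep = PrismLike.exists-sweep em ℝ P (Geometry.IsPrismLike.dimension prismLike) P′ dimension′ f em
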